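{- There is a string $\mathrm{MILL}1$ grammar whose generated language is NP-complete.
   Context: $\mathrm{MILL}1$ is first-order multiplicative intuitionistic linear logic (formulas from atoms $p(x_1,\dots,x_n)$ — no function symbols or constants — with $\otimes,\multimap,\exists,\forall$; standard sequent calculus with multiset antecedent and single succedent). $\mathrm{FVar}(A)$: free variables; $A[h]$: substitution. Fix two distinct variables $\mathbf{s},\mathbf{t}$. A string $\mathrm{MILL}1$ grammar is $\langle T,S,\triangleright\rangle$ with $T$ a finite alphabet, $S$ a formula with $\mathrm{FVar}(S)\subseteq\{\mathbf{s},\mathbf{t}\}$, $\triangleright\subseteq T\times\mathrm{Fm}$ a finite relation with $a\triangleright A\Rightarrow\mathrm{FVar}(A)\subseteq\{\mathbf{s},\mathbf{t}\}$. It generates the string $a_1\dots a_n$ iff there are formulas $A_i$ with $a_i\triangleright A_i$ such that $A_1[x_0/\mathbf{s},x_1/\mathbf{t}],\dots,A_n[x_{n-1}/\mathbf{s},x_n/\mathbf{t}]\vdash S[x_0/\mathbf{s},x_n/\mathbf{t}]$ is derivable in $\mathrm{MILL}1$ for distinct variables $x_0,\dots,x_n$. -}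

module Defs where

open import Data.Nat using (ℕ; zero; suc; _<_; _≤_; _*_; _^_; _≟_)
open import Data.Fin using (Fin)
open import Data.Bool using (Bool; true; if_then_else_)
open import Data.Maybe using (Maybe; just; nothing)
open import Data.Product using (Σ; ∃; _×_; _,_; proj₁)
open import Data.Sum using (_⊎_; inj₁; inj₂)
open import Data.Unit using (⊤)
open import Data.Empty using (⊥)
open import Data.List using (List; []; _∷_; _++_; map; length; concatMap)
open import Data.List.Membership.Propositional using (_∈_; _∉_)
open import Data.List.Relation.Unary.All using (All)
open import Data.List.Relation.Binary.Pointwise using (Pointwise)
open import Data.List.Relation.Binary.Permutation.Propositional using (_↭_)
open import Relation.Binary.PropositionalEquality using (_≡_; _≢_)
open import Relation.Nullary using (does)
open import Function.Bundles using (_⇔_)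

-- MILL1 syntax (locally nameless: free variables are names in ℕ,
-- bound variables are de Bruijn indices). No function symbols, no
-- constants: terms are variables only.

data Tm : Set where
  fv : ℕ → Tm
  bv : ℕ → Tm

infixr 6 _⊗_
infixr 5 _⊸_

data Fm : Set where
  atom : ℕ → List Tm → Fm
  _⊗_  : Fm → Fm → Fm
  _⊸_  : Fm → Fm → Fm
  ex   : Fm → Fm
  all  : Fm → Fm

fvTm : Tm → List ℕ
fvTm (fv x) = x ∷ []
fvTm (bv _) = []

fvs : Fm → List ℕ
fvs (atom p ts) = concatMap fvTm ts
fvs (A ⊗ B) = fvs A ++ fvs B
fvs (A ⊸ B) = fvs A ++ fvs B
fvs (ex A) = fvs A
fvs (all A) = fvs A

fvsCtx : List Fm → List ℕ
fvsCtx = concatMap fvs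

LCTm : ℕ → Tm → Set
LCTm d (fv _) = ⊤
LCTm d (bv j) = j < d

LC : ℕ → Fm → Set
LC d (atom p ts) = All (LCTm d) ts
LC d (A ⊗ B) = LC d A × LC d B
LC d (A ⊸ B) = LC d A × LC d B
LC d (ex A) = LC (suc d) A
LC d (all A) = LC (suc d) A

openTm : ℕ → ℕ → Tm → Tm
openTm i x (fv y) = fv y
openTm i x (bv j) = if does (j ≟ i) then fv x else bv j

openAt : ℕ → ℕ → Fm → Fm
openAt i x (atom p ts) = atom p (map (openTm i x) ts)
openAt i x (A ⊗ B) = openAt i x A ⊗ openAt i x B
openAt i x (A ⊸ B) = openAt i x A ⊸ openAt i x B
openAt i x (ex A) = ex (openAt (suc i) x A)
openAt i x (all A) = all (openAt (suc i) x A)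

_[_] : Fm → ℕ → Fm
A [ y ] = openAt 0 y A

renTm : (ℕ → ℕ) → Tm → Tm
renTm h (fv x) = fv (h x)
renTm h (bv j) = bv j

ren : (ℕ → ℕ) → Fm → Fm
ren h (atom p ts) = atom p (map (renTm h) ts)
ren h (A ⊗ B) = ren h A ⊗ ren h B
ren h (A ⊸ B) = ren h A ⊸ ren h B
ren h (ex A) = ex (ren h A)
ren h (all A) = all (ren h A)

-- MILL1 sequent calculus (antecedent a multiset: list + exchange)

infix 3 _⊢_

data _⊢_ : List Fm → Fm → Set where
  ax   : ∀ {A} → (A ∷ []) ⊢ A
  cut  : ∀ {Γ Δ A C} → Γ ⊢ A → (A ∷ Δ) ⊢ C → (Γ ++ Δ) ⊢ C
  exch : ∀ {Γ Δ C} → Γ ↭ Δ → Γ ⊢ C → Δ ⊢ C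
  ⊗L   : ∀ {Γ A B C} → (A ∷ B ∷ Γ) ⊢ C → ((A ⊗ B) ∷ Γ) ⊢ C
  ⊗R   : ∀ {Γ Δ A B} → Γ ⊢ A → Δ ⊢ B → (Γ ++ Δ) ⊢ A ⊗ B
  ⊸L   : ∀ {Γ Δ A B C} → Γ ⊢ A → (B ∷ Δ) ⊢ C → ((A ⊸ B) ∷ Γ ++ Δ) ⊢ C
  ⊸R   : ∀ {Γ A B} → (A ∷ Γ) ⊢ B → Γ ⊢ A ⊸ B
  ∃L   : ∀ {Γ A C} y → y ∉ fvsCtx (ex A ∷ Γ) → y ∉ fvs C →
         (A [ y ] ∷ Γ) ⊢ C → (ex A ∷ Γ) ⊢ C
  ∃R   : ∀ {Γ A} z → Γ ⊢ A [ z ] → Γ ⊢ ex A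
  ∀L   : ∀ {Γ A C} z → (A [ z ] ∷ Γ) ⊢ C → (all A ∷ Γ) ⊢ C
  ∀R   : ∀ {Γ A} y → y ∉ fvsCtx (all A ∷ Γ) →
         Γ ⊢ A [ y ] → Γ ⊢ all A

𝐬 𝐭 : ℕ
𝐬 = 0
𝐭 = 1

GoodFm : Fm → Set
GoodFm A = LC 0 A × All (λ x → x ≡ 𝐬 ⊎ x ≡ 𝐭) (fvs A)

st↦ : ℕ → ℕ → ℕ → ℕ
st↦ a b zero = a
st↦ a b (suc zero) = b
st↦ a b (suc (suc x)) = suc (suc x)

record Grammar : Set where
  field
    k     : ℕ
    S     : Fm
    S-ok  : GoodFm S
    lex   : List (Fin k × Fm)
    lex-ok : All (λ p → GoodFm (Data.Product.proj₂ p)) lex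

antecedent : (ℕ → ℕ) → ℕ → List Fm → List Fm
antecedent x i [] = []
antecedent x i (A ∷ As) = ren (st↦ (x i) (x (suc i))) A ∷ antecedent x (suc i) As

DistinctUpTo : ℕ → (ℕ → ℕ) → Set
DistinctUpTo n x = ∀ i j → i ≤ n → j ≤ n → x i ≡ x j → i ≡ j

Lang : ℕ → Set₁
Lang k = List (Fin k) → Set

Generates : (G : Grammar) → Lang (Grammar.k G)
Generates G w =
  Σ (List Fm) λ As →
    Pointwise (λ a A → (a , A) ∈ Grammar.lex G) w As ×
    Σ (ℕ → ℕ) λ x → DistinctUpTo (length w) x ×
      (antecedent x 0 As ⊢ ren (st↦ (x 0) (x (length w))) (Grammar.S G))

-- Deterministic single-tape Turing machines (tape bounded on the left),
-- input alphabet I, output alphabet O.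

data Move : Set where L R S : Move

record TM (I O : Set) : Set where
  field
    nQ nΣ    : ℕ
    start    : Fin nQ
    blank    : Fin nΣ
    δ        : Fin nQ → Fin nΣ → Maybe (Fin nQ × Fin nΣ × Move)  -- nothing = halt
    accept   : Fin nQ → Bool
    inE      : I → Fin nΣ
    outE     : O → Fin nΣ
    outE-inj : ∀ a b → outE a ≡ outE b → a ≡ b
    outE-nb  : ∀ a → outE a ≢ blank

record Config {I O : Set} (M : TM I O) : Set where
  constructor cfg
  field
    state : Fin (TM.nQ M)
    left  : List (Fin (TM.nΣ M))   -- cells left of the head, nearest first
    right : List (Fin (TM.nΣ M))   -- head cell and cells to its right ([] = blanks)

module _ {I O : Set} (M : TM I O) where
  open TM M

  hd : List (Fin nΣ) → Fin nΣ
  hd [] = blank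
  hd (a ∷ _) = a

  tl : List (Fin nΣ) → List (Fin nΣ)
  tl [] = []
  tl (_ ∷ r) = r

  initCfg : List I → Config M
  initCfg w = cfg start [] (map inE w)

  move : Fin nQ → Fin nΣ → Move → Config M → Config M
  move q' s' L (cfg q [] r) = cfg q' [] (s' ∷ tl r)
  move q' s' L (cfg q (a ∷ l) r) = cfg q' l (a ∷ s' ∷ tl r)
  move q' s' R (cfg q l r) = cfg q' (s' ∷ l) (tl r)
  move q' s' S (cfg q l r) = cfg q' l (s' ∷ tl r)

  step : Config M → Config M
  step c with δ (Config.state c) (hd (Config.right c))
  ... | nothing = c
  ... | just (q' , s' , m) = move q' s' m c

  run : ℕ → Config M → Config M
  run zero c = c
  run (suc n) c = run n (step c)

  Halted : Config M → Set
  Halted c = δ (Config.state c) (hd (Config.right c)) ≡ nothing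

  OutputIs : Config M → List O → Set
  OutputIs c v = Σ (List (Fin nΣ)) λ rest →
    Config.right c ≡ map outE v ++ rest × hd rest ≡ blank

poly : ℕ → ℕ → ℕ → ℕ
poly c d n = c * (suc n ^ d)

PolyDecidable : {I : Set} → (List I → Set) → Set
PolyDecidable {I} P =
  Σ (TM I ⊥) λ M → Σ ℕ λ c → Σ ℕ λ d → ∀ w →
    let cf = run M (poly c d (length w)) (initCfg M w) in
    Halted M cf × ((TM.accept M (Config.state cf) ≡ true) ⇔ P w)

PolyComputable : {I O : Set} → (List I → List O) → Set
PolyComputable {I} {O} f =
  Σ (TM I O) λ M → Σ ℕ λ c → Σ ℕ λ d → ∀ w →
    let cf = run M (poly c d (length w)) (initCfg M w) in
    Halted M cf × OutputIs M cf (f w)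

InNP : {k : ℕ} → Lang k → Set₁
InNP {k} P =
  Σ (List (Fin k ⊎ Bool) → Set) λ V → PolyDecidable V ×
  Σ ℕ λ c → Σ ℕ λ d → ∀ w →
    P w ⇔ (Σ (List Bool) λ u → length u ≤ poly c d (length w) ×
                               V (map inj₁ w ++ map inj₂ u))

_≤p_ : {k k' : ℕ} → Lang k' → Lang k → Set
_≤p_ {k} {k'} P Q = Σ (List (Fin k') → List (Fin k)) λ f →
  PolyComputable f × (∀ w → P w ⇔ Q (f w))

NPHard : {k : ℕ} → Lang k → Set₁
NPHard {k} Q = ∀ (k' : ℕ) (P : Lang k') → InNP P → P ≤p Q

NPComplete : {k : ℕ} → Lang k → Set₁
NPComplete Q = InNP Q × NPHard Q

module Submission where

-- The grammar encodes a fixed automaton that reads one instruction per letter: it pushes or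
-- pops bits on two stacks, swaps them, or chooses nondeterministically whether to execute or
-- to skip the letters up to the next control letter.  A string position is a program counter
-- and a stack is a linked list of atoms whose pointers are first-order variables.  Derivations
-- yield runs because all rules are sound when formulas are read as types (⊗ as product, ⊸ as
-- function, quantifiers as Σ and Π over pointers) and state atoms as reachability.
--
-- Membership in NP: a certificate lists the choices; a machine then matches every pop with the
-- nearest live push to its left on the tape.
--
-- Hardness: a verifier M becomes a list of straight-line programs on two stacks of symbols in
-- unary code, one for each transition.  A word that offers the whole list sufficiently often,
-- each program being skippable, is accepted iff M accepts some certificate.  As certificates
-- that are too long must be excluded, the number of opportunities to guess a bit has to equal
-- the polynomial bound exactly; it is obtained by counting subsets of the input cells, weighted
-- by the forward differences of the polynomial.

-- Reading ⊗ as product and ⊸ as function also validates weakening and contraction, so linearity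
-- cannot be what makes derivations sound. Positions take over this task: they are distinct
-- variables, the formula of a letter leads only from its position to the next one, and links are
-- true equations between stacks; hence repeated use of a formula proves nothing false. Linearity
-- matters in the other direction, where every link must be consumed; derivations are therefore
-- built from the end of a run, when the later pops are known. In the reduction the word is written
-- by a machine whose only counter is its tape, and one recursion over the cells produces all parts
-- of the word. Guessing and transition blocks thus occur everywhere, and the top symbol of the
-- right stack decides which of them can be executed. Transitions need only be numerous enough, but
-- the guesses must match the certificate bound c(n+1)^d. Newton's formula writes m^d as the sum
-- over b of the binomial coefficient C(m,b) times the b-th difference at 0, a natural number; with
-- the left end marker counted as a cell, m is n+1.

open import Defs
open import Data.Bool using (Bool; true; false; not; if_then_else_)
open import Data.Bool.Properties using (not-involutive)
open import Data.Empty using (⊥; ⊥-elim)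
open import Data.Fin using (Fin; splitAt; join; combine; remQuot; toℕ; fromℕ; fromℕ<; inject₁)
open import Data.Fin.Properties
  using (splitAt-join; remQuot-combine; toℕ-fromℕ; toℕ-fromℕ<; toℕ-inject₁; toℕ-injective)
open import Data.List
  using (List; []; _∷_; _++_; map; length; take; reverse; _ʳ++_; replicate; allFin)
open import Data.List.Membership.Propositional using (_∈_; _∉_)
open import Data.List.Membership.Propositional.Properties
  using (∈-++⁺ˡ; ∈-++⁺ʳ; ∈-map⁺; ∈-map⁻; ∈-allFin)
open import Data.List.Properties
  using (length-map; length-++; length-reverse; length-ʳ++; map-++; map-ʳ++; map-∘; map-id; map-cong;
         ∷-injectiveˡ; ∷-injectiveʳ; ++-identityʳ; ++-assoc; ʳ++-defn; ʳ++-ʳ++; ++-ʳ++)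
open import Data.List.Relation.Binary.Permutation.Propositional using (_↭_; ↭-refl; ↭-sym; ↭-trans; prep)
open import Data.List.Relation.Binary.Permutation.Propositional.Properties using (All-resp-↭; shift; shifts)
open import Data.List.Relation.Binary.Pointwise using (Pointwise; []; _∷_)
open import Data.List.Relation.Unary.All as All using (All; []; _∷_; universal)
open import Data.List.Relation.Unary.All.Properties using (++⁻; ++⁺) renaming (map⁺ to All-map⁺)
open import Data.List.Relation.Unary.Any using (here; there)
open import Data.Maybe as Maybe using (Maybe; just; nothing)
open import Data.Nat
  using (ℕ; zero; suc; pred; _+_; _*_; _^_; _∸_; _⊔_; _<_; _≤_; z≤n; s≤s; _≟_)
open import Data.Nat.ListAction using (sum)
open import Data.Nat.Properties hiding (_≟_)
open import Data.Nat.Solver using (module +-*-Solver)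
open import Data.Product using (Σ; _×_; _,_; proj₁; proj₂)
open import Data.Sum as Sum using (_⊎_; inj₁; inj₂)
open import Data.Unit using (⊤; tt)
open import Function using (_∘_; id)
open import Function.Bundles using (_⇔_; mk⇔; Equivalence)
open import Relation.Binary.PropositionalEquality hiding ([_])
open import Relation.Nullary using (does; yes; no; contradiction)
open import Relation.Nullary.Decidable using (dec-true; dec-false)
open Equivalence using (to; from)

-- Soundness of MILL1 for the reading of formulas as types

module Model (D : Set) (d₀ : D) (⟦_⟧ᵃ : ℕ → List D → Set) where

  Env : Set
  Env = ℕ → D

  infixr 5 _▹_
  _▹_ : D → Env → Env
  (d ▹ σ) zero    = d
  (d ▹ σ) (suc j) = σ j

  ⟦_⟧ᵗ : Tm → Env → Env → D
  ⟦ fv x ⟧ᵗ ρ σ = ρ x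
  ⟦ bv j ⟧ᵗ ρ σ = σ j

  ⟦_⟧ᵗˢ : List Tm → Env → Env → List D
  ⟦ ts ⟧ᵗˢ ρ σ = map (λ t → ⟦ t ⟧ᵗ ρ σ) ts

  ⟦_⟧ : Fm → Env → Env → Set
  ⟦ atom p ts ⟧ ρ σ = ⟦ p ⟧ᵃ (⟦ ts ⟧ᵗˢ ρ σ)
  ⟦ A ⊗ B ⟧     ρ σ = ⟦ A ⟧ ρ σ × ⟦ B ⟧ ρ σ
  ⟦ A ⊸ B ⟧     ρ σ = ⟦ A ⟧ ρ σ → ⟦ B ⟧ ρ σ
  ⟦ ex A ⟧      ρ σ = Σ D λ d → ⟦ A ⟧ ρ (d ▹ σ)
  ⟦ all A ⟧     ρ σ = ∀ d → ⟦ A ⟧ ρ (d ▹ σ)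

  private
    ≡⇒⇔ : ∀ {p} {xs ys : List D} → xs ≡ ys → ⟦ p ⟧ᵃ xs ⇔ ⟦ p ⟧ᵃ ys
    ≡⇒⇔ refl = mk⇔ id id

    ⊗-cong : ∀ {X X′ Y Y′ : Set} → X ⇔ X′ → Y ⇔ Y′ → (X × Y) ⇔ (X′ × Y′)
    ⊗-cong f g = mk⇔ (λ (x , y) → to f x , to g y) (λ (x , y) → from f x , from g y)

    ⊸-cong : ∀ {X X′ Y Y′ : Set} → X ⇔ X′ → Y ⇔ Y′ → (X → Y) ⇔ (X′ → Y′)
    ⊸-cong f g = mk⇔ (λ h → to g ∘ h ∘ from f) (λ h → from g ∘ h ∘ to f)

    ex-cong : {P P′ : D → Set} → (∀ d → P d ⇔ P′ d) → Σ D P ⇔ Σ D P′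
    ex-cong f = mk⇔ (λ (d , p) → d , to (f d) p) (λ (d , p) → d , from (f d) p)

    all-cong : {P P′ : D → Set} → (∀ d → P d ⇔ P′ d) → (∀ d → P d) ⇔ (∀ d → P′ d)
    all-cong f = mk⇔ (λ h d → to (f d) (h d)) (λ h d → from (f d) (h d))

  ▹-cong : ∀ {d σ σ′} → σ ≗ σ′ → d ▹ σ ≗ d ▹ σ′
  ▹-cong eq zero    = refl
  ▹-cong eq (suc j) = eq j

  coincidence : ∀ A {ρ ρ′ σ σ′} → (∀ {x} → x ∈ fvs A → ρ x ≡ ρ′ x) → σ ≗ σ′ →
                ⟦ A ⟧ ρ σ ⇔ ⟦ A ⟧ ρ′ σ′
  coincidence (atom p ts) {ρ} {ρ′} {σ} {σ′} eρ eσ = ≡⇒⇔ (terms ts eρ)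
    where
    terms : ∀ ts → (∀ {x} → x ∈ fvs (atom p ts) → ρ x ≡ ρ′ x) → ⟦ ts ⟧ᵗˢ ρ σ ≡ ⟦ ts ⟧ᵗˢ ρ′ σ′
    terms []          e = refl
    terms (fv x ∷ ts) e = cong₂ _∷_ (e (here refl)) (terms ts (e ∘ there))
    terms (bv j ∷ ts) e = cong₂ _∷_ (eσ j) (terms ts e)
  coincidence (A ⊗ B) eρ eσ =
    ⊗-cong (coincidence A (eρ ∘ ∈-++⁺ˡ) eσ) (coincidence B (eρ ∘ ∈-++⁺ʳ (fvs A)) eσ)
  coincidence (A ⊸ B) eρ eσ =
    ⊸-cong (coincidence A (eρ ∘ ∈-++⁺ˡ) eσ) (coincidence B (eρ ∘ ∈-++⁺ʳ (fvs A)) eσ)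
  coincidence (ex A)  eρ eσ = ex-cong λ d → coincidence A eρ (▹-cong eσ)
  coincidence (all A) eρ eσ = all-cong λ d → coincidence A eρ (▹-cong eσ)

  -- The two environments differ only at index `i`, where `openAt` puts the value of `y`. An
  -- arbitrary `i` lets the induction pass a binder, where `i` becomes `suc i`.
  openAt-sound : ∀ A i y {ρ σ σ′} → σ′ i ≡ ρ y → (∀ j → j ≢ i → σ j ≡ σ′ j) →
                 ⟦ openAt i y A ⟧ ρ σ ⇔ ⟦ A ⟧ ρ σ′
  openAt-sound (atom p ts) i y {ρ} {σ} {σ′} ei ej = ≡⇒⇔ (terms ts)
    where
    term : ∀ t → ⟦ openTm i y t ⟧ᵗ ρ σ ≡ ⟦ t ⟧ᵗ ρ σ′
    term (fv x) = refl
    term (bv j) with j ≟ i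
    ... | yes refl rewrite dec-true (j ≟ j) refl  = sym ei
    ... | no j≢i   rewrite dec-false (j ≟ i) j≢i = ej j j≢i
    terms : ∀ ts → ⟦ map (openTm i y) ts ⟧ᵗˢ ρ σ ≡ ⟦ ts ⟧ᵗˢ ρ σ′
    terms []       = refl
    terms (t ∷ ts) = cong₂ _∷_ (term t) (terms ts)
  openAt-sound (A ⊗ B) i y ei ej = ⊗-cong (openAt-sound A i y ei ej) (openAt-sound B i y ei ej)
  openAt-sound (A ⊸ B) i y ei ej = ⊸-cong (openAt-sound A i y ei ej) (openAt-sound B i y ei ej)
  openAt-sound (ex A)  i y ei ej =
    ex-cong λ d → openAt-sound A (suc i) y ei λ { zero _ → refl ; (suc j) n → ej j (n ∘ cong suc) }
  openAt-sound (all A) i y ei ej =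
    all-cong λ d → openAt-sound A (suc i) y ei λ { zero _ → refl ; (suc j) n → ej j (n ∘ cong suc) }

  -- Bound variables are opened without shifting, so instantiation commutes with
  -- the interpretation only when dangling indices all have the same value.
  σ₀ : Env
  σ₀ _ = d₀

  Holds : Env → Fm → Set
  Holds ρ A = ⟦ A ⟧ ρ σ₀

  instantiate : ∀ A y {ρ} → Holds ρ (A [ y ]) ⇔ ⟦ A ⟧ ρ (ρ y ▹ σ₀)
  instantiate A y = openAt-sound A 0 y refl λ { zero n → contradiction refl n ; (suc j) _ → refl }

  update : ℕ → D → Env → Env
  update y d ρ x = if does (x ≟ y) then d else ρ x

  update-≡ : ∀ y d ρ → update y d ρ y ≡ d
  update-≡ y d ρ rewrite dec-true (y ≟ y) refl = refl

  update-≢ : ∀ {y} d ρ {x} → x ≢ y → ρ x ≡ update y d ρ x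
  update-≢ {y} d ρ {x} n rewrite dec-false (x ≟ y) n = refl

  fresh-update : ∀ A {y d ρ σ} → y ∉ fvs A → ⟦ A ⟧ ρ σ ⇔ ⟦ A ⟧ (update y d ρ) σ
  fresh-update A {d = d} {ρ} y∉ = coincidence A (λ x∈ → update-≢ d ρ λ { refl → y∉ x∈ }) λ _ → refl

  fresh-updates : ∀ Γ {y d ρ} → y ∉ fvsCtx Γ → All (Holds ρ) Γ → All (Holds (update y d ρ)) Γ
  fresh-updates []      y∉ []       = []
  fresh-updates (A ∷ Γ) y∉ (a ∷ as) =
    to (fresh-update A (y∉ ∘ ∈-++⁺ˡ)) a ∷ fresh-updates Γ (y∉ ∘ ∈-++⁺ʳ (fvs A)) as

  fresh-instance : ∀ A y {ρ} → y ∉ fvs A → ∀ d → ⟦ A ⟧ ρ (d ▹ σ₀) ⇔ Holds (update y d ρ) (A [ y ])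
  fresh-instance A y {ρ} y∉ d = mk⇔
    (λ a → from (instantiate A y) (subst (λ e → ⟦ A ⟧ (update y d ρ) (e ▹ σ₀)) (sym (update-≡ y d ρ))
             (to (fresh-update A y∉) a)))
    (λ a → from (fresh-update A y∉) (subst (λ e → ⟦ A ⟧ (update y d ρ) (e ▹ σ₀)) (update-≡ y d ρ)
             (to (instantiate A y) a)))

  -- Read as types, the rules are those of intuitionistic predicate logic. In `∃L` and `∀R` the
  -- eigenvariable is reassigned to the given value, which by freshness affects no other formula.
  sound : ∀ {Γ C} → Γ ⊢ C → ∀ ρ → All (Holds ρ) Γ → Holds ρ C
  sound ax ρ (a ∷ []) = a
  sound (cut {Γ} p q) ρ as with as₁ , as₂ ← ++⁻ Γ as = sound q ρ (sound p ρ as₁ ∷ as₂)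
  sound (exch π p) ρ as = sound p ρ (All-resp-↭ (↭-sym π) as)
  sound (⊗L p) ρ ((a , b) ∷ as) = sound p ρ (a ∷ b ∷ as)
  sound (⊗R {Γ} p q) ρ as with as₁ , as₂ ← ++⁻ Γ as = sound p ρ as₁ , sound q ρ as₂
  sound (⊸L {Γ} p q) ρ (f ∷ as) with as₁ , as₂ ← ++⁻ Γ as = sound q ρ (f (sound p ρ as₁) ∷ as₂)
  sound (⊸R p) ρ as = λ a → sound p ρ (a ∷ as)
  sound (∃L {Γ} {A} {C} y y∉ y∉C p) ρ ((d , a) ∷ as) =
    from (fresh-update C y∉C) (sound p (update y d ρ)
      (to (fresh-instance A y (y∉ ∘ ∈-++⁺ˡ) d) a ∷ fresh-updates Γ (y∉ ∘ ∈-++⁺ʳ (fvs A)) as))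
  sound (∃R {A = A} z p) ρ as = ρ z , to (instantiate A z) (sound p ρ as)
  sound (∀L {A = A} z p) ρ (f ∷ as) = sound p ρ (from (instantiate A z) (f (ρ z)) ∷ as)
  sound (∀R {Γ} {A} y y∉ p) ρ as = λ d →
    from (fresh-instance A y (y∉ ∘ ∈-++⁺ˡ) d)
      (sound p (update y d ρ) (fresh-updates Γ (y∉ ∘ ∈-++⁺ʳ (fvs A)) as))

-- The automaton and its grammar

data Letter : Set where
  push pop           : Bool → Letter
  swap choice resume : Letter

data Mode : Set where
  exec skip : Mode

State : Set
State = Mode × List Bool × List Bool

data Plain : Letter → Set where
  push : ∀ {b} → Plain (push b)
  pop  : ∀ {b} → Plain (pop b)
  swap : Plain swap

infix 4 _⟨_⟩_ _⟨_⟩*_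

data _⟨_⟩_ : State → Letter → State → Set where
  push   : ∀ {b l r} → (exec , l , r) ⟨ push b ⟩ (exec , b ∷ l , r)
  pop    : ∀ {b l r} → (exec , b ∷ l , r) ⟨ pop b ⟩ (exec , l , r)
  swap   : ∀ {l r} → (exec , l , r) ⟨ swap ⟩ (exec , r , l)
  choice : ∀ {m} m′ {l r} → (m , l , r) ⟨ choice ⟩ (m′ , l , r)
  resume : ∀ {m l r} → (m , l , r) ⟨ resume ⟩ (exec , l , r)
  skip   : ∀ {a l r} → Plain a → (skip , l , r) ⟨ a ⟩ (skip , l , r)

infixr 5 _∷_

data _⟨_⟩*_ : State → List Letter → State → Set where
  []  : ∀ {s} → s ⟨ [] ⟩* s
  _∷_ : ∀ {s s′ s″ a as} → s ⟨ a ⟩ s′ → s′ ⟨ as ⟩* s″ → s ⟨ a ∷ as ⟩* s″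

_+++_ : ∀ {s s′ s″ as bs} → s ⟨ as ⟩* s′ → s′ ⟨ bs ⟩* s″ → s ⟨ as ++ bs ⟩* s″
[]       +++ q = q
(t ∷ p) +++ q = t ∷ (p +++ q)

initial : State
initial = exec , [] , []

Accepts : List Letter → Set
Accepts w = Σ (List Bool) λ l → Σ (List Bool) λ r → initial ⟨ w ⟩* (exec , l , r)

encLetter : Letter → Fin 7
encLetter (push false) = Fin.zero
encLetter (push true)  = Fin.suc Fin.zero
encLetter (pop false)  = Fin.suc (Fin.suc Fin.zero)
encLetter (pop true)   = Fin.suc (Fin.suc (Fin.suc Fin.zero))
encLetter swap         = Fin.suc (Fin.suc (Fin.suc (Fin.suc Fin.zero)))
encLetter choice       = Fin.suc (Fin.suc (Fin.suc (Fin.suc (Fin.suc Fin.zero))))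
encLetter resume       = Fin.suc (Fin.suc (Fin.suc (Fin.suc (Fin.suc (Fin.suc Fin.zero)))))

decLetter : Fin 7 → Letter
decLetter Fin.zero                                                             = push false
decLetter (Fin.suc Fin.zero)                                                   = push true
decLetter (Fin.suc (Fin.suc Fin.zero))                                         = pop false
decLetter (Fin.suc (Fin.suc (Fin.suc Fin.zero)))                               = pop true
decLetter (Fin.suc (Fin.suc (Fin.suc (Fin.suc Fin.zero))))                     = swap
decLetter (Fin.suc (Fin.suc (Fin.suc (Fin.suc (Fin.suc Fin.zero)))))           = choice
decLetter (Fin.suc (Fin.suc (Fin.suc (Fin.suc (Fin.suc (Fin.suc Fin.zero)))))) = resume

dec-encLetter : ∀ a → decLetter (encLetter a) ≡ a
dec-encLetter (push false) = refl
dec-encLetter (push true)  = refl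
dec-encLetter (pop false)  = refl
dec-encLetter (pop true)   = refl
dec-encLetter swap         = refl
dec-encLetter choice       = refl
dec-encLetter resume       = refl

modePred : Mode → ℕ
modePred exec = 0
modePred skip = 1

at : Mode → Tm → Tm → Tm → Fm
at m x l r = atom (modePred m) (x ∷ l ∷ r ∷ [])

linkPred : Bool → ℕ
linkPred false = 2
linkPred true  = 3

link : Bool → Tm → Tm → Fm
link b l′ l = atom (linkPred b) (l′ ∷ l ∷ [])

-- A stack is a linked list of atoms.  The entry pushᵈ creates a pointer without an atom:
-- it is for pushes that are never popped, since every atom must be consumed.
data Entry : Set where
  stay             : Mode → Mode → Entry
  pushᵒ pushᵈ popᵒ : Bool → Entry
  swapᵒ            : Entry

-- The outer bound variables point to the tops of the left and the right stack. The existential of a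
-- push binds the new top and so raises the other indices by one; the innermost variable of a pop is
-- the cell below the popped one.
formula : Entry → Fm
formula (stay m m′) = all (all (at m (fv 𝐬) (bv 1) (bv 0) ⊸ at m′ (fv 𝐭) (bv 1) (bv 0)))
formula (pushᵒ b)   = all (all (at exec (fv 𝐬) (bv 1) (bv 0) ⊸
                        ex (at exec (fv 𝐭) (bv 0) (bv 1) ⊗ link b (bv 0) (bv 2))))
formula (pushᵈ b)   = all (all (at exec (fv 𝐬) (bv 1) (bv 0) ⊸
                        ex (at exec (fv 𝐭) (bv 0) (bv 1))))
formula (popᵒ b)    = all (all (all (at exec (fv 𝐬) (bv 2) (bv 1) ⊗ link b (bv 2) (bv 0) ⊸
                        at exec (fv 𝐭) (bv 0) (bv 1))))
formula swapᵒ       = all (all (at exec (fv 𝐬) (bv 1) (bv 0) ⊸ at exec (fv 𝐭) (bv 0) (bv 1)))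

-- An empty stack is a pointer without links, so one variable serves both stacks at the start. The
-- final pointers are existential because any final contents are accepted.
goal : Fm
goal = all (at exec (fv 𝐬) (bv 0) (bv 0) ⊸ ex (ex (at exec (fv 𝐭) (bv 1) (bv 0))))

lexicon : List (Letter × Entry)
lexicon =
  (push false , pushᵒ false) ∷ (push false , pushᵈ false) ∷ (push false , stay skip skip) ∷
  (push true , pushᵒ true) ∷ (push true , pushᵈ true) ∷ (push true , stay skip skip) ∷
  (pop false , popᵒ false) ∷ (pop false , stay skip skip) ∷
  (pop true , popᵒ true) ∷ (pop true , stay skip skip) ∷
  (swap , swapᵒ) ∷ (swap , stay skip skip) ∷
  (choice , stay exec exec) ∷ (choice , stay exec skip) ∷
  (choice , stay skip exec) ∷ (choice , stay skip skip) ∷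
  (resume , stay exec exec) ∷ (resume , stay skip exec) ∷ []

data _▷_ : Letter → Entry → Set where
  push   : ∀ {b} → push b ▷ pushᵒ b
  lose   : ∀ {b} → push b ▷ pushᵈ b
  pop    : ∀ {b} → pop b ▷ popᵒ b
  swap   : swap ▷ swapᵒ
  skip   : ∀ {a} → Plain a → a ▷ stay skip skip
  choice : ∀ {m m′} → choice ▷ stay m m′
  resume : ∀ {m} → resume ▷ stay m exec

lexicon-sound : All (λ (a , e) → a ▷ e) lexicon
lexicon-sound =
  push ∷ lose ∷ skip push ∷ push ∷ lose ∷ skip push ∷ pop ∷ skip pop ∷ pop ∷ skip pop ∷
  swap ∷ skip swap ∷ choice ∷ choice ∷ choice ∷ choice ∷ resume ∷ resume ∷ []

formula-good : ∀ e → GoodFm (formula e)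
formula-good = λ
  { (stay m m′) → ((_ ∷ 1< ∷ 0< ∷ []) , (_ ∷ 1< ∷ 0< ∷ [])) , s,t
  ; (pushᵒ b)   → ((_ ∷ 1< ∷ 0< ∷ []) , (_ ∷ 0< ∷ 1< ∷ []) , (0< ∷ 2< ∷ [])) , s,t
  ; (pushᵈ b)   → ((_ ∷ 1< ∷ 0< ∷ []) , (_ ∷ 0< ∷ 1< ∷ [])) , s,t
  ; (popᵒ b)    → (((_ ∷ 2< ∷ 1< ∷ []) , (2< ∷ 0< ∷ [])) , (_ ∷ 0< ∷ 1< ∷ [])) , s,t
  ; swapᵒ       → ((_ ∷ 1< ∷ 0< ∷ []) , (_ ∷ 0< ∷ 1< ∷ [])) , s,t }
  where
  0< : ∀ {n} → 0 < suc n
  0< = s≤s z≤n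
  1< : ∀ {n} → 1 < suc (suc n)
  1< = s≤s 0<
  2< : ∀ {n} → 2 < suc (suc (suc n))
  2< = s≤s 1<
  s,t : All (λ x → x ≡ 𝐬 ⊎ x ≡ 𝐭) (𝐬 ∷ 𝐭 ∷ [])
  s,t = inj₁ refl ∷ inj₂ refl ∷ []

entryPair : Letter × Entry → Fin 7 × Fm
entryPair (a , e) = encLetter a , formula e

stackGrammar : Grammar
stackGrammar = record
  { k      = 7
  ; S      = goal
  ; S-ok   = ((_ ∷ s≤s z≤n ∷ s≤s z≤n ∷ []) , (_ ∷ s≤s (s≤s z≤n) ∷ s≤s z≤n ∷ [])) , inj₁ refl ∷ inj₂ refl ∷ []
  ; lex    = map entryPair lexicon
  ; lex-ok = All-map⁺ {f = entryPair} (universal (λ (_ , e) → formula-good e) lexicon)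
  }

-- Derivations yield runs

module Soundness (x : ℕ → ℕ) (w : List Letter) (distinct : DistinctUpTo (length w) x) where

  Reach : Mode → ℕ → List Bool → List Bool → Set
  Reach m p l r = Σ (List Letter) λ v → Σ (List Letter) λ v′ →
    v ++ v′ ≡ w × p ≡ x (length v) × initial ⟨ v ⟩* (m , l , r)

  -- The calculus has a single sort, so a variable may stand for a position or for a pointer; its
  -- value carries both readings, a name and a stack.
  Value : Set
  Value = ℕ × List Bool

  Atom : ℕ → List Value → Set
  Atom 0 ((p , _) ∷ (_ , l) ∷ (_ , r) ∷ []) = Reach exec p l r
  Atom 1 ((p , _) ∷ (_ , l) ∷ (_ , r) ∷ []) = Reach skip p l r
  Atom 2 ((_ , l′) ∷ (_ , l) ∷ [])          = l′ ≡ false ∷ l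
  Atom 3 ((_ , l′) ∷ (_ , l) ∷ [])          = l′ ≡ true ∷ l
  Atom _ _                                  = ⊤

  open Model Value (0 , []) Atom

  at⇔ : ∀ m {p l r} → Atom (modePred m) (p ∷ l ∷ r ∷ []) ⇔ Reach m (proj₁ p) (proj₂ l) (proj₂ r)
  at⇔ exec = mk⇔ id id
  at⇔ skip = mk⇔ id id

  link⇔ : ∀ b {l′ l} → Atom (linkPred b) (l′ ∷ l ∷ []) ⇔ (proj₂ l′ ≡ b ∷ proj₂ l)
  link⇔ false = mk⇔ id id
  link⇔ true  = mk⇔ id id

  ρ : Env
  ρ y = y , []

  length-split : ∀ (u : List Letter) {u′} → u ++ u′ ≡ w → length u ≤ length w
  length-split u e = ≤-trans (m≤m+n (length u) _) (≤-reflexive (trans (sym (length-++ u)) (cong length e)))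

  same-prefix : ∀ {u u′ : List Letter} (t : List Letter) {t′} → u ++ u′ ≡ t ++ t′ → length u ≡ length t → u ≡ t
  same-prefix {[]}     []      e l = refl
  same-prefix {c ∷ u} (d ∷ t) e l =
    cong₂ _∷_ (∷-injectiveˡ e) (same-prefix t (∷-injectiveʳ e) (cong pred l))

  module _ (v : List Letter) {a : Letter} {v′ : List Letter} (w≡ : v ++ a ∷ v′ ≡ w) where

    -- Distinct positions have distinct variables, so the prefix in the witness must be `v`, and the
    -- letter extends the run exactly at its own place.
    advance : ∀ {m l r m′ l′ r′} → (m , l , r) ⟨ a ⟩ (m′ , l′ , r′) →
              Reach m (x (length v)) l r → Reach m′ (x (suc (length v))) l′ r′
    advance t (u , u′ , e , xe , run) with refl ← same-prefix {u} v (trans e (sym w≡))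
        (sym (distinct (length v) (length u) (length-split v w≡) (length-split u e) xe)) =
      v ++ a ∷ [] , v′ , trans (++-assoc v (a ∷ []) v′) w≡ ,
      cong x (sym (trans (length-++ v) (+-comm (length v) 1))) , (run +++ (t ∷ []))

    entry-holds : ∀ {e} → a ▷ e →
                  Holds ρ (ren (st↦ (x (length v)) (x (suc (length v)))) (formula e))
    entry-holds (push {b})  (_ , l) r h              = (0 , b ∷ l) , advance push h , from (link⇔ b) refl
    entry-holds (lose {b})  (_ , l) r h              = (0 , b ∷ l) , advance push h
    entry-holds (pop {b})   (_ , l) r (_ , l′) (h , c) with refl ← to (link⇔ b) c = advance pop h
    entry-holds swap        l r h                    = advance swap h
    entry-holds (skip π)    l r                      = advance (skip π)
    entry-holds (choice {m} {m′}) l r h              = from (at⇔ m′) (advance (choice m′) (to (at⇔ m) h))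
    entry-holds (resume {m}) l r h                   = advance resume (to (at⇔ m) h)

  antecedent-holds : ∀ v {v′} As → v ++ v′ ≡ w →
                     Pointwise (λ a A → Σ Entry λ e → a ▷ e × A ≡ formula e) v′ As →
                     All (Holds ρ) (antecedent x (length v) As)
  antecedent-holds v []       e []                   = []
  antecedent-holds v {a ∷ v′} (_ ∷ As) e ((_ , a▷e , refl) ∷ rest) =
    entry-holds v e a▷e ∷
    subst (λ n → All (Holds ρ) (antecedent x n As)) (trans (length-++ v) (+-comm (length v) 1))
      (antecedent-holds (v ++ a ∷ []) As (trans (++-assoc v (a ∷ []) v′) e) rest)

  accepted : ∀ {As} → Pointwise (λ a A → Σ Entry λ e → a ▷ e × A ≡ formula e) w As →
             antecedent x 0 As ⊢ ren (st↦ (x 0) (x (length w))) goal → Accepts w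
  -- `(0 , [])` makes both initial stacks empty, and the initial state is reached by the empty
  -- prefix. The result is a state reached at the last position, that is, by all of `w`.
  accepted pw d with sound d ρ (antecedent-holds [] _ refl pw) (0 , []) ([] , w , refl , refl , [])
  ... | (_ , l) , (_ , r) , v , v′ , e , xe , run =
    l , r , subst (λ u → initial ⟨ u ⟩* (exec , l , r))
      (same-prefix {v} w (trans e (sym (++-identityʳ w)))
        (sym (distinct (length w) (length v) ≤-refl (length-split v e) xe))) run

-- Runs yield derivations

∈⇒≤sum : ∀ {y xs} → y ∈ xs → y ≤ sum xs
∈⇒≤sum {xs = x ∷ xs} (here refl) = m≤m+n x (sum xs)
∈⇒≤sum {xs = x ∷ xs} (there y∈)  = ≤-trans (∈⇒≤sum y∈) (m≤n+m (sum xs) x)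

fresh : List ℕ → ℕ
fresh xs = suc (sum xs)

fresh-∉ : ∀ xs → fresh xs ∉ xs
fresh-∉ xs y∈ = <-irrefl refl (∈⇒≤sum y∈)

∃L-fresh : ∀ {Γ A C} → (∀ y → (A [ y ] ∷ Γ) ⊢ C) → (ex A ∷ Γ) ⊢ C
∃L-fresh {Γ} {A} {C} d = ∃L y (fresh-∉ xs ∘ ∈-++⁺ˡ) (fresh-∉ xs ∘ ∈-++⁺ʳ (fvsCtx (ex A ∷ Γ))) (d y)
  where
  xs = fvsCtx (ex A ∷ Γ) ++ fvs C
  y  = fresh xs

∀R-fresh : ∀ {Γ A} → (∀ y → Γ ⊢ A [ y ]) → Γ ⊢ all A
∀R-fresh {Γ} {A} d = ∀R (fresh xs) (fresh-∉ xs) (d (fresh xs))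
  where xs = fvsCtx (all A ∷ Γ)

infixr 5 _◂_
_◂_ : ℕ → (ℕ → ℕ) → ℕ → ℕ
(y ◂ p) zero    = y
(y ◂ p) (suc j) = p j

-- `p` names the pointers from the top downwards, so a pop passes to `p ∘ suc` and a push to
-- `y ◂ p`.
chain : List Bool → (ℕ → ℕ) → List Fm
chain []      p = []
chain (b ∷ l) p = link b (fv (p 0)) (fv (p 1)) ∷ chain l (p ∘ suc)

goalAt : ℕ → Fm
goalAt n = ex (ex (at exec (fv n) (bv 1) (bv 0)))

Chosen : List Letter → List Fm → Set
Chosen = Pointwise (λ a A → Σ Entry λ e → a ▷ e × A ≡ formula e)

-- Only the links that will still be popped are in the context.
record Derivable (m : Mode) (l r : List Bool) (i n : ℕ) (w : List Letter) : Set where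
  constructor derivable
  field
    {As}        : List Fm
    chosen      : Chosen w As
    l₁          : List Bool
    {l₂}        : List Bool
    l-split     : l₁ ++ l₂ ≡ l
    r₁          : List Bool
    {r₂}        : List Bool
    r-split     : r₁ ++ r₂ ≡ r
    derivation  : ∀ p q → (at m (fv i) (fv (p 0)) (fv (q 0)) ∷ chain l₁ p ++ chain r₁ q ++ antecedent id i As)
                          ⊢ goalAt n

bring : ∀ {F X C} Γ Δ {Θ} → (F ∷ X ∷ Γ ++ Δ ++ Θ) ⊢ C → (X ∷ Γ ++ Δ ++ F ∷ Θ) ⊢ C
bring {F} {X} Γ Δ {Θ} = exch (↭-trans (prep F (prep X (≡⇒↭ (sym (++-assoc Γ Δ Θ)))))
  (↭-trans (↭-sym (shift F (X ∷ Γ ++ Δ) Θ)) (prep X (≡⇒↭ (++-assoc Γ Δ (F ∷ Θ))))))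
  where
  ≡⇒↭ : ∀ {xs ys : List Fm} → xs ≡ ys → xs ↭ ys
  ≡⇒↭ refl = ↭-refl

stay-derivable : ∀ {m m′ l r i n a w} → a ▷ stay m m′ →
                 Derivable m′ l r (suc i) n w → Derivable m l r i n (a ∷ w)
stay-derivable a▷ (derivable c l₁ el r₁ er d) = derivable ((_ , a▷ , refl) ∷ c) l₁ el r₁ er λ p q →
  bring (chain l₁ p) (chain r₁ q) (∀L (p 0) (∀L (q 0) (⊸L ax (d p q))))

-- The derivation for the rest of the run comes first: only its `l₁` tells whether a pushed bit will
-- be popped, hence whether `pushᵒ` or `pushᵈ` is the right entry.
derive : ∀ {m l r lₙ rₙ} i {n} w → (m , l , r) ⟨ w ⟩* (exec , lₙ , rₙ) → i + length w ≡ n → Derivable m l r i n w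
derive-next : ∀ {m l r lₙ rₙ} i {n} w → (m , l , r) ⟨ w ⟩* (exec , lₙ , rₙ) → i + suc (length w) ≡ n →
              Derivable m l r (suc i) n w
derive i [] [] refl = derivable [] [] refl [] refl λ p q →
  subst (λ k → (at exec (fv i) (fv (p 0)) (fv (q 0)) ∷ []) ⊢ goalAt k) (sym (+-identityʳ i))
    (∃R (p 0) (∃R (q 0) ax))
derive i (_ ∷ w) (push {b} ∷ run) e with derive-next i w run e
-- None of the bits now on the left stack is popped later, so the new top must come without a link.
... | derivable c [] el r₁ er d = derivable ((_ , lose , refl) ∷ c) [] refl r₁ er λ p q →
  bring [] (chain r₁ q) (∀L (p 0) (∀L (q 0) (⊸L ax (∃L-fresh λ y → d (y ◂ p) q))))
... | derivable c (_ ∷ l₁) refl r₁ er d = derivable ((_ , push , refl) ∷ c) l₁ refl r₁ er λ p q →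
  bring (chain l₁ p) (chain r₁ q) (∀L (p 0) (∀L (q 0) (⊸L ax (∃L-fresh λ y → ⊗L (d (y ◂ p) q)))))
derive i (_ ∷ w) (pop {b} ∷ run) e with derive-next i w run e
... | derivable c l₁ el r₁ er d = derivable ((_ , pop , refl) ∷ c) (b ∷ l₁) (cong (b ∷_) el) r₁ er λ p q →
  bring (chain (b ∷ l₁) p) (chain r₁ q)
    -- `p 1` is the cell below the top; the two axioms consume the state atom and the link of the
    -- popped bit.
    (∀L (p 0) (∀L (q 0) (∀L (p 1) (⊸L (⊗R ax ax) (d (p ∘ suc) q)))))
derive i (_ ∷ w) (swap ∷ run) e with derive-next i w run e
... | derivable c l₁ el r₁ er d = derivable ((_ , swap , refl) ∷ c) r₁ er l₁ el λ p q →
  bring (chain r₁ p) (chain l₁ q) (∀L (p 0) (∀L (q 0)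
    (⊸L ax (exch (prep _ (shifts (chain l₁ q) (chain r₁ p))) (d q p)))))
derive i (_ ∷ w) (choice m′ ∷ run) e = stay-derivable choice (derive-next i w run e)
derive i (_ ∷ w) (resume ∷ run)    e = stay-derivable resume (derive-next i w run e)
derive i (_ ∷ w) (skip π ∷ run)    e = stay-derivable (skip π) (derive-next i w run e)
derive-next i w run e = derive (suc i) w run (trans (sym (+-suc i (length w))) e)

complete : ∀ {w} → Accepts w → Σ (List Fm) λ As → Chosen w As × antecedent id 0 As ⊢ ren (st↦ 0 (length w)) goal
complete {w} (l , r , run) with derive 0 w run refl
... | derivable {As} c [] {[]} refl [] {[]} refl d =
  -- Both stacks start empty, so both chains are empty and all pointers may be named `y`.
  As , c , ∀R-fresh λ y → ⊸R (d (λ _ → y) (λ _ → y))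

-- The generated language

▷⇒lexicon : ∀ {a e} → a ▷ e → (a , e) ∈ lexicon
▷⇒lexicon (push {false}) = here refl
▷⇒lexicon (lose {false}) = there (here refl)
▷⇒lexicon (skip (push {false})) = there (there (here refl))
▷⇒lexicon (push {true}) = there (there (there (here refl)))
▷⇒lexicon (lose {true}) = there (there (there (there (here refl))))
▷⇒lexicon (skip (push {true})) = there (there (there (there (there (here refl)))))
▷⇒lexicon (pop {false}) = ∈-++⁺ʳ (take 6 lexicon) (here refl)
▷⇒lexicon (skip (pop {false})) = ∈-++⁺ʳ (take 7 lexicon) (here refl)
▷⇒lexicon (pop {true}) = ∈-++⁺ʳ (take 8 lexicon) (here refl)
▷⇒lexicon (skip (pop {true})) = ∈-++⁺ʳ (take 9 lexicon) (here refl)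
▷⇒lexicon swap = ∈-++⁺ʳ (take 10 lexicon) (here refl)
▷⇒lexicon (skip swap) = ∈-++⁺ʳ (take 11 lexicon) (here refl)
▷⇒lexicon (choice {exec} {exec}) = ∈-++⁺ʳ (take 12 lexicon) (here refl)
▷⇒lexicon (choice {exec} {skip}) = ∈-++⁺ʳ (take 13 lexicon) (here refl)
▷⇒lexicon (choice {skip} {exec}) = ∈-++⁺ʳ (take 14 lexicon) (here refl)
▷⇒lexicon (choice {skip} {skip}) = ∈-++⁺ʳ (take 15 lexicon) (here refl)
▷⇒lexicon (resume {exec}) = ∈-++⁺ʳ (take 16 lexicon) (here refl)
▷⇒lexicon (resume {skip}) = ∈-++⁺ʳ (take 17 lexicon) (here refl)

enc-decLetter : ∀ i → encLetter (decLetter i) ≡ i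
enc-decLetter Fin.zero = refl
enc-decLetter (Fin.suc Fin.zero) = refl
enc-decLetter (Fin.suc (Fin.suc Fin.zero)) = refl
enc-decLetter (Fin.suc (Fin.suc (Fin.suc Fin.zero))) = refl
enc-decLetter (Fin.suc (Fin.suc (Fin.suc (Fin.suc Fin.zero)))) = refl
enc-decLetter (Fin.suc (Fin.suc (Fin.suc (Fin.suc (Fin.suc Fin.zero))))) = refl
enc-decLetter (Fin.suc (Fin.suc (Fin.suc (Fin.suc (Fin.suc (Fin.suc Fin.zero)))))) = refl

Lex : Fin 7 → Fm → Set
Lex i A = (i , A) ∈ Grammar.lex stackGrammar

chosen : ∀ {w As} → Pointwise Lex w As → Chosen (map decLetter w) As
chosen []       = []
chosen (∈lex ∷ rest) with (a , e) , ∈lexicon , refl ← ∈-map⁻ entryPair ∈lex =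
  (e , subst (_▷ e) (sym (dec-encLetter a)) (All.lookup lexicon-sound ∈lexicon) , refl) ∷ chosen rest

chosen⁻ : ∀ w {As} → Chosen (map decLetter w) As → Pointwise Lex w As
chosen⁻ []      []                    = []
chosen⁻ (i ∷ w) ((e , i▷ , refl) ∷ rest) =
  subst (λ j → Lex j (formula e)) (enc-decLetter i) (∈-map⁺ entryPair (▷⇒lexicon i▷)) ∷ chosen⁻ w rest

-- From left to right the derivation may use any distinct position variables; from right to left the
-- positions themselves serve as names, with `id` for `x`.
generates⇔accepts : ∀ w → Generates stackGrammar w ⇔ Accepts (map decLetter w)
generates⇔accepts w = mk⇔
  (λ (As , pw , x , dist , d) → Soundness.accepted x (map decLetter w)
      (subst (λ n → DistinctUpTo n x) (sym (length-map decLetter w)) dist) (chosen pw)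
      (subst (λ n → antecedent x 0 As ⊢ ren (st↦ (x 0) (x n)) goal) (sym (length-map decLetter w)) d))
  (λ acc → let As , c , d = complete acc in
    As , chosen⁻ w c , id , (λ _ _ _ _ e → e) ,
    subst (λ n → antecedent id 0 As ⊢ ren (st↦ 0 n) goal) (length-map decLetter w) d)

-- Turing machines with structured states and symbols

-- A retraction suffices in place of a bijection: machines are transported by decoding states and
-- symbols, and codes outside the image of `enc` never occur in a run.
record Finite (A : Set) : Set where
  field
    card    : ℕ
    enc     : A → Fin card
    dec     : Fin card → A
    dec-enc : ∀ a → dec (enc a) ≡ a

  enc-injective : ∀ {a b} → enc a ≡ enc b → a ≡ b
  enc-injective {a} {b} e = trans (sym (dec-enc a)) (trans (cong dec e) (dec-enc b))

open Finite

finite-retract : ∀ {A B} → Finite B → (f : A → B) (g : B → A) → (∀ a → g (f a) ≡ a) → Finite A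
finite-retract F f g gf = record
  { card = card F ; enc = enc F ∘ f ; dec = g ∘ dec F
  ; dec-enc = λ a → trans (cong g (dec-enc F (f a))) (gf a) }

finite-Fin : ∀ n → Finite (Fin n)
finite-Fin n = record { card = n ; enc = id ; dec = id ; dec-enc = λ _ → refl }

finite-⊤ : Finite ⊤
finite-⊤ = record { card = 1 ; enc = λ _ → Fin.zero ; dec = λ _ → tt ; dec-enc = λ _ → refl }

infixr 1 _⊎ᶠ_
infixr 2 _×ᶠ_

_⊎ᶠ_ : ∀ {A B} → Finite A → Finite B → Finite (A ⊎ B)
F ⊎ᶠ G = record
  { card = card F + card G
  ; enc = join (card F) (card G) ∘ Sum.map (enc F) (enc G)
  ; dec = Sum.map (dec F) (dec G) ∘ splitAt (card F)
  ; dec-enc = λ x → trans (cong (Sum.map (dec F) (dec G)) (splitAt-join (card F) (card G) (Sum.map (enc F) (enc G) x))) (cancel x) }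
  where
  cancel : ∀ x → Sum.map (dec F) (dec G) (Sum.map (enc F) (enc G) x) ≡ x
  cancel (inj₁ a) = cong inj₁ (dec-enc F a)
  cancel (inj₂ b) = cong inj₂ (dec-enc G b)

_×ᶠ_ : ∀ {A B} → Finite A → Finite B → Finite (A × B)
F ×ᶠ G = record
  { card = card F * card G
  ; enc = λ (a , b) → combine (enc F a) (enc G b)
  ; dec = λ i → let x , y = remQuot (card G) i in dec F x , dec G y
  ; dec-enc = λ (a , b) → trans (cong (λ (x , y) → dec F x , dec G y) (remQuot-combine (enc F a) (enc G b)))
                                (cong₂ _,_ (dec-enc F a) (dec-enc G b)) }

finite-Bool : Finite Bool
finite-Bool = finite-retract (finite-⊤ ⊎ᶠ finite-⊤)
  (λ { false → inj₁ tt ; true → inj₂ tt }) (λ { (inj₁ _) → false ; (inj₂ _) → true })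
  (λ { false → refl ; true → refl })

finite-Maybe : ∀ {A} → Finite A → Finite (Maybe A)
finite-Maybe F = finite-retract (finite-⊤ ⊎ᶠ F)
  (λ { nothing → inj₁ tt ; (just a) → inj₂ a }) (λ { (inj₁ _) → nothing ; (inj₂ a) → just a })
  (λ { nothing → refl ; (just a) → refl })

record Machine : Set₁ where
  field
    Q A       : Set
    finite-Q  : Finite Q
    finite-A  : Finite A
    δ         : Q → A → Maybe (Q × A × Move)
    begin     : Q
    ␣         : A
    accepting : Q → Bool

module MachineRuns (M : Machine) where
  open Machine M

  record Conf : Set where
    constructor conf
    field
      state      : Q
      left right : List A

  head : List A → A
  head []      = ␣
  head (a ∷ _) = a

  tail : List A → List A
  tail []      = []
  tail (_ ∷ r) = r

  shiftHead : Q → A → Move → Conf → Conf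
  shiftHead q′ a′ L (conf q [] r)      = conf q′ [] (a′ ∷ tail r)
  shiftHead q′ a′ L (conf q (a ∷ l) r) = conf q′ l (a ∷ a′ ∷ tail r)
  shiftHead q′ a′ R (conf q l r)       = conf q′ (a′ ∷ l) (tail r)
  shiftHead q′ a′ S (conf q l r)       = conf q′ l (a′ ∷ tail r)

  act : Maybe (Q × A × Move) → Conf → Conf
  act nothing              c = c
  act (just (q′ , a′ , m)) c = shiftHead q′ a′ m c

  scanned : Conf → Maybe (Q × A × Move)
  scanned (conf q l r) = δ q (head r)

  step′ : Conf → Conf
  step′ c = act (scanned c) c

  run′ : ℕ → Conf → Conf
  run′ zero    c = c
  run′ (suc n) c = run′ n (step′ c)

  run′-+ : ∀ m n c → run′ (m + n) c ≡ run′ n (run′ m c)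
  run′-+ zero    n c = refl
  run′-+ (suc m) n c = run′-+ m n (step′ c)

  run′-halted : ∀ n {c} → scanned c ≡ nothing → run′ n c ≡ c
  run′-halted zero        h = refl
  run′-halted (suc n) {c} h = trans (cong (run′ n) (cong (λ x → act x c) h)) (run′-halted n h)

  infix 4 _⇒[_]_
  -- Upper bounds compose and weaken easily. Since a halted machine stays put, `run′-until` turns
  -- such a bound into the fixed number of steps that the complexity classes speak of.
  _⇒[_]_ : Conf → ℕ → Conf → Set
  c ⇒[ b ] c′ = Σ ℕ λ t → t ≤ b × run′ t c ≡ c′

  stop : ∀ {c} → c ⇒[ 0 ] c
  stop = 0 , z≤n , refl

  infixr 4 _▸_
  _▸_ : ∀ {c c′ c″ a b} → c ⇒[ a ] c′ → c′ ⇒[ b ] c″ → c ⇒[ a + b ] c″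
  (t , t≤ , refl) ▸ (u , u≤ , refl) = t + u , +-mono-≤ t≤ u≤ , run′-+ t u _

  weaken : ∀ {c c′ a b} → a ≤ b → c ⇒[ a ] c′ → c ⇒[ b ] c′
  weaken a≤b (t , t≤ , e) = t , ≤-trans t≤ a≤b , e

  step-to : ∀ {c x} → scanned c ≡ just x → c ⇒[ 1 ] act (just x) c
  step-to {c} e = 1 , s≤s z≤n , cong (λ y → act y c) e

  run′-until : ∀ {c c′ b} → c ⇒[ b ] c′ → scanned c′ ≡ nothing → run′ b c ≡ c′
  run′-until {c} {b = b} (t , t≤b , refl) h = begin-equality
    run′ b c                    ≡⟨ cong (λ n → run′ n c) (m+[n∸m]≡n t≤b) ⟨
    run′ (t + (b ∸ t)) c        ≡⟨ run′-+ t (b ∸ t) c ⟩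
    run′ (b ∸ t) (run′ t c)     ≡⟨ run′-halted (b ∸ t) h ⟩
    run′ t c                    ∎
    where
    open ≡-Reasoning renaming (begin_ to begin-equality_)

  Passes : Move → Q → A → Set
  Passes m q a = δ q a ≡ just (q , a , m)

  moveLeft : ∀ {q q′ a′ l y r} xs → δ q (head r) ≡ just (q′ , a′ , L) → All (Passes L q′) xs →
             conf q (xs ++ y ∷ l) r ⇒[ suc (length xs) ] conf q′ l (y ∷ xs ʳ++ (a′ ∷ tail r))
  moveLeft []       e []       = step-to e
  moveLeft (x ∷ xs) e (p ∷ ps) = step-to e ▸ moveLeft xs p ps

  sweepLeft : ∀ {q q′ a′ l y r} (f : A → A) xs → δ q (head r) ≡ just (q′ , a′ , L) →
              All (λ x → δ q′ x ≡ just (q′ , f x , L)) xs →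
              conf q (xs ++ y ∷ l) r ⇒[ suc (length xs) ] conf q′ l (y ∷ map f xs ʳ++ (a′ ∷ tail r))
  sweepLeft f []       e []       = step-to e
  sweepLeft f (x ∷ xs) e (p ∷ ps) = step-to e ▸ sweepLeft f xs p ps

  passing : ∀ {q l r} xs → All (Passes R q) xs → conf q l (xs ++ r) ⇒[ length xs ] conf q (xs ʳ++ l) r
  passing []       []       = stop
  passing (x ∷ xs) (p ∷ ps) = step-to p ▸ passing xs ps

  moveRight : ∀ {q q′ a′ l r₀ r} xs → δ q (head r₀) ≡ just (q′ , a′ , R) → tail r₀ ≡ xs ++ r →
              All (Passes R q′) xs → conf q l r₀ ⇒[ suc (length xs) ] conf q′ (xs ʳ++ (a′ ∷ l)) r
  moveRight {q} {q′} {a′} {l} {r₀} xs e eq ps =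
    subst (λ r → conf q l r₀ ⇒[ 1 ] conf q′ (a′ ∷ l) r) eq (step-to e) ▸ passing xs ps

  All-reversed : ∀ {P : A → Set} vs {ws} → All P vs → All P ws → All P (vs ʳ++ ws)
  All-reversed []       []       qs = qs
  All-reversed (v ∷ vs) (p ∷ ps) qs = All-reversed vs ps (p ∷ qs)

  excursionRight : ∀ {q₀ q₁ q₂ a a′ y y′ l r} xs → δ q₀ a ≡ just (q₁ , a′ , R) → All (Passes R q₁) xs →
                   δ q₁ y ≡ just (q₂ , y′ , L) → All (Passes L q₂) xs →
                   conf q₀ l (a ∷ xs ++ y ∷ r) ⇒[ suc (length xs) + suc (length xs) ] conf q₂ l (a′ ∷ xs ++ y′ ∷ r)
  excursionRight {q₁ = q₁} {q₂} {a′ = a′} {y} {y′} {l} {r} xs e ps e′ ps′ =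
    moveRight xs e refl ps ▸
    subst₂ (λ l₁ r₂ → conf q₁ l₁ (y ∷ r) ⇒[ suc (length xs) ] conf q₂ l (a′ ∷ r₂)) (sym (ʳ++-defn xs)) (ʳ++-ʳ++ xs)
      (subst (λ n → conf q₁ (reverse xs ++ a′ ∷ l) (y ∷ r) ⇒[ suc n ] conf q₂ l (a′ ∷ reverse xs ʳ++ (y′ ∷ r)))
        (length-reverse xs) (moveLeft (reverse xs) e′ (All-reversed xs ps′ [])))
  excursionLeft : ∀ {q₀ q₁ q₂ a a′ y y′ l r} xs → δ q₀ a ≡ just (q₁ , a′ , L) → All (Passes L q₁) xs →
                  δ q₁ y ≡ just (q₂ , y′ , R) → All (Passes R q₂) xs →
                  conf q₀ (xs ++ y ∷ l) (a ∷ r) ⇒[ suc (length xs) + suc (length xs) ] conf q₂ (xs ++ y′ ∷ l) (a′ ∷ r)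
  excursionLeft {q₁ = q₁} {q₂} {a′ = a′} {y} {y′} {l} {r} xs e ps e′ ps′ =
    moveLeft xs e ps ▸
    subst₂ (λ r₁ l₂ → conf q₁ l (y ∷ r₁) ⇒[ suc (length xs) ] conf q₂ l₂ (a′ ∷ r)) (sym (ʳ++-defn xs)) (ʳ++-ʳ++ xs)
      (subst (λ n → conf q₁ l (y ∷ reverse xs ++ a′ ∷ r) ⇒[ suc n ] conf q₂ (reverse xs ʳ++ (y′ ∷ l)) (a′ ∷ r))
        (length-reverse xs) (moveRight (reverse xs) e′ refl (All-reversed xs ps′ [])))

  returning : ∀ {q q′ y a} ws → δ q ␣ ≡ just (q′ , a , L) → All (Passes L q′) ws →
              conf q (ws ʳ++ (y ∷ [])) [] ⇒[ suc (length ws) ] conf q′ [] (y ∷ ws ++ a ∷ [])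
  returning {q} {q′} {y} {a} ws e ps = subst₂ (λ l r → conf q l [] ⇒[ suc (length ws) ] conf q′ [] (y ∷ r))
    (sym (ʳ++-defn ws)) (ʳ++-ʳ++ ws)
    (subst (λ n → conf q (reverse ws ++ y ∷ []) [] ⇒[ suc n ] conf q′ [] (y ∷ reverse ws ʳ++ (a ∷ [])))
      (length-reverse ws) (moveLeft (reverse ws) e (All-reversed ws ps [])))

  -- The tape is bounded on the left, and the head cannot detect its end; so the input
  -- is first shifted by one cell to make room for a marker.
  module Shifting {I : Set} (inp : I → A) (carry : A → Q) (put : Q)
    (δ-carry : ∀ a i → δ (carry a) (inp i) ≡ just (carry (inp i) , a , R))
    (δ-blank : ∀ a → δ (carry a) ␣ ≡ just (put , a , R)) where

    shifted : ∀ a {l} w → conf (carry a) l (map inp w) ⇒[ suc (length w) ] conf put (map inp w ʳ++ (a ∷ l)) []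
    shifted a []      = step-to (δ-blank a)
    shifted a (i ∷ w) = step-to (δ-carry a i) ▸ shifted (inp i) w

-- From structured machines to Turing machines

module Realise (M : Machine) {I O : Set} (inE : I → Machine.A M) (outE : O → Machine.A M)
  (outE-injective : ∀ {a b} → outE a ≡ outE b → a ≡ b) (outE-nonblank : ∀ a → outE a ≢ Machine.␣ M) where
  open Machine M
  open MachineRuns M

  private
    encQ = enc finite-Q
    encA = enc finite-A

  encAct : Q × A × Move → Fin (card finite-Q) × Fin (card finite-A) × Move
  encAct (q , a , m) = encQ q , encA a , m

  tm : TM I O
  tm = record
    { nQ = card finite-Q ; nΣ = card finite-A ; start = encQ begin ; blank = encA ␣
    ; δ = λ q a → Maybe.map encAct (δ (dec finite-Q q) (dec finite-A a))
    ; accept = accepting ∘ dec finite-Q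
    ; inE = encA ∘ inE ; outE = encA ∘ outE
    ; outE-inj = λ _ _ → outE-injective ∘ enc-injective finite-A
    ; outE-nb = λ a → outE-nonblank a ∘ enc-injective finite-A }

  encConf : Conf → Config tm
  encConf (conf q l r) = cfg (encQ q) (map encA l) (map encA r)

  hd-enc : ∀ r → hd tm (map encA r) ≡ encA (head r)
  hd-enc []      = refl
  hd-enc (_ ∷ _) = refl

  tl-enc : ∀ r → tl tm (map encA r) ≡ map encA (tail r)
  tl-enc []      = refl
  tl-enc (_ ∷ _) = refl

  scanned-enc : ∀ q r → TM.δ tm (encQ q) (hd tm (map encA r)) ≡ Maybe.map encAct (δ q (head r))
  scanned-enc q r rewrite hd-enc r | dec-enc finite-Q q | dec-enc finite-A (head r) = refl

  move-enc : ∀ q′ a′ m c → move tm (encQ q′) (encA a′) m (encConf c) ≡ encConf (shiftHead q′ a′ m c)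
  move-enc q′ a′ L (conf q [] r)      rewrite tl-enc r = refl
  move-enc q′ a′ L (conf q (x ∷ l) r) rewrite tl-enc r = refl
  move-enc q′ a′ R (conf q l r)       rewrite tl-enc r = refl
  move-enc q′ a′ S (conf q l r)       rewrite tl-enc r = refl

  step-enc : ∀ c → step tm (encConf c) ≡ encConf (step′ c)
  step-enc c@(conf q l r) with TM.δ tm (encQ q) (hd tm (map encA r)) | scanned-enc q r
  ... | x | e with δ q (head r)
  step-enc c@(conf q l r) | .nothing | refl | nothing = refl
  step-enc c@(conf q l r) | ._       | refl | just (q′ , a′ , m) = move-enc q′ a′ m c

  run-enc : ∀ n c → run tm n (encConf c) ≡ encConf (run′ n c)
  run-enc zero    c = refl
  run-enc (suc n) c = trans (cong (run tm n) (step-enc c)) (run-enc n (step′ c))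

  halted-enc : ∀ c → scanned c ≡ nothing → Halted tm (encConf c)
  halted-enc (conf q l r) h = trans (scanned-enc q r) (cong (Maybe.map encAct) h)

  init-enc : ∀ w → initCfg tm w ≡ encConf (conf begin [] (map inE w))
  init-enc w = cong (cfg _ []) (map-∘ w)

  run-init : ∀ n w → run tm n (initCfg tm w) ≡ encConf (run′ n (conf begin [] (map inE w)))
  run-init n w = trans (cong (run tm n) (init-enc w)) (run-enc n _)

-- Polynomial bounds

PolyBounded : (ℕ → ℕ) → Set
PolyBounded g = Σ ℕ λ c → Σ ℕ λ d → ∀ n → g n ≤ poly c d n

poly-mono : ∀ c d {m n} → m ≤ n → poly c d m ≤ poly c d n
poly-mono c d m≤n = *-monoʳ-≤ c (^-monoˡ-≤ d (s≤s m≤n))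

poly-degree-mono : ∀ c {d e} n → d ≤ e → poly c d n ≤ poly c e n
poly-degree-mono c n d≤e = *-monoʳ-≤ c (^-monoʳ-≤ (suc n) d≤e)

bound-≤ : ∀ {f g} → (∀ n → f n ≤ g n) → PolyBounded g → PolyBounded f
bound-≤ f≤g (c , d , h) = c , d , λ n → ≤-trans (f≤g n) (h n)

bound-const : ∀ k → PolyBounded (λ _ → k)
bound-const k = k , 0 , λ n → ≤-reflexive (sym (*-identityʳ k))

bound-id : PolyBounded (λ n → n)
bound-id = 1 , 1 , λ n → ≤-trans (n≤1+n n) (≤-reflexive (sym (trans (*-identityˡ _) (*-identityʳ (suc n)))))

bound-+ : ∀ {f g} → PolyBounded f → PolyBounded g → PolyBounded (λ n → f n + g n)
bound-+ (c , d , h) (c′ , d′ , h′) = c + c′ , d ⊔ d′ , λ n → ≤-trans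
  (+-mono-≤ (≤-trans (h n) (poly-degree-mono c n (m≤m⊔n d d′))) (≤-trans (h′ n) (poly-degree-mono c′ n (m≤n⊔m d d′))))
  (≤-reflexive (sym (*-distribʳ-+ (suc n ^ (d ⊔ d′)) c c′)))

bound-* : ∀ {f g} → PolyBounded f → PolyBounded g → PolyBounded (λ n → f n * g n)
bound-* (c , d , h) (c′ , d′ , h′) = c * c′ , d + d′ , λ n → ≤-trans (*-mono-≤ (h n) (h′ n))
  (≤-reflexive (trans (solve 4 (λ a x b y → (a :* x) :* (b :* y) := (a :* b) :* (x :* y)) refl c (suc n ^ d) c′ (suc n ^ d′))
    (cong ((c * c′) *_) (sym (^-distribˡ-+-* (suc n) d d′)))))
  where open +-*-Solver

bound-^ : ∀ {f} → PolyBounded f → ∀ k → PolyBounded (λ n → f n ^ k)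
bound-^ f zero    = bound-const 1
bound-^ f (suc k) = bound-* f (bound-^ f k)

bound-poly : ∀ {f} c d → PolyBounded f → PolyBounded (λ n → poly c d (f n))
bound-poly c d f = bound-* (bound-const c) (bound-^ (bound-+ (bound-const 1) f) d)

-- Membership in NP

module Verifier where

  -- Consumed cells stay on the tape as a record: an executed push becomes `live` with its track and
  -- bit, every other letter and every popped bit becomes `dead`, a used choice bit becomes `read`,
  -- and `cursor` marks the place to return to.
  data Cell : Set where
    blank lend rend read dead cursor : Cell
    letter                           : Letter → Cell
    bit                              : Bool → Cell
    live                             : Bool → Bool → Cell

  -- The flag of main, seek, ... says which of the two tracks currently holds the left stack.
  data Ctl : Set where
    carry          : Cell → Ctl
    put ret        : Ctl
    main backLeft  : Mode → Bool → Ctl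
    seek           : Bool → Bool → Ctl
    backRight scan : Bool → Ctl

  same : Bool → Bool → Bool
  same false b = not b
  same true  b = b

  same-refl : ∀ b → same b b ≡ true
  same-refl false = refl
  same-refl true  = refl

  same⇒≡ : ∀ b c → same b c ≡ true → b ≡ c
  same⇒≡ false false _ = refl
  same⇒≡ true  true  _ = refl

  same-not : ∀ b → same (not b) b ≡ false
  same-not false = refl
  same-not true  = refl

  mode : Bool → Mode
  mode false = skip
  mode true  = exec

  δ : Ctl → Cell → Maybe (Ctl × Cell × Move)
  δ (carry a) blank             = just (put , a , R)
  δ (carry a) c                 = just (carry c , a , R)
  δ put c                       = just (ret , rend , L)
  δ ret lend                    = just (main exec false , lend , R)
  δ ret c                       = just (ret , c , L)
  δ (main exec o) (letter (push b)) = just (main exec o , live o b , R)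
  δ (main exec o) (letter (pop b))  = just (seek o b , cursor , L)
  -- Every live cell knows its track, so exchanging the stacks only flips which track counts as
  -- left.
  δ (main exec o) (letter swap)     = just (main exec (not o) , dead , R)
  δ (main m o) (letter choice)      = just (scan o , cursor , R)
  δ (main m o) (letter resume)      = just (main exec o , dead , R)
  δ (main skip o) (letter _)        = just (main skip o , dead , R)
  δ (main m o) c                    = nothing
  δ (seek o b) (live o′ b′) = if same o o′
    then (if same b b′ then just (backRight o , dead , R) else nothing)
    else just (seek o b , live o′ b′ , L)
  δ (seek o b) lend             = nothing
  δ (seek o b) c                = just (seek o b , c , L)
  δ (backRight o) cursor        = just (main exec o , dead , R)
  δ (backRight o) c             = just (backRight o , c , R)
  δ (scan o) (bit b)            = just (backLeft (mode b) o , read , L)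
  δ (scan o) rend               = nothing
  δ (scan o) c                  = just (scan o , c , R)
  δ (backLeft m o) cursor       = just (main m o , dead , R)
  δ (backLeft m o) c            = just (backLeft m o , c , L)

  accepting : Ctl → Bool
  accepting (main exec _) = true
  accepting _             = false

  finite-Letter : Finite Letter
  finite-Letter = finite-retract (finite-Fin 7) encLetter decLetter dec-encLetter

  finite-Mode : Finite Mode
  finite-Mode = finite-retract finite-Bool (λ { exec → true ; skip → false }) mode λ { exec → refl ; skip → refl }

  finite-Cell : Finite Cell
  finite-Cell = finite-retract (finite-Fin 6 ⊎ᶠ finite-Letter ⊎ᶠ finite-Bool ⊎ᶠ finite-Bool ×ᶠ finite-Bool) f g gf
    where
    f : Cell → Fin 6 ⊎ Letter ⊎ Bool ⊎ Bool × Bool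
    f blank      = inj₁ Fin.zero
    f lend       = inj₁ (Fin.suc Fin.zero)
    f rend       = inj₁ (Fin.suc (Fin.suc Fin.zero))
    f read       = inj₁ (Fin.suc (Fin.suc (Fin.suc Fin.zero)))
    f dead       = inj₁ (Fin.suc (Fin.suc (Fin.suc (Fin.suc Fin.zero))))
    f cursor     = inj₁ (Fin.suc (Fin.suc (Fin.suc (Fin.suc (Fin.suc Fin.zero)))))
    f (letter a) = inj₂ (inj₁ a)
    f (bit b)    = inj₂ (inj₂ (inj₁ b))
    f (live o b) = inj₂ (inj₂ (inj₂ (o , b)))
    g : Fin 6 ⊎ Letter ⊎ Bool ⊎ Bool × Bool → Cell
    g (inj₁ Fin.zero)                                         = blank
    g (inj₁ (Fin.suc Fin.zero))                               = lend
    g (inj₁ (Fin.suc (Fin.suc Fin.zero)))                     = rend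
    g (inj₁ (Fin.suc (Fin.suc (Fin.suc Fin.zero))))           = read
    g (inj₁ (Fin.suc (Fin.suc (Fin.suc (Fin.suc Fin.zero))))) = dead
    g (inj₁ (Fin.suc (Fin.suc (Fin.suc (Fin.suc (Fin.suc _)))))) = cursor
    g (inj₂ (inj₁ a))              = letter a
    g (inj₂ (inj₂ (inj₁ b)))       = bit b
    g (inj₂ (inj₂ (inj₂ (o , b)))) = live o b
    gf : ∀ c → g (f c) ≡ c
    gf blank      = refl
    gf lend       = refl
    gf rend       = refl
    gf read       = refl
    gf dead       = refl
    gf cursor     = refl
    gf (letter _) = refl
    gf (bit _)    = refl
    gf (live _ _) = refl

  finite-Ctl : Finite Ctl
  finite-Ctl = finite-retract
    (finite-Cell ⊎ᶠ finite-Bool ⊎ᶠ (finite-Bool ×ᶠ finite-Mode ×ᶠ finite-Bool) ⊎ᶠ finite-Bool ×ᶠ finite-Bool ⊎ᶠ finite-Bool ×ᶠ finite-Bool) f g gf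
    where
    Code = Cell ⊎ Bool ⊎ (Bool × Mode × Bool) ⊎ Bool × Bool ⊎ Bool × Bool
    f : Ctl → Code
    f (carry c)      = inj₁ c
    f put            = inj₂ (inj₁ false)
    f ret            = inj₂ (inj₁ true)
    f (main m o)     = inj₂ (inj₂ (inj₁ (false , m , o)))
    f (backLeft m o) = inj₂ (inj₂ (inj₁ (true , m , o)))
    f (seek o b)     = inj₂ (inj₂ (inj₂ (inj₁ (o , b))))
    f (backRight o)  = inj₂ (inj₂ (inj₂ (inj₂ (false , o))))
    f (scan o)       = inj₂ (inj₂ (inj₂ (inj₂ (true , o))))
    g : Code → Ctl
    g (inj₁ c)                                  = carry c
    g (inj₂ (inj₁ false))                       = put
    g (inj₂ (inj₁ true))                        = ret
    g (inj₂ (inj₂ (inj₁ (false , m , o))))      = main m o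
    g (inj₂ (inj₂ (inj₁ (true , m , o))))       = backLeft m o
    g (inj₂ (inj₂ (inj₂ (inj₁ (o , b)))))       = seek o b
    g (inj₂ (inj₂ (inj₂ (inj₂ (false , o)))))   = backRight o
    g (inj₂ (inj₂ (inj₂ (inj₂ (true , o)))))    = scan o
    gf : ∀ q → g (f q) ≡ q
    gf (carry _)      = refl
    gf put            = refl
    gf ret            = refl
    gf (main _ _)     = refl
    gf (backLeft _ _) = refl
    gf (seek _ _)     = refl
    gf (backRight _)  = refl
    gf (scan _)       = refl

  verifier : Machine
  verifier = record
    { Q = Ctl ; A = Cell ; finite-Q = finite-Ctl ; finite-A = finite-Cell
    ; δ = δ ; begin = carry lend ; ␣ = blank ; accepting = accepting }

  open MachineRuns verifier public

  -- Guided runs and the contents of the tape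

  infix 4 _⟨_∣_⟩*_
  -- Only `choose` consumes a bit, so `us` makes the automaton deterministic; surplus bits at the
  -- end are permitted.
  data _⟨_∣_⟩*_ : State → List Letter → List Bool → State → Set where
    []     : ∀ {s us} → s ⟨ [] ∣ us ⟩* s
    choose : ∀ {m l r w b us s} → (mode b , l , r) ⟨ w ∣ us ⟩* s → (m , l , r) ⟨ choice ∷ w ∣ b ∷ us ⟩* s
    _∷_    : ∀ {s s′ s″ a w us} → a ≢ choice × s ⟨ a ⟩ s′ → s′ ⟨ w ∣ us ⟩* s″ → s ⟨ a ∷ w ∣ us ⟩* s″

  -- The cells left of the head are listed nearest first, so the live cells of a track form its
  -- stack from the top down.
  stack : Bool → List Cell → List Bool
  stack o []              = []
  stack o (live o′ b ∷ c) = if same o o′ then b ∷ stack o c else stack o c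
  stack o (_ ∷ c)         = stack o c

  choices : List Cell → List Bool
  choices []          = []
  choices (bit b ∷ c) = b ∷ choices c
  choices (_ ∷ c)     = choices c

  data Processed : Cell → Set where
    live : ∀ {o b} → Processed (live o b)
    dead : Processed dead

  -- The machine must halt on ill-formed inputs too. Letters that follow the first bit are therefore
  -- counted as advice, and the scan for a bit passes over them.
  data Advice : Cell → Set where
    read   : Advice read
    bit    : ∀ {b} → Advice (bit b)
    input  : ∀ {a} → Advice (letter a)

  -- The boundary after the last letter: on such a cell, or on `rend` if the advice is empty, the
  -- state `main` halts.
  data StartsAdvice : List Cell → Set where
    []   : StartsAdvice []
    read : ∀ {c} → StartsAdvice (read ∷ c)
    bit  : ∀ {b c} → StartsAdvice (bit b ∷ c)

  data OffTrack (o : Bool) : Cell → Set where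
    live : ∀ {o′ b} → same o o′ ≡ false → OffTrack o (live o′ b)
    dead : OffTrack o dead

  data TopOf (o : Bool) : List Cell → Set where
    none : ∀ {xs} → All (OffTrack o) xs → TopOf o xs
    top  : ∀ xs b ys → All (OffTrack o) xs → TopOf o (xs ++ live o b ∷ ys)

  topOf : ∀ o {ps} → All Processed ps → TopOf o ps
  topOf o [] = none []
  topOf o (dead ∷ ps) with topOf o ps
  ... | none n        = none (dead ∷ n)
  ... | top xs b ys n = top (dead ∷ xs) b ys (dead ∷ n)
  topOf o (live {o′} {b} ∷ ps) with same o o′ in e
  ... | true with refl ← same⇒≡ o o′ e = top [] b _ []
  ... | false with topOf o ps
  ...   | none n         = none (live e ∷ n)
  ...   | top xs b′ ys n = top (live o′ b ∷ xs) b′ ys (live e ∷ n)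

  stack-none : ∀ {o xs} → All (OffTrack o) xs → stack o xs ≡ []
  stack-none []                    = refl
  stack-none (live e ∷ n) rewrite e = stack-none n
  stack-none (dead ∷ n)            = stack-none n

  stack-top : ∀ {o xs} b ys → All (OffTrack o) xs → stack o (xs ++ live o b ∷ ys) ≡ b ∷ stack o ys
  stack-top {o} b ys [] rewrite same-refl o = refl
  stack-top b ys (live e ∷ n) rewrite e     = stack-top b ys n
  stack-top b ys (dead ∷ n)                 = stack-top b ys n

  stack-killed : ∀ {o xs} ys → All (OffTrack o) xs → stack o (xs ++ dead ∷ ys) ≡ stack o ys
  stack-killed ys []                    = refl
  stack-killed ys (live e ∷ n) rewrite e = stack-killed ys n
  stack-killed ys (dead ∷ n)            = stack-killed ys n

  stack-other : ∀ {o b xs} ys → All (OffTrack o) xs →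
                stack (not o) (xs ++ dead ∷ ys) ≡ stack (not o) (xs ++ live o b ∷ ys)
  stack-other {o} ys [] rewrite same-not o = refl
  stack-other {o} ys (live {o′} {b} e ∷ n) = cong (λ s → if same (not o) o′ then b ∷ s else s) (stack-other ys n)
  stack-other ys (dead ∷ n) = stack-other ys n

  data NoBit : Cell → Set where
    read   : NoBit read
    input  : ∀ {a} → NoBit (letter a)

  data NextBit : List Cell → Set where
    none : ∀ {xs} → All NoBit xs → NextBit xs
    next : ∀ xs b ys → All NoBit xs → NextBit (xs ++ bit b ∷ ys)

  nextBit : ∀ {xs} → All Advice xs → NextBit xs
  nextBit []         = none []
  nextBit (bit ∷ as) = next [] _ _ []
  nextBit (read ∷ as) with nextBit as
  ... | none n         = none (read ∷ n)
  ... | next xs b ys n = next (read ∷ xs) b ys (read ∷ n)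
  nextBit (input {a} ∷ as) with nextBit as
  ... | none n         = none (input ∷ n)
  ... | next xs b ys n = next (letter a ∷ xs) b ys (input ∷ n)

  choices-none : ∀ {xs} → All NoBit xs → choices xs ≡ []
  choices-none []           = refl
  choices-none (read ∷ n)   = choices-none n
  choices-none (input ∷ n) = choices-none n

  choices-++ : ∀ {xs} ys → All NoBit xs → choices (xs ++ ys) ≡ choices ys
  choices-++ ys []           = refl
  choices-++ ys (read ∷ n)   = choices-++ ys n
  choices-++ ys (input ∷ n) = choices-++ ys n

  letters-NoBit : ∀ w → All NoBit (map letter w)
  letters-NoBit []      = []
  letters-NoBit (_ ∷ w) = input ∷ letters-NoBit w

  Ends : State → List Letter → List Bool → Set
  Ends s w us = Σ (List Bool) λ l → Σ (List Bool) λ r → s ⟨ w ∣ us ⟩* (exec , l , r)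

  record Verdict (c : Conf) (b : ℕ) (P : Set) : Set where
    constructor verdict
    field
      {final} : Conf
      reached : c ⇒[ b ] final
      halted  : scanned final ≡ nothing
      correct : (accepting (Conf.state final) ≡ true) ⇔ P

  reject : ∀ {c c′ k b P} → c ⇒[ k ] c′ → k ≤ b → scanned c′ ≡ nothing → accepting (Conf.state c′) ≡ false →
           (P → ⊥) → Verdict c b P
  reject run k≤b h a ¬p = verdict (weaken k≤b run) h (mk⇔ (λ e → contradiction (trans (sym a) e) λ ()) (⊥-elim ∘ ¬p))

  continue : ∀ {c c′ k K b P P′} → c ⇒[ k ] c′ → k ≤ K → P′ ⇔ P → Verdict c′ b P′ → Verdict c (K + b) P
  continue run k≤K iff (verdict run′ h ok) =
    verdict (weaken k≤K run ▸ run′) h (mk⇔ (to iff ∘ to ok) (from ok ∘ from iff))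

  deterministic : ∀ {s s′ a w us} → a ≢ choice → s ⟨ a ⟩ s′ → (∀ {s″} → s ⟨ a ⟩ s″ → s″ ≡ s′) →
                  Ends s′ w us ⇔ Ends s (a ∷ w) us
  deterministic {s} {s′} {a} {w} {us} a≢ t unique = mk⇔ (λ (l , r , run) → l , r , (a≢ , t) ∷ run) λ (l , r , run) → l , r , back a≢ run
    where
    back : ∀ {f} → a ≢ choice → s ⟨ a ∷ w ∣ us ⟩* f → s′ ⟨ w ∣ us ⟩* f
    back a≢ (choose _)        = contradiction refl a≢
    back a≢ ((_ , t′) ∷ run) with refl ← unique t′ = run

  -- The price of one letter: an excursion over at most `N` cells, out and back, and one step off
  -- the cursor.
  cost : ℕ → ℕ
  cost N = suc (suc N + suc N)

  1≤cost : ∀ {N} → 1 ≤ cost N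
  1≤cost = s≤s z≤n

  OffTrack-seek : ∀ {o b c} → OffTrack o c → Passes L (seek o b) c
  OffTrack-seek (live e) rewrite e = refl
  OffTrack-seek dead               = refl

  OffTrack-back : ∀ {o c} → OffTrack o c → Passes R (backRight o) c
  OffTrack-back (live e) = refl
  OffTrack-back dead     = refl

  NoBit-scan : ∀ {o c} → NoBit c → Passes R (scan o) c
  NoBit-scan read   = refl
  NoBit-scan input = refl

  NoBit-back : ∀ {m o c} → NoBit c → Passes L (backLeft m o) c
  NoBit-back read   = refl
  NoBit-back input = refl

  s≤s≤cost : ∀ {k N e} → k ≤ N → suc k ≤ cost N + e
  s≤s≤cost {k} {N} k≤N = ≤-trans (s≤s (≤-trans k≤N (≤-trans (m≤m+n N (suc N)) (n≤1+n _)))) (m≤m+n (cost N) _)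

  excursion≤cost : ∀ {k N} → k ≤ N → suc k + suc k + 1 ≤ cost N
  excursion≤cost {k} k≤N = ≤-trans (≤-reflexive (+-comm (suc k + suc k) 1)) (s≤s (+-mono-≤ (s≤s k≤N) (s≤s k≤N)))

  choice-step : ∀ m {o} → δ (main m o) (letter choice) ≡ just (scan o , cursor , R)
  choice-step exec = refl
  choice-step skip = refl

  Size : List Cell → List Letter → List Cell → ℕ
  Size ps w rest = length ps + length w + length rest

  prefix≤ : ∀ (xs : List Cell) {ys w rest N} → Size (xs ++ ys) w rest ≤ N → length xs ≤ N
  prefix≤ xs {ys} h = ≤-trans (≤-trans (≤-trans (≤-trans (m≤m+n (length xs) (length ys)) (≤-reflexive (sym (length-++ xs))))
    (m≤m+n _ _)) (m≤m+n _ _)) h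

  suffix≤ : ∀ (w : List Letter) (xs : List Cell) {p k N} → p + suc (length w) + (length xs + k) ≤ N → length (map letter w ++ xs) ≤ N
  suffix≤ w xs {p} {k} h = ≤-trans (≤-reflexive (trans (length-++ (map letter w)) (cong (_+ length xs) (length-map letter w))))
    (≤-trans (+-mono-≤ (≤-trans (n≤1+n _) (m≤n+m (suc (length w)) p)) (m≤m+n (length xs) k)) h)

  Tape : Mode → Bool → List Cell → List Letter → List Cell → Conf
  Tape m o ps w rest = conf (main m o) (ps ++ lend ∷ []) (map letter w ++ rest ++ rend ∷ [])

  Correct : ℕ → Mode → Bool → List Cell → List Letter → List Cell → Set
  Correct N m o ps w rest = Verdict (Tape m o ps w rest) (length w * cost N)
    (Ends (m , stack o ps , stack (not o) ps) w (choices rest))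

  -- The invariant reads both stacks off the processed cells and the remaining choices off the
  -- advice. Each letter moves to the processed side, so `Size` is constant and bounds every
  -- excursion.
  verify : ∀ {N} w m o {ps rest} → All Processed ps → All Advice rest → StartsAdvice rest →
           Size ps w rest ≤ N → Correct N m o ps w rest
  verifyPop : ∀ {N} w o b {ps rest} → All Processed ps → All Advice rest → StartsAdvice rest →
              Size ps (pop b ∷ w) rest ≤ N → Correct N exec o ps (pop b ∷ w) rest
  verifyChoice : ∀ {N} w m o {ps rest} → All Processed ps → All Advice rest → StartsAdvice rest →
                 Size ps (choice ∷ w) rest ≤ N → Correct N m o ps (choice ∷ w) rest

  module _ {w : List Letter} {rest : List Cell} {N : ℕ} where

    moved : ∀ {ps a} c → Size ps (a ∷ w) rest ≤ N → Size (c ∷ ps) w rest ≤ N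
    moved {ps} c h = ≤-trans (≤-reflexive (cong (_+ length rest) (sym (+-suc (length ps) (length w))))) h

    inPlace : ∀ {m m′ o o′ ps a} c → Processed c →
              δ (main m o) (letter a) ≡ just (main m′ o′ , c , R) → a ≢ choice →
              (m , stack o ps , stack (not o) ps) ⟨ a ⟩ (m′ , stack o′ (c ∷ ps) , stack (not o′) (c ∷ ps)) →
              (∀ {s} → (m , stack o ps , stack (not o) ps) ⟨ a ⟩ s → s ≡ (m′ , stack o′ (c ∷ ps) , stack (not o′) (c ∷ ps))) →
              All Processed ps → All Advice rest → StartsAdvice rest → Size ps (a ∷ w) rest ≤ N →
              Correct N m o ps (a ∷ w) rest
    inPlace {ps = ps} {a} c πc e a≢ t unique π α σ h =
      continue (step-to e) 1≤cost (deterministic a≢ t unique) (verify w _ _ (πc ∷ π) α σ (moved {ps} {a} c h))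

  verify [] exec o π α [] h   = verdict stop refl (mk⇔ (λ _ → _ , _ , []) (λ _ → refl))
  verify [] exec o π α read h = verdict stop refl (mk⇔ (λ _ → _ , _ , []) (λ _ → refl))
  verify [] exec o π α bit h  = verdict stop refl (mk⇔ (λ _ → _ , _ , []) (λ _ → refl))
  verify [] skip o π α [] h   = verdict stop refl (mk⇔ (λ ()) λ ())
  verify [] skip o π α read h = verdict stop refl (mk⇔ (λ ()) λ ())
  verify [] skip o π α bit h  = verdict stop refl (mk⇔ (λ ()) λ ())
  verify (push b ∷ w) exec o {ps} = inPlace (live o b) live refl (λ ()) stepped (λ { push → unique })
    where
    stacks : (b ∷ stack o ps , stack (not o) ps) ≡ (stack o (live o b ∷ ps) , stack (not o) (live o b ∷ ps))
    stacks rewrite same-refl o | same-not o = refl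
    unique = cong (exec ,_) stacks
    stepped : (exec , stack o ps , stack (not o) ps) ⟨ push b ⟩ (exec , stack o (live o b ∷ ps) , stack (not o) (live o b ∷ ps))
    stepped = subst ((exec , stack o ps , stack (not o) ps) ⟨ push b ⟩_) unique push
  verify (swap ∷ w) exec o {ps} = inPlace dead dead refl (λ ()) stepped (λ { swap → unique })
    where
    unique : (exec , stack (not o) ps , stack o ps) ≡ (exec , stack (not o) ps , stack (not (not o)) ps)
    unique = cong (λ o′ → exec , stack (not o) ps , stack o′ ps) (sym (not-involutive o))
    stepped : (exec , stack o ps , stack (not o) ps) ⟨ swap ⟩ (exec , stack (not o) ps , stack (not (not o)) ps)
    stepped = subst ((exec , stack o ps , stack (not o) ps) ⟨ swap ⟩_) unique swap
  verify (pop b ∷ w)  exec o = verifyPop w o b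
  verify (choice ∷ w) m o    = verifyChoice w m o
  verify (resume ∷ w) exec o = inPlace dead dead refl (λ ()) resume (λ { resume → refl })
  verify (resume ∷ w) skip o = inPlace dead dead refl (λ ()) resume (λ { resume → refl })
  verify (push b ∷ w) skip o = inPlace dead dead refl (λ ()) (skip push) (λ { (skip _) → refl })
  verify (pop b ∷ w)  skip o = inPlace dead dead refl (λ ()) (skip pop) (λ { (skip _) → refl })
  verify (swap ∷ w)   skip o = inPlace dead dead refl (λ ()) (skip swap) (λ { (skip _) → refl })

  verifyPop {N} w o b {ps} {rest} π α σ h with topOf o π
  ... | none n = reject (moveLeft ps refl (All.map OffTrack-seek n))
      (s≤s≤cost (≤-trans (≤-trans (m≤m+n (length ps) _) (m≤m+n _ _)) h)) refl refl
      λ (l , r , run) → empty (subst (λ st → (exec , st , stack (not o) ps) ⟨ _ ∣ _ ⟩* _) (stack-none n) run)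
    where
    empty : ∀ {r us f} → (exec , [] , r) ⟨ pop b ∷ w ∣ us ⟩* f → ⊥
    empty ((_ , ()) ∷ _)
  ... | top xs b′ ys n with same b b′ in e
  ...   | false rewrite ++-assoc xs (live o b′ ∷ ys) (lend ∷ []) =
    reject (moveLeft xs refl (All.map OffTrack-seek n)) (s≤s≤cost (prefix≤ xs {w = pop b ∷ w} {rest} h)) mismatch refl
      λ (l , r , run) → differ (subst (λ st → (exec , st , stack (not o) (xs ++ live o b′ ∷ ys)) ⟨ _ ∣ _ ⟩* _) (stack-top b′ ys n) run)
    where
    mismatch : δ (seek o b) (live o b′) ≡ nothing
    mismatch rewrite same-refl o | e = refl
    differ : ∀ {st r us f} → (exec , b′ ∷ st , r) ⟨ pop b ∷ w ∣ us ⟩* f → ⊥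
    differ ((_ , pop) ∷ _) = contradiction (trans (sym (same-refl b)) e) λ ()
  ...   | true with refl ← same⇒≡ b b′ e | πx , _ ∷ πy ← ++⁻ xs π
    rewrite ++-assoc xs (live o b ∷ ys) (lend ∷ []) =
    continue (excursionLeft xs refl (All.map OffTrack-seek n) match (All.map OffTrack-back n) ▸ step-to refl)
      (excursion≤cost (prefix≤ xs {w = pop b ∷ w} {rest} h)) (popped n)
      (subst (λ l → Verdict (conf (main exec o) (dead ∷ l) (map letter w ++ rest ++ rend ∷ [])) (length w * cost N)
                 (Ends (exec , stack o (xs ++ dead ∷ ys) , stack (not o) (xs ++ dead ∷ ys)) w (choices rest)))
        (++-assoc xs (dead ∷ ys) (lend ∷ []))
        (verify w exec o (dead ∷ ++⁺ πx (dead ∷ πy)) α σ (≤-trans (≤-reflexive size) h)))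
    where
    match : δ (seek o b) (live o b) ≡ just (backRight o , dead , R)
    match rewrite same-refl o | same-refl b = refl
    popped : ∀ {us} → All (OffTrack o) xs →
             Ends (exec , stack o (xs ++ dead ∷ ys) , stack (not o) (xs ++ dead ∷ ys)) w us ⇔
             Ends (exec , stack o (xs ++ live o b ∷ ys) , stack (not o) (xs ++ live o b ∷ ys)) (pop b ∷ w) us
    popped n rewrite stack-killed ys n | stack-top b ys n | stack-other {o} {b} ys n =
      deterministic (λ ()) pop λ { pop → refl }
    size : Size (dead ∷ xs ++ dead ∷ ys) w rest ≡ Size (xs ++ live o b ∷ ys) (pop b ∷ w) rest
    size rewrite length-++ xs {dead ∷ ys} | length-++ xs {live o b ∷ ys} =
      cong (_+ length rest) (sym (+-suc (length xs + suc (length ys)) (length w)))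

  verifyChoice {N} w m o {ps} {rest} π α σ h with nextBit α
  ... | none n rewrite choices-none n =
    reject (moveRight (map letter w ++ rest) (choice-step m) (sym (++-assoc (map letter w) rest (rend ∷ [])))
        (All.map NoBit-scan (++⁺ (letters-NoBit w) n)))
      (s≤s≤cost (suffix≤ w rest {length ps} {0} (≤-trans (≤-reflexive (cong (λ k → length ps + suc (length w) + k) (+-identityʳ (length rest)))) h)))
      refl refl
      λ { (l , r , (a≢ , _) ∷ _) → a≢ refl }
  ... | next xs b ys n = continue
    (subst₂ (λ r r′ → conf (main m o) (ps ++ lend ∷ []) (letter choice ∷ r) ⇒[ _ ] conf (main (mode b) o) (dead ∷ ps ++ lend ∷ []) r′)
      (reassoc (bit b)) (reassoc read)
      (excursionRight (map letter w ++ xs) (choice-step m) (All.map NoBit-scan (++⁺ (letters-NoBit w) n)) refl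
        (All.map NoBit-back (++⁺ (letters-NoBit w) n)) ▸ step-to refl))
    (excursion≤cost (suffix≤ w xs {length ps} {suc (length ys)} (≤-trans (≤-reflexive (cong (λ k → length ps + suc (length w) + k) (sym (length-++ xs)))) h)))
    chooses (verify w (mode b) o (dead ∷ π) (advice (++⁻ xs α)) (starts xs σ) (≤-trans (≤-reflexive size) h))
    where
    reassoc : ∀ c → (map letter w ++ xs) ++ c ∷ ys ++ rend ∷ [] ≡ map letter w ++ (xs ++ c ∷ ys) ++ rend ∷ []
    reassoc c = trans (++-assoc (map letter w) xs _) (cong (map letter w ++_) (sym (++-assoc xs (c ∷ ys) (rend ∷ []))))
    chooses : Ends (mode b , stack o ps , stack (not o) ps) w (choices (xs ++ read ∷ ys)) ⇔
             Ends (m , stack o ps , stack (not o) ps) (choice ∷ w) (choices (xs ++ bit b ∷ ys))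
    chooses rewrite choices-++ (read ∷ ys) n | choices-++ (bit b ∷ ys) n = mk⇔
      (λ (l , r , run) → l , r , choose run)
      (λ { (l , r , choose run) → l , r , run ; (l , r , (a≢ , _) ∷ _) → contradiction refl a≢ })
    advice : All Advice xs × All Advice (bit b ∷ ys) → All Advice (xs ++ read ∷ ys)
    advice (αx , _ ∷ αy) = ++⁺ αx (read ∷ αy)
    starts : ∀ xs → StartsAdvice (xs ++ bit b ∷ ys) → StartsAdvice (xs ++ read ∷ ys)
    starts []      _    = read
    starts (_ ∷ _) read = read
    starts (_ ∷ _) bit  = bit
    size : Size (dead ∷ ps) w (xs ++ read ∷ ys) ≡ Size ps (choice ∷ w) (xs ++ bit b ∷ ys)
    size rewrite length-++ xs {read ∷ ys} | length-++ xs {bit b ∷ ys} =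
      cong (_+ (length xs + suc (length ys))) (sym (+-suc (length ps) (length w)))

  inp : Fin 7 ⊎ Bool → Cell
  inp (inj₁ i) = letter (decLetter i)
  inp (inj₂ b) = bit b

  carries : ∀ a i → δ (carry a) (inp i) ≡ just (carry (inp i) , a , R)
  carries a (inj₁ _) = refl
  carries a (inj₂ _) = refl

  open Shifting inp carry put carries (λ _ → refl)

  delimited : ∀ x → conf (carry lend) [] (map inp x) ⇒[ suc (length x) + suc (length x) ]
                    conf ret [] (lend ∷ map inp x ++ rend ∷ [])
  delimited x = shifted lend x ▸
    subst (λ n → conf put (map inp x ʳ++ (lend ∷ [])) [] ⇒[ suc n ] conf ret [] (lend ∷ map inp x ++ rend ∷ []))
      (length-map inp x) (returning (map inp x) refl (passes x))
    where
    passes : ∀ x → All (Passes L ret) (map inp x)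
    passes []           = []
    passes (inj₁ _ ∷ x) = refl ∷ passes x
    passes (inj₂ _ ∷ x) = refl ∷ passes x

  begins : List (Fin 7 ⊎ Bool) → Conf
  begins x = conf (carry lend) [] (map inp x)

  time : ℕ → ℕ
  time n = (suc n + suc n) + (1 + n * cost n)

  time-bounded : PolyBounded time
  time-bounded = bound-+ (bound-+ 1+n 1+n) (bound-+ (bound-const 1) (bound-* bound-id (bound-+ (bound-const 1) (bound-+ 1+n 1+n))))
    where 1+n = bound-+ (bound-const 1) bound-id

  decides : ∀ x w {rest} → map inp x ≡ map letter w ++ rest → All Advice rest → StartsAdvice rest →
            Verdict (begins x) (time (length x)) (Ends initial w (choices rest))
  decides x w {rest} e α σ with verify {length x} w exec false [] α σ (≤-reflexive size)
    where
    size : length w + length rest ≡ length x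
    size = trans (cong (_+ length rest) (sym (length-map letter w))) (trans (sym (length-++ (map letter w)))
      (trans (cong length (sym e)) (length-map inp x)))
  ... | verdict run h ok = verdict (delimited x ▸
      subst (λ r → conf ret [] (lend ∷ map inp x ++ rend ∷ []) ⇒[ 1 ] conf (main exec false) (lend ∷ []) r)
        (trans (cong (_++ rend ∷ []) e) (++-assoc (map letter w) rest (rend ∷ []))) (step-to refl) ▸
      weaken (*-monoˡ-≤ (cost (length x)) w≤x) run) h ok
    where
    w≤x : length w ≤ length x
    w≤x = ≤-trans (≤-reflexive (sym (length-map letter w))) (≤-trans (m≤m+n _ (length rest))
      (≤-reflexive (trans (sym (length-++ (map letter w))) (trans (cong length (sym e)) (length-map inp x)))))

  record Parse (x : List (Fin 7 ⊎ Bool)) : Set where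
    constructor parse
    field
      w      : List Letter
      {rest} : List Cell
      parses : map inp x ≡ map letter w ++ rest
      advice : All Advice rest
      starts : StartsAdvice rest

  parsed : ∀ x → Parse x
  parsed []            = parse [] refl [] []
  parsed (inj₁ i ∷ x) with parse w e α σ ← parsed x = parse (decLetter i ∷ w) (cong (letter (decLetter i) ∷_) e) α σ
  parsed (inj₂ b ∷ x)  = parse [] refl (bit ∷ advices x) bit
    where
    advices : ∀ x → All Advice (map inp x)
    advices []           = []
    advices (inj₁ _ ∷ x) = input ∷ advices x
    advices (inj₂ _ ∷ x) = bit ∷ advices x

  bits-parse : ∀ (w : List (Fin 7)) (u : List Bool) → map inp (map inj₁ w ++ map inj₂ u) ≡ map letter (map decLetter w) ++ map bit u
  bits-parse []      []      = refl
  bits-parse []      (b ∷ u) = cong (bit b ∷_) (bits-parse [] u)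
  bits-parse (i ∷ w) u       = cong (letter (decLetter i) ∷_) (bits-parse w u)

  bits-advice : ∀ u → All Advice (map bit u)
  bits-advice []      = []
  bits-advice (b ∷ u) = bit ∷ bits-advice u

  bits-start : ∀ u → StartsAdvice (map bit u)
  bits-start []      = []
  bits-start (_ ∷ _) = bit

  bits-choices : ∀ u → choices (map bit u) ≡ u
  bits-choices []      = refl
  bits-choices (b ∷ u) = cong (b ∷_) (bits-choices u)

  no-output : ⊥ → Cell
  no-output ()

  no-output-injective : ∀ {a b} → no-output a ≡ no-output b → a ≡ b
  no-output-injective {()}

  no-output-nonblank : ∀ a → no-output a ≢ blank
  no-output-nonblank ()

  module Real = Realise verifier inp no-output no-output-injective no-output-nonblank

  c d : ℕ
  c = proj₁ time-bounded
  d = proj₁ (proj₂ time-bounded)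

  -- As acceptance by the machine itself, `V` is decided as soon as the machine halts on all inputs
  -- in time; its meaning matters only for letters followed by bits, where `V-spec` gives it.
  V : List (Fin 7 ⊎ Bool) → Set
  V x = TM.accept Real.tm (Config.state (run Real.tm (poly c d (length x)) (initCfg Real.tm x))) ≡ true

  final-run : ∀ {P} x → (v : Verdict (begins x) (time (length x)) P) →
              run Real.tm (poly c d (length x)) (initCfg Real.tm x) ≡ Real.encConf (Verdict.final v)
  final-run x (verdict reach h _) = trans (Real.run-init (poly c d (length x)) x)
    (cong Real.encConf (run′-until (weaken (proj₂ (proj₂ time-bounded) (length x)) reach) h))

  V-decidable : PolyDecidable V
  V-decidable = Real.tm , c , d , λ x →
    let parse w e α σ = parsed x ; v = decides x w e α σ in
    subst (Halted Real.tm) (sym (final-run x v)) (Real.halted-enc (Verdict.final v) (Verdict.halted v)) , mk⇔ id id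

  V-spec : ∀ w u → V (map inj₁ w ++ map inj₂ u) ⇔ Ends initial (map decLetter w) u
  V-spec w u = mk⇔
    (λ acc → subst (Ends initial (map decLetter w)) (bits-choices u) (to (Verdict.correct v) (trans (sym same-state) acc)))
    (λ ends → trans same-state (from (Verdict.correct v) (subst (Ends initial (map decLetter w)) (sym (bits-choices u)) ends)))
    where
    x = map inj₁ w ++ map inj₂ u
    v = decides x (map decLetter w) (bits-parse w u) (bits-advice u) (bits-start u)
    same-state : TM.accept Real.tm (Config.state (run Real.tm (poly c d (length x)) (initCfg Real.tm x))) ≡
                 accepting (Conf.state (Verdict.final v))
    same-state = trans (cong (TM.accept Real.tm ∘ Config.state) (final-run x v))
      (cong accepting (Finite.dec-enc finite-Ctl (Conf.state (Verdict.final v))))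

  guide : ∀ {s w f} → s ⟨ w ⟩* f → Σ (List Bool) λ us → length us ≤ length w × s ⟨ w ∣ us ⟩* f
  guide [] = [] , z≤n , []
  guide (choice exec ∷ run) with us , l , g ← guide run = true ∷ us , s≤s l , choose g
  guide (choice skip ∷ run) with us , l , g ← guide run = false ∷ us , s≤s l , choose g
  guide (push ∷ run)   with us , l , g ← guide run = us , m≤n⇒m≤1+n l , ((λ ()) , push) ∷ g
  guide (pop ∷ run)    with us , l , g ← guide run = us , m≤n⇒m≤1+n l , ((λ ()) , pop) ∷ g
  guide (swap ∷ run)   with us , l , g ← guide run = us , m≤n⇒m≤1+n l , ((λ ()) , swap) ∷ g
  guide (resume ∷ run) with us , l , g ← guide run = us , m≤n⇒m≤1+n l , ((λ ()) , resume) ∷ g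
  guide (skip π ∷ run) with us , l , g ← guide run = us , m≤n⇒m≤1+n l , (plain π , skip π) ∷ g
    where
    plain : ∀ {a} → Plain a → a ≢ choice
    plain push ()
    plain pop  ()
    plain swap ()

  unguide : ∀ {s w us f} → s ⟨ w ∣ us ⟩* f → s ⟨ w ⟩* f
  unguide []             = []
  unguide (choose g)     = choice _ ∷ unguide g
  unguide ((_ , t) ∷ g)  = t ∷ unguide g

  accepts-NP : InNP (λ w → Accepts (map decLetter w))
  -- At most one bit per letter is consumed, and `poly 1 1 n` is `suc n`.
  accepts-NP = V , V-decidable , 1 , 1 , λ w → mk⇔
    (λ (l , r , run) → let us , len , g = guide run in
      us , ≤-trans len (≤-trans (≤-reflexive (length-map decLetter w)) (proj₂ (proj₂ bound-id) (length w))) ,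
      from (V-spec w us) (l , r , g))
    (λ (us , _ , v) → let l , r , g = to (V-spec w us) v in l , r , unguide g)

-- The machine that computes the reduction

ʳ++-++ : ∀ {A : Set} (xs : List A) {ys zs} → xs ʳ++ (ys ++ zs) ≡ (xs ʳ++ ys) ++ zs
ʳ++-++ xs {ys} {zs} = trans (ʳ++-defn xs) (trans (sym (++-assoc (reverse xs) ys zs)) (cong (_++ zs) (sym (ʳ++-defn xs))))

nth : ∀ {A : Set} → ℕ → List A → Maybe A
nth _       []      = nothing
nth zero    (x ∷ _) = just x
nth (suc n) (_ ∷ l) = nth n l

nth-middle : ∀ {A : Set} (xs : List A) {y ys} → nth (length xs) (xs ++ y ∷ ys) ≡ just y
nth-middle []       = refl
nth-middle (_ ∷ xs) = nth-middle xs

nth-end : ∀ {A : Set} (xs : List A) → nth (length xs) xs ≡ nothing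
nth-end []       = refl
nth-end (_ ∷ xs) = nth-end xs

upper-bound : ∀ {B} → Finite B → (f : B → ℕ) → Σ ℕ λ m → ∀ b → f b ≤ m
upper-bound F f = let m , h = on-Fin (f ∘ Finite.dec F) in
  m , λ b → subst (λ b → f b ≤ m) (Finite.dec-enc F b) (h (Finite.enc F b))
  where
  on-Fin : ∀ {n} (g : Fin n → ℕ) → Σ ℕ λ m → ∀ i → g i ≤ m
  on-Fin {zero}  g = 0 , λ ()
  on-Fin {suc n} g with m , h ← on-Fin (g ∘ Fin.suc) =
    g Fin.zero ⊔ m , λ { Fin.zero → m≤m⊔n _ m ; (Fin.suc i) → ≤-trans (h i) (m≤n⊔m (g Fin.zero) m) }

data Mark (k : ℕ) : Set where
  lend mid rend : Mark k
  input     : Fin k → Mark k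

finite-Mark : ∀ k → Finite (Mark k)
finite-Mark k = finite-retract (finite-Maybe finite-Bool ⊎ᶠ finite-Fin k)
  (λ { lend → inj₁ (just false) ; mid → inj₁ nothing ; rend → inj₁ (just true) ; (input i) → inj₂ i })
  (λ { (inj₁ (just false)) → lend ; (inj₁ nothing) → mid ; (inj₁ (just true)) → rend ; (inj₂ i) → input i })
  (λ { lend → refl ; mid → refl ; rend → refl ; (input _) → refl })

-- The number of nonempty subsets with at most `j` of `m` elements, by Pascal's recursion: subsets
-- without the last element, its singleton, and its unions with nonempty smaller subsets.
ticks : ℕ → ℕ → ℕ
ticks zero    m       = 0
ticks (suc j) zero    = 0
ticks (suc j) (suc m) = ticks (suc j) m + (1 + ticks j m)

-- Every cell of the work area carries a level, initially D.  One tick lowers the first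
-- nonzero level, suc i, to zero, sets all levels before it to i, and appends a block to the
-- output.  Hence the blocks appended at level D ∸ i correspond to the (1 + i)-element
-- subsets of the work area.
module Odometer (k o D : ℕ) (E : Mark k → ℕ → List (Fin o)) (E-end : List (Fin o)) where

  Level : Set
  Level = Fin (suc D)

  Block : Set
  Block = Maybe (Mark k × Level)

  finite-Block : Finite Block
  finite-Block = finite-Maybe (finite-Mark k ×ᶠ finite-Fin (suc D))

  block : Block → List (Fin o)
  block nothing        = E-end
  block (just (x , j)) = E x (toℕ j)

  maxLength : ℕ
  maxLength = proj₁ (upper-bound finite-Block (length ∘ block))

  block≤ : ∀ b → length (block b) ≤ maxLength
  block≤ = proj₂ (upper-bound finite-Block (length ∘ block))

  data Cell : Set where
    blank : Cell
    cell  : Mark k → Level → Cell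
    out   : Fin o → Cell

  data Ctl : Set where
    carry                      : Cell → Ctl
    put put′ find home unwind halt : Ctl
    reset                      : Level → Block → Ctl
    emit                       : Block → Fin (suc maxLength) → Ctl

  -- The successor saturates in order to stay within `Fin`; in `write` the bound `i<max` keeps it
  -- below the cap whenever it is applied.
  next : Fin (suc maxLength) → Fin (suc maxLength)
  next i = fromℕ< (s≤s (m⊓n≤n (suc (toℕ i)) maxLength))

  after : Block → Ctl
  after nothing  = unwind
  after (just _) = home

  top : Level
  top = fromℕ D

  emitting : Block → Fin (suc maxLength) → Maybe (Fin o) → Ctl × Cell × Move
  emitting b i nothing  = after b , blank , L
  emitting b i (just c) = emit b (next i) , out c , R

  δ : Ctl → Cell → Maybe (Ctl × Cell × Move)
  δ (carry a) blank                  = just (put , a , R)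
  δ (carry a) c                      = just (carry c , a , R)
  δ put c                            = just (put′ , cell mid top , R)
  δ put′ c                           = just (home , cell rend top , L)
  δ find (cell x Fin.zero)           = just (find , cell x Fin.zero , R)
  δ find (cell lend (Fin.suc i))     = just (emit (just (lend , Fin.suc i)) Fin.zero , cell lend Fin.zero , R)
  δ find (cell x (Fin.suc i))        = just (reset (inject₁ i) (just (x , Fin.suc i)) , cell x Fin.zero , L)
  δ find c                           = just (emit nothing Fin.zero , c , S)
  δ (reset j b) (cell lend _)        = just (emit b Fin.zero , cell lend j , R)
  δ (reset j b) (cell x _)           = just (reset j b , cell x j , L)
  δ (reset j b) c                    = nothing
  δ (emit b i) blank                 = just (emitting b i (nth (toℕ i) (block b)))
  δ (emit b i) c                     = just (emit b i , c , R)
  δ home (cell lend j)               = just (find , cell lend j , S)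
  δ home c                           = just (home , c , L)
  δ unwind (cell rend j)             = just (halt , cell rend j , R)
  δ unwind c                         = just (unwind , c , L)
  δ halt c                           = nothing

  finite-Cell : Finite Cell
  finite-Cell = finite-retract (finite-⊤ ⊎ᶠ finite-Mark k ×ᶠ finite-Fin (suc D) ⊎ᶠ finite-Fin o)
    (λ { blank → inj₁ tt ; (cell x j) → inj₂ (inj₁ (x , j)) ; (out c) → inj₂ (inj₂ c) })
    (λ { (inj₁ _) → blank ; (inj₂ (inj₁ (x , j))) → cell x j ; (inj₂ (inj₂ c)) → out c })
    (λ { blank → refl ; (cell _ _) → refl ; (out _) → refl })

  finite-Ctl : Finite Ctl
  finite-Ctl = finite-retract
    (finite-Cell ⊎ᶠ (finite-Bool ⊎ᶠ finite-Bool ×ᶠ finite-Bool) ⊎ᶠ finite-Fin (suc D) ×ᶠ finite-Block ⊎ᶠ finite-Block ×ᶠ finite-Fin (suc maxLength))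
    f g gf
    where
    Code = Cell ⊎ (Bool ⊎ Bool × Bool) ⊎ Level × Block ⊎ Block × Fin (suc maxLength)
    f : Ctl → Code
    f (carry c)   = inj₁ c
    f halt        = inj₂ (inj₁ (inj₁ false))
    f put′        = inj₂ (inj₁ (inj₁ true))
    f put         = inj₂ (inj₁ (inj₂ (false , false)))
    f find        = inj₂ (inj₁ (inj₂ (false , true)))
    f home        = inj₂ (inj₁ (inj₂ (true , false)))
    f unwind      = inj₂ (inj₁ (inj₂ (true , true)))
    f (reset j b) = inj₂ (inj₂ (inj₁ (j , b)))
    f (emit b i)  = inj₂ (inj₂ (inj₂ (b , i)))
    g : Code → Ctl
    g (inj₁ c)                              = carry c
    g (inj₂ (inj₁ (inj₁ false)))            = halt
    g (inj₂ (inj₁ (inj₁ true)))             = put′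
    g (inj₂ (inj₁ (inj₂ (false , false))))  = put
    g (inj₂ (inj₁ (inj₂ (false , true))))   = find
    g (inj₂ (inj₁ (inj₂ (true , false))))   = home
    g (inj₂ (inj₁ (inj₂ (true , true))))    = unwind
    g (inj₂ (inj₂ (inj₁ (j , b))))          = reset j b
    g (inj₂ (inj₂ (inj₂ (b , i))))          = emit b i
    gf : ∀ q → g (f q) ≡ q
    gf (carry _)   = refl
    gf halt        = refl
    gf put′        = refl
    gf put         = refl
    gf find        = refl
    gf home        = refl
    gf unwind      = refl
    gf (reset _ _) = refl
    gf (emit _ _)  = refl

  machine : Machine
  machine = record
    { Q = Ctl ; A = Cell ; finite-Q = finite-Ctl ; finite-A = finite-Cell
    ; δ = δ ; begin = carry (cell lend top) ; ␣ = blank ; accepting = λ _ → false }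

  -- Correctness of the odometer

  open MachineRuns machine

  -- `xs` lists the cells from right to left. Before `x` can be lowered, all cells to its left have
  -- counted down from the same level; the tick of `x` sets them to level `j`, from which they count
  -- down again.
  output : ℕ → List (Mark k) → List (Fin o)
  output zero    xs       = []
  output (suc j) []       = []
  output (suc j) (x ∷ xs) = output (suc j) xs ++ E x (suc j) ++ output j xs

  -- On turning back after an emission the head writes an explicit blank, so the written tape ends
  -- with at most one.
  data Pad : List Cell → Set where
    []  : Pad []
    [␣] : Pad (blank ∷ [])

  head-pad : ∀ {p} → Pad p → head p ≡ blank
  head-pad []  = refl
  head-pad [␣] = refl

  tail-pad : ∀ {p} → Pad p → tail p ≡ []
  tail-pad []  = refl
  tail-pad [␣] = refl

  -- Cells that lie between the return point of an emission and the end of the tape.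
  data Skipped : Block → Cell → Set where
    out  : ∀ {b c} → Skipped b (out c)
    cell : ∀ {x j y i} → x ≢ lend → Skipped (just (y , i)) (cell x j)

  skip-right : ∀ {b i c} → Skipped b c → Passes R (emit b i) c
  skip-right out      = refl
  skip-right (cell _) = refl

  skip-left : ∀ {b c} → Skipped b c → Passes L (after b) c
  skip-left {nothing} out                 = refl
  skip-left {just _}  out                 = refl
  skip-left (cell {lend} x≢)              = contradiction refl x≢
  skip-left (cell {mid} x≢)               = refl
  skip-left (cell {rend} x≢)              = refl
  skip-left (cell {input _} x≢)           = refl

  skip-outs : ∀ {b} os → All (Skipped b) (map out os)
  skip-outs []       = []
  skip-outs (_ ∷ os) = out ∷ skip-outs os

  toℕ-next : ∀ i → toℕ i < maxLength → toℕ (next i) ≡ suc (toℕ i)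
  toℕ-next i i<max = trans (toℕ-fromℕ< _) (m≤n⇒m⊓n≡m i<max)

  write : ∀ b done todo i {l p} → block b ≡ done ++ todo → toℕ i ≡ length done → Pad p →
          Σ (Fin (suc maxLength)) λ i′ → Σ (List Cell) λ p′ → Pad p′ × nth (toℕ i′) (block b) ≡ nothing ×
          conf (emit b i) l p ⇒[ length todo ] conf (emit b i′) (map out todo ʳ++ l) p′
  write b done [] i {p = p} eq ei π =
    i , p , π , trans (cong₂ nth ei (trans eq (++-identityʳ done))) (nth-end done) , stop
  write b done (c ∷ todo) i {l} {p} eq ei π =
    let i′ , p′ , π′ , end , run = write b (done ++ c ∷ []) todo (next i) {out c ∷ l} {[]}
          (trans eq (sym (++-assoc done (c ∷ []) todo)))
          (trans (toℕ-next i i<max) (trans (cong suc ei) (trans (+-comm 1 _) (sym (length-++ done))))) [] in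
    i′ , p′ , π′ , end ,
      (subst (λ p₁ → conf (emit b i) l p ⇒[ 1 ] conf (emit b (next i)) (out c ∷ l) p₁) (tail-pad π) (step-to here′) ▸ run)
    where
    i<max : toℕ i < maxLength
    i<max = ≤-trans (≤-trans (s≤s (≤-reflexive ei)) (≤-trans (s≤s (m≤m+n (length done) (length todo)))
      (≤-reflexive (sym (trans (cong length eq) (trans (length-++ done) (+-suc (length done) (length todo)))))))) (block≤ b)
    here′ : δ (emit b i) (head p) ≡ just (emit b (next i) , out c , R)
    here′ = trans (cong (δ (emit b i)) (head-pad π))
      (cong (just ∘ emitting b i) (trans (cong₂ nth ei eq) (nth-middle done)))

  emission : ∀ b stuff {y l p} → All (Skipped b) stuff → Pad p →
             conf (emit b Fin.zero) (y ∷ l) (stuff ++ p)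
             ⇒[ length stuff + (length (block b) + suc (length stuff + length (block b))) ]
             conf (after b) l (y ∷ stuff ++ map out (block b) ++ blank ∷ [])
  emission b stuff {y} {l} σ π with i , p′ , π′ , end , run ← write b [] (block b) Fin.zero {stuff ʳ++ (y ∷ l)} refl refl π =
    passing stuff (All.map skip-right σ) ▸ run ▸
    subst₂ (λ l₁ r₂ → conf (emit b i) l₁ p′ ⇒[ suc (length stuff + length (block b)) ] conf (after b) l (y ∷ r₂))
      (trans (sym (ʳ++-defn written)) (++-ʳ++ stuff)) right-part
      (subst (λ n → conf (emit b i) (reverse written ++ y ∷ l) p′ ⇒[ suc n ] conf (after b) l (y ∷ reverse written ʳ++ (blank ∷ tail p′)))
        (trans (length-reverse written) (trans (length-++ stuff) (cong (length stuff +_) (length-map out (block b)))))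
        (moveLeft (reverse written) turn (All-reversed written (All.map skip-left (++⁺ σ (skip-outs (block b)))) [])))
    where
    written = stuff ++ map out (block b)
    turn : δ (emit b i) (head p′) ≡ just (after b , blank , L)
    turn rewrite head-pad π′ | end = refl
    right-part : reverse written ʳ++ (blank ∷ tail p′) ≡ stuff ++ map out (block b) ++ blank ∷ []
    right-part rewrite tail-pad π′ = trans (ʳ++-ʳ++ written) (++-assoc stuff (map out (block b)) (blank ∷ []))

  data Inner : Cell → Set where
    inner : ∀ {x j} → x ≢ lend → Inner (cell x j)

  inner-skipped : ∀ {x i c} → Inner c → Skipped (just (x , i)) c
  inner-skipped (inner x≢) = cell x≢

  data Prefix : List (Mark k) → Set where
    [lend] : Prefix (lend ∷ [])
    _∷_    : ∀ {x y xs} → x ≢ lend → Prefix (y ∷ xs) → Prefix (x ∷ y ∷ xs)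

  prefix-last : ∀ {xs} → Prefix xs → Σ (List (Mark k)) λ vs → All (_≢ lend) vs × xs ≡ vs ++ lend ∷ []
  prefix-last [lend] = [] , [] , refl
  prefix-last (_∷_ {x} x≢ π) with vs , vs≢ , eq ← prefix-last π = x ∷ vs , x≢ ∷ vs≢ , cong (x ∷_) eq

  levelled : Level → List (Mark k) → List Cell
  levelled j = map (λ x → cell x j)

  -- In order: the walk to the first nonzero level, the sweep back, the step at `lend`, the
  -- emission, and the step from `home` to `find`. `B` bounds every distance.
  tickCost : ℕ → ℕ
  tickCost B = B + (B + (1 + ((B + (B + suc (B + B))) + 1)))

  find-step : ∀ {x i} → x ≢ lend →
              δ find (cell x (Fin.suc i)) ≡ just (reset (inject₁ i) (just (x , Fin.suc i)) , cell x Fin.zero , L)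
  find-step {lend}    x≢ = contradiction refl x≢
  find-step {mid}     x≢ = refl
  find-step {rend}    x≢ = refl
  find-step {input _} x≢ = refl

  finish-tick : ∀ b {j B p} stuff os → All (Skipped (just b)) stuff → Pad p →
    length stuff + length os ≤ B → length (block (just b)) ≤ B →
    conf (emit (just b) Fin.zero) (cell lend j ∷ []) (stuff ++ map out os ++ p)
    ⇒[ (B + (B + suc (B + B))) + 1 ]
    conf find [] (cell lend j ∷ stuff ++ map out (os ++ block (just b)) ++ blank ∷ [])
  finish-tick b {j} {B} {p} stuff os σ π s≤B b≤B =
    weaken (+-mono-≤ l≤B (+-mono-≤ b≤B (s≤s (+-mono-≤ l≤B b≤B))))
      (subst (λ t → conf (emit (just b) Fin.zero) (cell lend j ∷ []) t
                      ⇒[ length between + (length (block (just b)) + suc (length between + length (block (just b)))) ]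
                    conf home [] (cell lend j ∷ between ++ map out (block (just b)) ++ blank ∷ []))
        (++-assoc stuff (map out os) p) (emission (just b) between (++⁺ σ (skip-outs os)) π)) ▸
    subst (λ t → conf home [] (cell lend j ∷ between ++ map out (block (just b)) ++ blank ∷ []) ⇒[ 1 ] conf find [] (cell lend j ∷ t))
      (trans (++-assoc stuff (map out os) _) (cong (stuff ++_) (trans (sym (++-assoc (map out os) _ _))
        (cong (_++ blank ∷ []) (sym (map-++ out os (block (just b)))))))) (step-to refl)
    where
    between = stuff ++ map out os
    l≤B : length between ≤ B
    l≤B = ≤-trans (≤-reflexive (trans (length-++ stuff) (cong (length stuff +_) (length-map out os)))) s≤B

  tick-inner : ∀ {xs x i rest os p B} → x ≢ lend → (Σ (List (Mark k)) λ vs → All (_≢ lend) vs × xs ≡ vs ++ lend ∷ []) →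
    All Inner rest → Pad p →
    length xs + (suc (length rest) + (length os + length (E x (suc (toℕ i))))) ≤ B →
    conf find [] (levelled Fin.zero xs ʳ++ (cell x (Fin.suc i) ∷ rest ++ map out os ++ p))
    ⇒[ tickCost B ]
    conf find [] (levelled (inject₁ i) xs ʳ++ (cell x Fin.zero ∷ rest ++ map out (os ++ E x (suc (toℕ i))) ++ blank ∷ []))
  tick-inner {x = x} {i} {rest} {os} {p} {B} x≢ (vs , vs≢ , refl) ρ π h =
    weaken (≤-trans (≤-reflexive (trans (length-reverse V) (length-map _ (vs ++ lend ∷ [])))) xs≤B)
      (subst₂ (λ r₁ l₂ → conf find [] r₁ ⇒[ length (reverse V) ] conf find l₂ tape) (sym (ʳ++-defn V))
        (trans (ʳ++-ʳ++ V) (trans (++-identityʳ V) (map-++ _ vs (lend ∷ []))))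
        (passing (reverse V) (All-reversed V (zeros (vs ++ lend ∷ [])) []))) ▸
    weaken (≤-trans (≤-reflexive (trans (cong suc (length-map _ vs)) (trans (+-comm 1 _) (sym (length-++ vs))))) xs≤B)
      (sweepLeft lower (levelled Fin.zero vs) (find-step x≢) (lowers vs vs≢)) ▸
    step-to refl ▸
    subst₂ (λ r₁ r₂ → conf (emit (just b) Fin.zero) (cell lend (inject₁ i) ∷ []) r₁ ⇒[ _ ] conf find [] r₂) start end
      (finish-tick b (levelled (inject₁ i) vs ʳ++ (cell x Fin.zero ∷ rest)) os
        (All-reversed (levelled (inject₁ i) vs) (skips vs vs≢) (cell x≢ ∷ All.map inner-skipped ρ)) π
        (≤-trans (≤-reflexive (cong (_+ length os) (trans (length-ʳ++ (levelled (inject₁ i) vs)) (cong (_+ suc (length rest)) (length-map _ vs))))) stuff≤B)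
        (≤-trans (≤-trans (m≤n+m _ (length os)) (≤-trans (m≤n+m _ (suc (length rest))) (m≤n+m _ (length (vs ++ lend ∷ []))))) h))
    where
    b = x , Fin.suc i
    V = levelled Fin.zero (vs ++ lend ∷ [])
    tape = cell x (Fin.suc i) ∷ rest ++ map out os ++ p
    lower : Cell → Cell
    lower (cell y _) = cell y (inject₁ i)
    lower c          = c
    xs≤B : length (vs ++ lend ∷ []) ≤ B
    xs≤B = ≤-trans (m≤m+n _ _) h
    stuff≤B : length vs + suc (length rest) + length os ≤ B
    stuff≤B = ≤-trans (≤-reflexive (+-assoc (length vs) (suc (length rest)) (length os)))
      (≤-trans (+-mono-≤ (≤-trans (m≤m+n (length vs) 1) (≤-reflexive (sym (length-++ vs)))) (+-monoʳ-≤ (suc (length rest)) (m≤m+n (length os) _))) h)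
    zeros : ∀ ys → All (Passes R find) (levelled Fin.zero ys)
    zeros []       = []
    zeros (_ ∷ ys) = refl ∷ zeros ys
    lowers : ∀ ys → All (_≢ lend) ys → All (λ c → δ (reset (inject₁ i) (just b)) c ≡ just (reset (inject₁ i) (just b) , lower c , L)) (levelled Fin.zero ys)
    lowers []             []        = []
    lowers (lend ∷ ys)    (y≢ ∷ ≢s) = contradiction refl y≢
    lowers (mid ∷ ys)     (y≢ ∷ ≢s) = refl ∷ lowers ys ≢s
    lowers (rend ∷ ys)    (y≢ ∷ ≢s) = refl ∷ lowers ys ≢s
    lowers (input _ ∷ ys) (y≢ ∷ ≢s) = refl ∷ lowers ys ≢s
    skips : ∀ ys → All (_≢ lend) ys → All (Skipped (just b)) (levelled (inject₁ i) ys)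
    skips []       []        = []
    skips (_ ∷ ys) (y≢ ∷ ≢s) = cell y≢ ∷ skips ys ≢s
    start : (levelled (inject₁ i) vs ʳ++ (cell x Fin.zero ∷ rest)) ++ map out os ++ p ≡
            map lower (levelled Fin.zero vs) ʳ++ (cell x Fin.zero ∷ rest ++ map out os ++ p)
    start = trans (sym (ʳ++-++ (levelled (inject₁ i) vs)))
      (cong (_ʳ++ (cell x Fin.zero ∷ rest ++ map out os ++ p)) (map-∘ vs))
    end : cell lend (inject₁ i) ∷ (levelled (inject₁ i) vs ʳ++ (cell x Fin.zero ∷ rest)) ++ map out (os ++ E x (suc (toℕ i))) ++ blank ∷ [] ≡
          levelled (inject₁ i) (vs ++ lend ∷ []) ʳ++ (cell x Fin.zero ∷ rest ++ map out (os ++ E x (suc (toℕ i))) ++ blank ∷ [])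
    end = sym (trans (cong (_ʳ++ _) (map-++ _ vs (lend ∷ []))) (trans (++-ʳ++ (levelled (inject₁ i) vs))
      (cong (cell lend (inject₁ i) ∷_) (ʳ++-++ (levelled (inject₁ i) vs)))))

  tick : ∀ {xs x i rest os p B n} → toℕ i ≡ n → Prefix (x ∷ xs) → All Inner rest → Pad p →
    length xs + (suc (length rest) + (length os + length (E x (suc n)))) ≤ B →
    conf find [] (levelled Fin.zero xs ʳ++ (cell x (Fin.suc i) ∷ rest ++ map out os ++ p))
    ⇒[ tickCost B ]
    conf find [] (levelled (inject₁ i) xs ʳ++ (cell x Fin.zero ∷ rest ++ map out (os ++ E x (suc n)) ++ blank ∷ []))
  tick {i = i} {rest} {os} {p} {B} refl [lend] ρ π h =
    weaken (≤-trans (m≤n+m _ B) (m≤n+m _ B))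
      (step-to refl ▸ finish-tick (lend , Fin.suc i) rest os (All.map inner-skipped ρ) π
        (≤-trans (+-monoʳ-≤ (length rest) (m≤m+n (length os) _)) (≤-trans (n≤1+n _) h))
        (≤-trans (≤-trans (m≤n+m _ (length os)) (m≤n+m _ (suc (length rest)))) h))
  tick refl (x≢ ∷ π₀) = tick-inner x≢ (prefix-last π₀)

  record Phase (n : ℕ) (xs : List (Mark k)) (j : Level) (rest : List Cell) (os : List (Fin o)) (p : List Cell) (B : ℕ) : Set where
    constructor phased
    field
      {pad}  : List Cell
      isPad  : Pad pad
      phases : conf find [] (levelled j xs ʳ++ (rest ++ map out os ++ p)) ⇒[ ticks n (length xs) * tickCost B ]
               conf find [] (levelled Fin.zero xs ʳ++ (rest ++ map out (os ++ output n xs) ++ pad))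

  -- The induction follows `output`: a phase for the cells left of `x`, one tick of `x`, and a phase
  -- at the lower level. `B` covers the output still to come, so that all ticks share one cost.
  phase : ∀ n xs {j rest os p B} → toℕ j ≡ n → Prefix xs → All Inner rest → Pad p →
          length xs + (length rest + (length os + length (output n xs))) ≤ B → Phase n xs j rest os p B
  phase zero xs {Fin.zero} {rest} {os} {p} refl _ _ π h = phased π
    (subst (λ os′ → conf find [] (levelled Fin.zero xs ʳ++ (rest ++ map out os ++ p))
                    ⇒[ 0 ] conf find [] (levelled Fin.zero xs ʳ++ (rest ++ map out os′ ++ p))) (sym (++-identityʳ os)) stop)
  phase (suc n) (x ∷ xs) {Fin.suc i} {rest} {os} {p} {B} eq pre ρ π h = phased (isPad ih₂)
    (weaken (≤-reflexive (sym (trans (*-distribʳ-+ K (ticks (suc n) (length xs)) (1 + ticks n (length xs)))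
        (cong (ticks (suc n) (length xs) * K +_) (*-distribʳ-+ K 1 (ticks n (length xs)))))))
      (phases ih₁ ▸ weaken (≤-reflexive (sym (+-identityʳ K))) (tick {i = i} {os = os₁} (suc-injective eq) pre ρ (isPad ih₁) fits-tick) ▸
       subst (λ os′ → conf find [] (levelled (inject₁ i) xs ʳ++ (cell x Fin.zero ∷ rest ++ map out (os₁ ++ e) ++ blank ∷ []))
                      ⇒[ ticks n (length xs) * K ]
                      conf find [] (levelled Fin.zero (x ∷ xs) ʳ++ (rest ++ map out os′ ++ pad ih₂)))
         (trans (++-assoc os₁ e o₂) (++-assoc os o₁ (e ++ o₂))) (phases ih₂)))
    where
    open Phase
    open +-*-Solver
    K = tickCost B
    o₁ = output (suc n) xs
    e  = E x (suc n)
    o₂ = output n xs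
    os₁ = os ++ o₁
    total : suc (length xs) + (length rest + (length os + (length o₁ + (length e + length o₂)))) ≤ B
    total = ≤-trans (≤-reflexive (cong (λ m → suc (length xs) + (length rest + (length os + m)))
      (sym (trans (length-++ o₁) (cong (length o₁ +_) (length-++ e)))))) h
    fits-before : length xs + (suc (length rest) + (length os + length o₁)) ≤ B
    fits-before = ≤-trans (m≤m+n _ (length e + length o₂)) (≤-trans (≤-reflexive
      (solve 6 (λ a r s u v w → (a :+ ((con 1 :+ r) :+ (s :+ u))) :+ (v :+ w) := (con 1 :+ a) :+ (r :+ (s :+ (u :+ (v :+ w))))) refl
        (length xs) (length rest) (length os) (length o₁) (length e) (length o₂))) total)
    fits-tick : length xs + (suc (length rest) + (length os₁ + length e)) ≤ B
    fits-tick rewrite length-++ os {o₁} = ≤-trans (m≤m+n _ (length o₂)) (≤-trans (≤-reflexive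
      (solve 6 (λ a r s u v w → (a :+ ((con 1 :+ r) :+ ((s :+ u) :+ v))) :+ w := (con 1 :+ a) :+ (r :+ (s :+ (u :+ (v :+ w))))) refl
        (length xs) (length rest) (length os) (length o₁) (length e) (length o₂))) total)
    fits-after : length xs + (suc (length rest) + (length (os₁ ++ e) + length o₂)) ≤ B
    fits-after rewrite length-++ os₁ {e} | length-++ os {o₁} = ≤-trans (≤-reflexive
      (solve 6 (λ a r s u v w → a :+ ((con 1 :+ r) :+ (((s :+ u) :+ v) :+ w)) := (con 1 :+ a) :+ (r :+ (s :+ (u :+ (v :+ w))))) refl
        (length xs) (length rest) (length os) (length o₁) (length e) (length o₂))) total
    output-[] : ∀ m → output m [] ≡ []
    output-[] zero    = refl
    output-[] (suc m) = refl
    empty : ∀ m {j rest os p} → Pad p → Phase m [] j rest os p B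
    empty m {j} {rest} {os} {p} π = phased π (weaken z≤n
      (subst (λ os′ → conf find [] (rest ++ map out os ++ p) ⇒[ 0 ] conf find [] (rest ++ map out os′ ++ p))
        (sym (trans (cong (os ++_) (output-[] m)) (++-identityʳ os))) stop))
    before : ∀ {xs} → Prefix (x ∷ xs) → length xs + (suc (length rest) + (length os + length (output (suc n) xs))) ≤ B →
             Phase (suc n) xs (Fin.suc i) (cell x (Fin.suc i) ∷ rest) os p B
    before [lend] _ = empty (suc n) π
    before (_∷_ {y = y} {ys} x≢ pre) h = phase (suc n) (y ∷ ys) eq pre (inner x≢ ∷ ρ) π h
    ih₁ = before pre fits-before
    beyond : ∀ {xs os} → Prefix (x ∷ xs) → length xs + (suc (length rest) + (length os + length (output n xs))) ≤ B →
             Phase n xs (inject₁ i) (cell x Fin.zero ∷ rest) os (blank ∷ []) B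
    beyond [lend] _ = empty n [␣]
    beyond (_∷_ {y = y} {ys} x≢ pre) h = phase n (y ∷ ys) (trans (toℕ-inject₁ i) (suc-injective eq)) pre (inner x≢ ∷ ρ) [␣] h
    ih₂ = beyond pre fits-after

  marks : List (Fin k) → List (Mark k)
  marks w = rend ∷ mid ∷ (map input w ʳ++ (lend ∷ []))

  length-marks : ∀ w → length (marks w) ≡ 3 + length w
  length-marks w = cong (2 +_) (trans (length-ʳ++ (map input w)) (trans (+-comm _ 1) (cong suc (length-map input w))))

  marks-prefix : ∀ w → Prefix (marks w)
  marks-prefix w = add (λ ()) (add (λ ()) (inputs w [lend]))
    where
    add : ∀ {x ys} → x ≢ lend → Prefix ys → Prefix (x ∷ ys)
    add x≢ [lend]       = x≢ ∷ [lend]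
    add x≢ (y≢ ∷ π)     = x≢ ∷ (y≢ ∷ π)
    inputs : ∀ w {ys} → Prefix ys → Prefix (map input w ʳ++ ys)
    inputs []      π = π
    inputs (i ∷ w) π = inputs w (add (λ ()) π)

  inputs-at : Level → List (Fin k) → List Cell
  inputs-at j = map (λ i → cell (input i) j)

  levelled-marks : ∀ j w r → levelled j (marks w) ʳ++ r ≡ cell lend j ∷ inputs-at j w ++ cell mid j ∷ cell rend j ∷ r
  levelled-marks j w r = trans (cong (_ʳ++ (cell mid j ∷ cell rend j ∷ r)) (map-ʳ++ _ (map input w)))
    (trans (ʳ++-ʳ++ (map _ (map input w))) (cong (λ t → cell lend j ∷ t ++ cell mid j ∷ cell rend j ∷ r) (sym (map-∘ w))))

  open Shifting (λ i → cell (input i) top) carry put (λ _ _ → refl) (λ _ → refl)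

  begins : List (Fin k) → Conf
  begins w = conf (carry (cell lend top)) [] (inputs-at top w)

  ready : ∀ w → begins w ⇒[ suc (length w) + (1 + (suc (length w + 1) + 1)) ] conf find [] (levelled top (marks w) ʳ++ [])
  ready w = shifted (cell lend top) w ▸ step-to refl ▸
    subst₂ (λ n l → conf put′ l [] ⇒[ suc n ] conf home [] (cell lend top ∷ (inputs-at top w ++ cell mid top ∷ []) ++ cell rend top ∷ []))
      (trans (length-++ (inputs-at top w)) (cong (_+ 1) (length-map _ w))) (++-ʳ++ (inputs-at top w))
      (returning (inputs-at top w ++ cell mid top ∷ []) refl (++⁺ (passes w) (refl ∷ []))) ▸
    subst (λ t → conf home [] (cell lend top ∷ (inputs-at top w ++ cell mid top ∷ []) ++ cell rend top ∷ []) ⇒[ 1 ] conf find [] t)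
      (trans (cong (cell lend top ∷_) (++-assoc (inputs-at top w) (cell mid top ∷ []) (cell rend top ∷ []))) (sym (levelled-marks top w [])))
      (step-to refl)
    where
    passes : ∀ w → All (Passes L home) (inputs-at top w)
    passes []      = []
    passes (_ ∷ w) = refl ∷ passes w

  start-ending : ∀ os {l p} → Pad p → Σ (List Cell) λ p′ → Pad p′ ×
    conf find l (map out os ++ p) ⇒[ 1 ] conf (emit nothing Fin.zero) l (map out os ++ p′)
  start-ending []      []  = _ , [␣] , step-to refl
  start-ending []      [␣] = _ , [␣] , step-to refl
  start-ending (_ ∷ _) π   = _ , π , step-to refl

  -- With all levels zero, `find` runs off the work area and `E-end` is appended; `unwind` then
  -- leaves the head on the first output cell, where `OutputIs` expects it.
  ending : ∀ w os {p} → Pad p → Σ (List Cell) λ l →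
    conf find [] (levelled Fin.zero (marks w) ʳ++ (map out os ++ p))
    ⇒[ (suc (length w) + 1) + (1 + (1 + ((length os + (length E-end + suc (length os + length E-end))) + 1))) ]
    conf halt l (map out os ++ map out E-end ++ blank ∷ [])
  ending w os {p} π = let p′ , π′ , begin = start-ending os π in
    cell rend Fin.zero ∷ (zs ʳ++ []) ,
    subst₂ (λ n t → conf find [] t ⇒[ n ] conf find (zs ʳ++ []) (cell rend Fin.zero ∷ map out os ++ p))
      (trans (length-++ (cell lend Fin.zero ∷ inputs-at Fin.zero w)) (cong (λ n → suc n + 1) (length-map _ w)))
      (trans (++-assoc (cell lend Fin.zero ∷ inputs-at Fin.zero w) _ _) (sym (levelled-marks Fin.zero w (map out os ++ p))))
      (passing zs (++⁺ (refl ∷ zeros w) (refl ∷ []))) ▸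
    step-to refl ▸ begin ▸
    subst (λ n → conf (emit nothing Fin.zero) (cell rend Fin.zero ∷ (zs ʳ++ [])) (map out os ++ p′)
                 ⇒[ n + (length E-end + suc (n + length E-end)) ]
                 conf unwind (zs ʳ++ []) (cell rend Fin.zero ∷ map out os ++ map out E-end ++ blank ∷ [])) (length-map out os)
      (emission nothing (map out os) (skip-outs os) π′) ▸
    step-to refl
    where
    zs = (cell lend Fin.zero ∷ inputs-at Fin.zero w) ++ cell mid Fin.zero ∷ []
    zeros : ∀ w → All (Passes R find) (inputs-at Fin.zero w)
    zeros []      = []
    zeros (_ ∷ w) = refl ∷ zeros w

  -- Output and running time of the odometer

  computed : List (Fin k) → List (Fin o)
  computed w = output D (marks w) ++ E-end

  output-length : ∀ n xs → n ≤ D → length (output n xs) ≤ ticks n (length xs) * maxLength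
  output-length zero    xs       _   = z≤n
  output-length (suc n) []       _   = z≤n
  output-length (suc n) (x ∷ xs) n<D = ≤-trans
    (≤-reflexive (trans (length-++ (output (suc n) xs)) (cong (length (output (suc n) xs) +_) (length-++ (E x (suc n))))))
    (≤-trans (+-mono-≤ (output-length (suc n) xs n<D) (+-mono-≤ E≤ (output-length n xs (≤-trans (n≤1+n n) n<D))))
      (≤-reflexive (sym (*-distribʳ-+ maxLength (ticks (suc n) (length xs)) (1 + ticks n (length xs))))))
    where
    E≤ : length (E x (suc n)) ≤ maxLength
    E≤ = subst (λ j → length (E x j) ≤ maxLength) (toℕ-fromℕ< (s≤s n<D)) (block≤ (just (x , fromℕ< (s≤s n<D))))

  -- The successor accounts for the empty subset, and with it the recursion becomes a plain sum of
  -- two terms.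
  ticks≤ : ∀ j m → suc (ticks j m) ≤ suc m ^ j
  ticks≤ zero    m       = s≤s z≤n
  ticks≤ (suc j) zero    = ≤-reflexive (sym (^-zeroˡ (suc j)))
  ticks≤ (suc j) (suc m) = ≤-trans (+-mono-≤ (ticks≤ (suc j) m) (ticks≤ j m))
    (≤-trans (≤-reflexive (+-comm _ (suc m ^ j))) (*-monoʳ-≤ (suc (suc m)) (^-monoˡ-≤ j (n≤1+n (suc m)))))

  outputBound : ℕ → ℕ
  outputBound n = ticks D (3 + n) * maxLength

  time : ℕ → ℕ
  time n = (suc n + (1 + (suc (n + 1) + 1))) + (ticks D (3 + n) * tickCost ((3 + n) + outputBound n) +
    ((suc n + 1) + (1 + (1 + ((outputBound n + (length E-end + suc (outputBound n + length E-end))) + 1)))))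

  time-bounded : PolyBounded time
  time-bounded = bound-+ (bound-+ 1+n (bound-+ one (bound-+ (bound-+ one (bound-+ bound-id one)) one))) (bound-+ (bound-* tk cost)
      (bound-+ (bound-+ 1+n one) (bound-+ one (bound-+ one (bound-+ (bound-+ ob (bound-+ (bound-const _) (bound-+ one (bound-+ ob (bound-const _))))) one)))))
    where
    one = bound-const 1
    1+n = bound-+ one bound-id
    3+n = bound-+ (bound-const 3) bound-id
    tk : PolyBounded (λ n → ticks D (3 + n))
    tk = bound-≤ (λ n → ≤-trans (n≤1+n _) (ticks≤ D (3 + n))) (bound-^ (bound-+ (bound-const 4) bound-id) D)
    ob : PolyBounded outputBound
    ob = bound-* tk (bound-const maxLength)
    B = bound-+ 3+n ob
    cost = bound-+ B (bound-+ B (bound-+ one (bound-+ (bound-+ B (bound-+ B (bound-+ one (bound-+ B B)))) one)))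

  record Halting (w : List (Fin k)) : Set where
    constructor halting
    field
      {left} : List Cell
      halts  : begins w ⇒[ time (length w) ] conf halt left (map out (computed w) ++ blank ∷ [])

  computes : ∀ w → Halting w
  computes w = halting (weaken total (ready w ▸ Phase.phases ph ▸ proj₂ (ending w (output D (marks w)) (Phase.isPad ph)) ▸ same))
    where
    n = length w
    B = (3 + n) + outputBound n
    out≤ : length (output D (marks w)) ≤ outputBound n
    out≤ = ≤-trans (output-length D (marks w) ≤-refl) (≤-reflexive (cong (λ m → ticks D m * maxLength) (length-marks w)))
    ph : Phase D (marks w) top [] [] [] B
    ph = phase D (marks w) (toℕ-fromℕ D) (marks-prefix w) [] [] (+-mono-≤ (≤-reflexive (length-marks w)) out≤)
    same : ∀ {q l} → conf q l (map out (output D (marks w)) ++ map out E-end ++ blank ∷ []) ⇒[ 0 ]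
                     conf q l (map out (computed w) ++ blank ∷ [])
    same {q} {l} = subst (λ t → conf q l (map out (output D (marks w)) ++ map out E-end ++ blank ∷ []) ⇒[ 0 ] conf q l t)
      (trans (sym (++-assoc (map out (output D (marks w))) (map out E-end) _)) (cong (_++ blank ∷ []) (sym (map-++ out (output D (marks w)) E-end)))) stop
    total = +-monoʳ-≤ (suc n + (1 + (suc (n + 1) + 1))) (+-mono-≤
      (≤-reflexive (cong (λ m → ticks D m * tickCost B) (length-marks w)))
      (≤-trans (≤-reflexive (+-identityʳ _))
        (+-monoʳ-≤ (suc n + 1) (s≤s (s≤s (+-monoˡ-≤ 1 (+-mono-≤ out≤ (+-monoʳ-≤ (length E-end) (s≤s (+-monoˡ-≤ (length E-end) out≤))))))))))

  out-injective : ∀ {a b} → out a ≡ out b → a ≡ b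
  out-injective refl = refl

  out-nonblank : ∀ a → out a ≢ blank
  out-nonblank _ ()

  module Real = Realise machine (λ i → cell (input i) top) out out-injective out-nonblank

  computable : PolyComputable computed
  computable = Real.tm , c , d , λ w → let halting {l} h = computes w in
    let final = trans (Real.run-init (poly c d (length w)) w) (cong Real.encConf (run′-until (weaken (c,d≥ (length w)) h) refl)) in
    subst (Halted Real.tm) (sym final) (Real.halted-enc (conf halt l (map out (computed w) ++ blank ∷ [])) refl) ,
    Finite.enc finite-Cell blank ∷ [] ,
    trans (cong Config.right final) (trans (map-++ _ (map out (computed w)) (blank ∷ []))
      (cong (_++ Finite.enc finite-Cell blank ∷ []) (sym (map-∘ (computed w))))) , refl
    where
    c = proj₁ time-bounded
    d = proj₁ (proj₂ time-bounded)
    c,d≥ = proj₂ (proj₂ time-bounded)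

-- Programs on two stacks of symbols

module Programs (Sym : Set) (code : Sym → ℕ) (code-injective : ∀ {a b} → code a ≡ code b → a ≡ b) where

  data Instr : Set where
    pushL pushR popL popR : Sym → Instr

  Stacks : Set
  Stacks = List Sym × List Sym

  infix 4 _⟪_⟫_
  data _⟪_⟫_ : Stacks → List Instr → Stacks → Set where
    []    : ∀ {s} → s ⟪ [] ⟫ s
    pushL : ∀ {a l r is s} → (a ∷ l , r) ⟪ is ⟫ s → (l , r) ⟪ pushL a ∷ is ⟫ s
    pushR : ∀ {a l r is s} → (l , a ∷ r) ⟪ is ⟫ s → (l , r) ⟪ pushR a ∷ is ⟫ s
    popL  : ∀ {a l r is s} → (l , r) ⟪ is ⟫ s → (a ∷ l , r) ⟪ popL a ∷ is ⟫ s
    popR  : ∀ {a l r is s} → (l , r) ⟪ is ⟫ s → (l , a ∷ r) ⟪ popR a ∷ is ⟫ s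

  -- Read from the top, a symbol is a block of `true` ended by `false`, so pushing writes it in
  -- reverse. The code is prefix-free: popping any other symbol gets stuck.
  pushCode popCode : ℕ → List Letter
  pushCode zero    = push false ∷ []
  pushCode (suc n) = pushCode n ++ push true ∷ []
  popCode zero     = pop false ∷ []
  popCode (suc n)  = pop true ∷ popCode n

  unary : ℕ → List Bool → List Bool
  unary zero    st = false ∷ st
  unary (suc n) st = true ∷ unary n st

  ⌜_⌝ : List Sym → List Bool
  ⌜ [] ⌝    = []
  ⌜ a ∷ l ⌝ = unary (code a) ⌜ l ⌝

  compile₁ : Instr → List Letter
  compile₁ (pushL a) = pushCode (code a)
  compile₁ (popL a)  = popCode (code a)
  compile₁ (pushR a) = swap ∷ pushCode (code a) ++ swap ∷ []
  compile₁ (popR a)  = swap ∷ popCode (code a) ++ swap ∷ []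

  compile : List Instr → List Letter
  compile []       = []
  compile (i ∷ is) = compile₁ i ++ compile is

  loaded : Stacks → State
  loaded (l , r) = exec , ⌜ l ⌝ , ⌜ r ⌝

  split-run : ∀ {s s″} u {v} → s ⟨ u ++ v ⟩* s″ → Σ State λ s′ → s ⟨ u ⟩* s′ × s′ ⟨ v ⟩* s″
  split-run []      run       = _ , [] , run
  split-run (a ∷ u) (t ∷ run) = let s′ , p , q = split-run u run in s′ , t ∷ p , q

  plain-unique : ∀ {s s₁ s₂ a} → Plain a → s ⟨ a ⟩ s₁ → s ⟨ a ⟩ s₂ → s₁ ≡ s₂
  plain-unique push push     push     = refl
  plain-unique push (skip _) (skip _) = refl
  plain-unique pop  pop      pop      = refl
  plain-unique pop  (skip _) (skip _) = refl
  plain-unique swap swap     swap     = refl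
  plain-unique swap (skip _) (skip _) = refl

  plain-run-unique : ∀ {s s₁ s₂ u} → All Plain u → s ⟨ u ⟩* s₁ → s ⟨ u ⟩* s₂ → s₁ ≡ s₂
  plain-run-unique []       []       []       = refl
  plain-run-unique (π ∷ πs) (t ∷ run) (t′ ∷ run′) with refl ← plain-unique π t t′ = plain-run-unique πs run run′

  skip-run : ∀ {u l r} → All Plain u → (skip , l , r) ⟨ u ⟩* (skip , l , r)
  skip-run []       = []
  skip-run (π ∷ πs) = skip π ∷ skip-run πs

  pushCode-plain : ∀ n → All Plain (pushCode n)
  pushCode-plain zero    = push ∷ []
  pushCode-plain (suc n) = ++⁺ (pushCode-plain n) (push ∷ [])

  popCode-plain : ∀ n → All Plain (popCode n)
  popCode-plain zero    = pop ∷ []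
  popCode-plain (suc n) = pop ∷ popCode-plain n

  compile₁-plain : ∀ i → All Plain (compile₁ i)
  compile₁-plain (pushL a) = pushCode-plain (code a)
  compile₁-plain (popL a)  = popCode-plain (code a)
  compile₁-plain (pushR a) = swap ∷ ++⁺ (pushCode-plain (code a)) (swap ∷ [])
  compile₁-plain (popR a)  = swap ∷ ++⁺ (popCode-plain (code a)) (swap ∷ [])

  compile-plain : ∀ is → All Plain (compile is)
  compile-plain []       = []
  compile-plain (i ∷ is) = ++⁺ (compile₁-plain i) (compile-plain is)

  push-run : ∀ n {l r} → (exec , l , r) ⟨ pushCode n ⟩* (exec , unary n l , r)
  push-run zero    = push ∷ []
  push-run (suc n) = push-run n +++ (push ∷ [])

  pop-run : ∀ n {l r} → (exec , unary n l , r) ⟨ popCode n ⟩* (exec , l , r)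
  pop-run zero    = pop ∷ []
  pop-run (suc n) = pop ∷ pop-run n

  compile-run : ∀ {s s′ is} → s ⟪ is ⟫ s′ → loaded s ⟨ compile is ⟩* loaded s′
  compile-run []                 = []
  compile-run (pushL {a} run)    = push-run (code a) +++ compile-run run
  compile-run (popL {a} run)     = pop-run (code a) +++ compile-run run
  compile-run (pushR {a} run)    = (swap ∷ (push-run (code a) +++ (swap ∷ []))) +++ compile-run run
  compile-run (popR {a} run)     = (swap ∷ (pop-run (code a) +++ (swap ∷ []))) +++ compile-run run

  pop-unary : ∀ m n {l r s} → (exec , unary m l , r) ⟨ popCode n ⟩* s → m ≡ n × s ≡ (exec , l , r)
  pop-unary zero    zero    (pop ∷ [])  = refl , refl
  pop-unary zero    (suc n) (() ∷ _)
  pop-unary (suc m) zero    (() ∷ _)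
  pop-unary (suc m) (suc n) (pop ∷ run) with refl , e ← pop-unary m n run = refl , e

  pop-sound : ∀ {a} l {r s} → (exec , ⌜ l ⌝ , r) ⟨ popCode (code a) ⟩* s →
              Σ (List Sym) λ l′ → l ≡ a ∷ l′ × s ≡ (exec , ⌜ l′ ⌝ , r)
  pop-sound {a} (b ∷ l) run with e , refl ← pop-unary (code b) (code a) run with refl ← code-injective e = l , refl , refl
  pop-sound {a} []      run = ⊥-elim (empty (code a) run)
    where
    empty : ∀ n {r s} → (exec , [] , r) ⟨ popCode n ⟩* s → ⊥
    empty zero    (() ∷ _)
    empty (suc n) (() ∷ _)

  -- Pushes and swaps act deterministically, and by prefix-freeness a run through `popCode` removes
  -- exactly the named symbol; no run can stop between two symbols.
  compile-sound : ∀ {s t} is → loaded s ⟨ compile is ⟩* t → Σ Stacks λ s′ → s ⟪ is ⟫ s′ × t ≡ loaded s′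
  compile-sound {s} [] [] = s , [] , refl
  compile-sound {l , r} (pushL a ∷ is) run
    with _ , p , q ← split-run (pushCode (code a)) run
    with refl ← plain-run-unique (pushCode-plain (code a)) p (push-run (code a))
    with s′ , e , eq ← compile-sound is q = s′ , pushL e , eq
  compile-sound {l , r} (popL a ∷ is) run
    with _ , p , q ← split-run (popCode (code a)) run
    with _ , refl , refl ← pop-sound l p
    with s′ , e , eq ← compile-sound is q = s′ , popL e , eq
  compile-sound {l , r} (pushR a ∷ is) (swap ∷ run)
    with _ , p , q ← split-run (pushCode (code a) ++ swap ∷ []) run
    with refl ← plain-run-unique (++⁺ (pushCode-plain (code a)) (swap ∷ [])) p (push-run (code a) +++ (swap ∷ []))
    with s′ , e , eq ← compile-sound is q = s′ , pushR e , eq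
  compile-sound {l , r} (popR a ∷ is) (swap ∷ run)
    with _ , p , q ← split-run (popCode (code a) ++ swap ∷ []) run
    with _ , p₁ , p₂ ← split-run (popCode (code a)) p
    with _ , refl , refl ← pop-sound r p₁
    with swap ∷ [] ← p₂
    with s′ , e , eq ← compile-sound is q = s′ , popR e , eq

  -- The final `resume` restores `exec`, so that a skipped block ends in a `loaded` state as well.
  blockCode : List Instr → List Letter
  blockCode is = choice ∷ compile is ++ resume ∷ []

  block-skipped : ∀ {s} is → loaded s ⟨ blockCode is ⟩* loaded s
  block-skipped is = choice skip ∷ (skip-run (compile-plain is) +++ (resume ∷ []))

  block-run : ∀ {s s′ is} → s ⟪ is ⟫ s′ → loaded s ⟨ blockCode is ⟩* loaded s′
  block-run run = choice exec ∷ (compile-run run +++ (resume ∷ []))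

  block-sound : ∀ {s t} is → loaded s ⟨ blockCode is ⟩* t → (t ≡ loaded s) ⊎ (Σ Stacks λ s′ → s ⟪ is ⟫ s′ × t ≡ loaded s′)
  block-sound {s} is (choice exec ∷ run)
    with _ , p , resume ∷ [] ← split-run (compile is) run
    with s′ , e , refl ← compile-sound {s} is p = inj₂ (s′ , e , refl)
  block-sound is (choice skip ∷ run)
    with _ , p , resume ∷ [] ← split-run (compile is) run
    with refl ← plain-run-unique (compile-plain is) p (skip-run (compile-plain is)) = inj₁ refl

  module Tables (blocks : List (List Instr)) where

    infix 4 _↦_ _↦*_
    _↦_ : Stacks → Stacks → Set
    s ↦ s′ = Σ (List Instr) λ is → is ∈ blocks × s ⟪ is ⟫ s′

    -- One pass through the table may execute several blocks, so soundness yields a sequence of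
    -- unknown length; completeness spends one pass per block and needs the count in `_↦[_]_`.
    data _↦*_ : Stacks → Stacks → Set where
      []  : ∀ {s} → s ↦* s
      _∷_ : ∀ {s s′ s″} → s ↦ s′ → s′ ↦* s″ → s ↦* s″

    infix 4 _↦[_]_
    data _↦[_]_ : Stacks → ℕ → Stacks → Set where
      stop : ∀ {s n} → s ↦[ n ] s
      _∷_  : ∀ {s s′ s″ n} → s ↦ s′ → s′ ↦[ n ] s″ → s ↦[ suc n ] s″

    ↦-weaken : ∀ {s s′ m n} → m ≤ n → s ↦[ m ] s′ → s ↦[ n ] s′
    ↦-weaken _         stop    = stop
    ↦-weaken (s≤s m≤n) (x ∷ p) = x ∷ ↦-weaken m≤n p

    ↦-trans : ∀ {s s′ s″ m n} → s ↦[ m ] s′ → s′ ↦[ n ] s″ → s ↦[ m + n ] s″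
    ↦-trans {m = m} {n} stop q = ↦-weaken (m≤n+m n m) q
    ↦-trans (x ∷ p)          q = x ∷ ↦-trans p q

    tableOf : List (List Instr) → List Letter
    tableOf []         = []
    tableOf (is ∷ bs) = blockCode is ++ tableOf bs

    table : List Letter
    table = tableOf blocks

    tableOf-skipped : ∀ bs {s} → loaded s ⟨ tableOf bs ⟩* loaded s
    tableOf-skipped []        = []
    tableOf-skipped (is ∷ bs) {s} = block-skipped {s} is +++ tableOf-skipped bs {s}

    tableOf-run : ∀ {bs is s s′} → is ∈ bs → s ⟪ is ⟫ s′ → loaded s ⟨ tableOf bs ⟩* loaded s′
    tableOf-run {_ ∷ bs} {s′ = s′} (here refl) run = block-run run +++ tableOf-skipped bs {s′}
    tableOf-run {b ∷ bs} {s = s} (there is∈) run = block-skipped {s} b +++ tableOf-run is∈ run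

    tableOf-only : ∀ bs {s t} → (∀ {is} → is ∈ bs → is ∈ blocks) → loaded s ⟨ tableOf bs ⟩* t →
                   Σ Stacks λ s′ → s ↦* s′ × t ≡ loaded s′
    tableOf-only []        {s} _ [] = s , [] , refl
    tableOf-only (is ∷ bs) {s} ⊆ run with _ , p , q ← split-run (blockCode is) run with block-sound {s} is p
    ... | inj₁ refl           = tableOf-only bs {s} (⊆ ∘ there) q
    ... | inj₂ (s₁ , x , refl) with s′ , y , e ← tableOf-only bs {s₁} (⊆ ∘ there) q = s′ , (is , ⊆ (here refl) , x) ∷ y , e

    table-only : ∀ {s t} → loaded s ⟨ table ⟩* t → Σ Stacks λ s′ → s ↦* s′ × t ≡ loaded s′
    table-only {s} = tableOf-only blocks {s} id

-- difference d b m is the b-th forward difference of m ^ d; the values at 0 are the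
-- coefficients that express m ^ d as a combination of binomial coefficients of m.
difference : ℕ → ℕ → ℕ → ℕ
difference zero    zero    m = 1
difference zero    (suc b) m = 0
difference (suc d) zero    m = m * difference d zero m
difference (suc d) (suc b) m = (m + suc b) * difference d (suc b) m + suc b * difference d b m

difference-zero : ∀ d m → difference d 0 m ≡ m ^ d
difference-zero zero    m = refl
difference-zero (suc d) m = cong (m *_) (difference-zero d m)

-- The recursion of `difference` is the Leibniz rule for the product of the identity with the d-th
-- power. It avoids subtraction, and the defining equation of forward differences follows by
-- induction.
difference-suc : ∀ d b m → difference d b (suc m) ≡ difference d b m + difference d (suc b) m
difference-suc zero    zero    m = refl
difference-suc zero    (suc b) m = refl
difference-suc (suc d) zero    m rewrite difference-suc d 0 m =
  solve 3 (λ m x y → (con 1 :+ m) :* (x :+ y) := m :* x :+ ((m :+ con 1) :* y :+ con 1 :* x)) refl m (difference d 0 m) (difference d 1 m)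
  where open +-*-Solver
difference-suc (suc d) (suc b) m rewrite difference-suc d (suc b) m | difference-suc d b m =
  solve 5 (λ m b x y z → (con 1 :+ m :+ (con 1 :+ b)) :* (y :+ z) :+ (con 1 :+ b) :* (x :+ y) :=
      (m :+ (con 1 :+ b)) :* y :+ (con 1 :+ b) :* x :+ ((m :+ (con 2 :+ b)) :* z :+ (con 2 :+ b) :* y)) refl
    m b (difference d b m) (difference d (suc b) m) (difference d (suc (suc b)) m)
  where open +-*-Solver

difference-vanishes : ∀ {d b} m → d < b → difference d b m ≡ 0
difference-vanishes {zero}  {suc b} m _          = refl
difference-vanishes {suc d} {suc b} m (s≤s d<b)
  rewrite difference-vanishes {d} {suc b} m (m≤n⇒m≤1+n d<b) | difference-vanishes {d} {b} m d<b =
  cong₂ _+_ (*-zeroʳ (m + suc b)) (*-zeroʳ b)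

-- The total weight of the nonempty subsets with at most `n` of `m` cells, where a subset of 1+i
-- elements weighs `g (b + i)`; the recursion is that of `ticks`.
weighted : (ℕ → ℕ) → ℕ → ℕ → ℕ → ℕ
weighted g b zero    m       = 0
weighted g b (suc n) zero    = 0
weighted g b (suc n) (suc m) = weighted g b (suc n) m + (g b + weighted g (suc b) n m)

weight : ℕ → ℕ → ℕ → ℕ
weight c d b = c * difference d b 0

-- Newton's formula for the b-th difference, by Pascal's recursion. Because of `d ≤ b + n`,
-- truncation after `n` terms loses only vanishing differences.
weighted-sum : ∀ c d b n m → d ≤ b + n → weight c d b + weighted (weight c d) (suc b) n m ≡ c * difference d b m
weighted-sum c d b zero    zero    h = +-identityʳ _
weighted-sum c d b zero    (suc m) h = begin
  weight c d b + 0              ≡⟨ weighted-sum c d b zero m h ⟩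
  c * difference d b m          ≡⟨ cong (c *_) (+-identityʳ _) ⟨
  c * (difference d b m + 0)    ≡⟨ cong (λ z → c * (difference d b m + z)) (difference-vanishes m (s≤s (≤-trans h (≤-reflexive (+-identityʳ b))))) ⟨
  c * (difference d b m + difference d (suc b) m) ≡⟨ cong (c *_) (difference-suc d b m) ⟨
  c * difference d b (suc m)    ∎
  where open ≡-Reasoning
weighted-sum c d b (suc n) zero    h = +-identityʳ _
weighted-sum c d b (suc n) (suc m) h = begin
  weight c d b + (weighted (weight c d) (suc b) (suc n) m + (weight c d (suc b) + weighted (weight c d) (suc (suc b)) n m))
    ≡⟨ +-assoc (weight c d b) (weighted (weight c d) (suc b) (suc n) m) _ ⟨
  (weight c d b + weighted (weight c d) (suc b) (suc n) m) + (weight c d (suc b) + weighted (weight c d) (suc (suc b)) n m)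
    ≡⟨ cong₂ _+_ (weighted-sum c d b (suc n) m h) (weighted-sum c d (suc b) n m (≤-trans h (≤-reflexive (+-suc b n)))) ⟩
  c * difference d b m + c * difference d (suc b) m ≡⟨ *-distribˡ-+ c (difference d b m) _ ⟨
  c * (difference d b m + difference d (suc b) m)   ≡⟨ cong (c *_) (difference-suc d b m) ⟨
  c * difference d b (suc m)                        ∎
  where open ≡-Reasoning

weighted-power : ∀ c d n m → d ≤ n → weight c d 0 + weighted (weight c d) 1 n m ≡ c * m ^ d
weighted-power c d n m d≤n = trans (weighted-sum c d 0 n m d≤n) (cong (c *_) (difference-zero d m))

-- Simulation of a Turing machine

module Simulation {k : ℕ} (M : TM (Fin k ⊎ Bool) ⊥) where

  open TM M using (nQ; nΣ)

  -- The top of the right stack acts as control: `guess`, `rewind`, a state of `M`, or `accepted`.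
  -- Below it lies the tape from the head on, and the left stack holds the cells to the left of the
  -- head.
  data Sym : Set where
    tape                                       : Fin nΣ → Sym
    state                                      : Fin nQ → Sym
    bottom guess unknown rewind accepted       : Sym

  finite-Sym : Finite Sym
  finite-Sym = finite-retract (finite-Fin nΣ ⊎ᶠ finite-Fin nQ ⊎ᶠ finite-Fin 5) f g gf
    where
    f : Sym → Fin nΣ ⊎ Fin nQ ⊎ Fin 5
    f (tape a)  = inj₁ a
    f (state q) = inj₂ (inj₁ q)
    f bottom    = inj₂ (inj₂ Fin.zero)
    f guess     = inj₂ (inj₂ (Fin.suc Fin.zero))
    f unknown   = inj₂ (inj₂ (Fin.suc (Fin.suc Fin.zero)))
    f rewind    = inj₂ (inj₂ (Fin.suc (Fin.suc (Fin.suc Fin.zero))))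
    f accepted  = inj₂ (inj₂ (Fin.suc (Fin.suc (Fin.suc (Fin.suc Fin.zero)))))
    g : Fin nΣ ⊎ Fin nQ ⊎ Fin 5 → Sym
    g (inj₁ a)                                              = tape a
    g (inj₂ (inj₁ q))                                       = state q
    g (inj₂ (inj₂ Fin.zero))                                = bottom
    g (inj₂ (inj₂ (Fin.suc Fin.zero)))                      = guess
    g (inj₂ (inj₂ (Fin.suc (Fin.suc Fin.zero))))            = unknown
    g (inj₂ (inj₂ (Fin.suc (Fin.suc (Fin.suc Fin.zero))))) = rewind
    g (inj₂ (inj₂ (Fin.suc (Fin.suc (Fin.suc (Fin.suc _)))))) = accepted
    gf : ∀ a → g (f a) ≡ a
    gf (tape _)  = refl
    gf (state _) = refl
    gf bottom    = refl
    gf guess     = refl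
    gf unknown   = refl
    gf rewind    = refl
    gf accepted  = refl

  abstract
    symCode : Sym → ℕ
    symCode = toℕ ∘ Finite.enc finite-Sym

    symCode-injective : ∀ {a b} → symCode a ≡ symCode b → a ≡ b
    symCode-injective = Finite.enc-injective finite-Sym ∘ toℕ-injective

  open Programs Sym symCode symCode-injective public

  data Rule : Set where
    rewindCell : Fin nΣ → Rule
    rewindBit  : Bool → Rule
    rewound    : Rule
    stepping   : Fin nQ → Maybe (Fin nΣ) → Maybe (Fin nΣ) → Rule

  finite-Rule : Finite Rule
  finite-Rule = finite-retract
    (finite-Fin nΣ ⊎ᶠ finite-Maybe finite-Bool ⊎ᶠ finite-Fin nQ ×ᶠ finite-Maybe (finite-Fin nΣ) ×ᶠ finite-Maybe (finite-Fin nΣ))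
    (λ { (rewindCell a) → inj₁ a ; (rewindBit b) → inj₂ (inj₁ (just b)) ; rewound → inj₂ (inj₁ nothing)
       ; (stepping q h x) → inj₂ (inj₂ (q , h , x)) })
    (λ { (inj₁ a) → rewindCell a ; (inj₂ (inj₁ (just b))) → rewindBit b ; (inj₂ (inj₁ nothing)) → rewound
       ; (inj₂ (inj₂ (q , h , x))) → stepping q h x })
    (λ { (rewindCell _) → refl ; (rewindBit _) → refl ; rewound → refl ; (stepping _ _ _) → refl })

  -- Here nothing stands for the end of a tape half.
  endSym : Maybe (Fin nΣ) → Sym
  endSym (just a) = tape a
  endSym nothing  = bottom

  val : Maybe (Fin nΣ) → Fin nΣ
  val (just a) = a
  val nothing  = TM.blank M

  refill : Maybe (Fin nΣ) → List Instr → List Instr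
  refill (just _) is = is
  refill nothing  is = pushR bottom ∷ is

  -- A move to the left brings the neighbour `c` under the head; at the left end the head stays in
  -- place, so `bottom` returns to the left stack.
  uncover : Maybe (Fin nΣ) → Fin nΣ → List Instr → List Instr
  uncover (just c) a is = pushR (tape a) ∷ pushR (tape c) ∷ is
  uncover nothing  a is = pushL bottom ∷ pushR (tape a) ∷ is

  -- Blocks without effect start by popping bottom, which is never on top of the right stack
  -- between blocks.
  transition : Fin nQ → Maybe (Fin nΣ) → Maybe (Fin nΣ) → Maybe (Fin nQ × Fin nΣ × Move) → List Instr
  transition q h x nothing = if TM.accept M q
    then popR (state q) ∷ popR (endSym h) ∷ pushR accepted ∷ []
    else popR bottom ∷ []
  transition q h x (just (q′ , a , L)) =
    popR (state q) ∷ popR (endSym h) ∷ popL (endSym x) ∷ refill h (uncover x a (pushR (state q′) ∷ []))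
  transition q h x (just (q′ , a , R)) =
    popR (state q) ∷ popR (endSym h) ∷ refill h (pushL (tape a) ∷ pushR (state q′) ∷ [])
  transition q h x (just (q′ , a , S)) =
    popR (state q) ∷ popR (endSym h) ∷ refill h (pushR (tape a) ∷ pushR (state q′) ∷ [])

  bit : Bool → Fin nΣ
  bit b = TM.inE M (inj₂ b)

  rule : Rule → List Instr
  rule (rewindCell a)   = popR rewind ∷ popL (tape a) ∷ pushR (tape a) ∷ pushR rewind ∷ []
  rule (rewindBit b)    = popR rewind ∷ popL unknown ∷ pushR (tape (bit b)) ∷ pushR rewind ∷ []
  rule rewound          = popR rewind ∷ popL bottom ∷ pushL bottom ∷ pushR (state (TM.start M)) ∷ []
  rule (stepping q h x) = transition q h x (TM.δ M q (val h))

  -- A single block, so that each copy contributes at most one bit to the certificate; two blocks,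
  -- one per value, could both be executed. The value is chosen later, by `rewindBit`.
  guessing : List Instr
  guessing = popR guess ∷ pushL unknown ∷ pushR guess ∷ []

  rules : List (List Instr)
  rules = map (rule ∘ Finite.dec finite-Rule) (allFin (Finite.card finite-Rule))

  open Tables rules public

  by-rule : ∀ r {s s′} → s ⟪ rule r ⟫ s′ → s ↦ s′
  by-rule r {s} {s′} run = rule r , subst (λ r′ → rule r′ ∈ _) (Finite.dec-enc finite-Rule r)
    (∈-map⁺ (rule ∘ Finite.dec finite-Rule) (∈-allFin (Finite.enc finite-Rule r))) , run

  rule-of : ∀ {s s′} → s ↦ s′ → Σ Rule λ r → s ⟪ rule r ⟫ s′
  rule-of (is , is∈ , run) with i , _ , refl ← ∈-map⁻ (rule ∘ Finite.dec finite-Rule) is∈ = Finite.dec finite-Rule i , run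

  -- Transition blocks and steps of the machine

  ends : List (Fin nΣ) → List Sym
  ends l = map tape l ++ bottom ∷ []

  stacksOf : Config M → Stacks
  stacksOf (cfg q l r) = ends l , state q ∷ ends r

  step-δ : ∀ {q l r x} → TM.δ M q (hd M r) ≡ just x → step M (cfg q l r) ≡ move M (proj₁ x) (proj₁ (proj₂ x)) (proj₂ (proj₂ x)) (cfg q l r)
  step-δ e rewrite e = refl

  step-halted : ∀ {c} → Halted M c → step M c ≡ c
  step-halted {c} e rewrite e = refl

  peek : List (Fin nΣ) → Maybe (Fin nΣ)
  peek []      = nothing
  peek (a ∷ _) = just a

  pop-end : ∀ r h {l is s} → (l , ends r) ⟪ popR (endSym h) ∷ is ⟫ s → h ≡ peek r
  pop-end []      nothing  (popR _) = refl
  pop-end []      (just _) ()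
  pop-end (a ∷ r) nothing  ()
  pop-end (a ∷ r) (just b) (popR _) = refl

  -- The pops compare the guessed `q`, `h` and, for a left move, `x` with the actual configuration,
  -- so only the block of the actual transition can run through.
  transition-sound : ∀ q h x q₀ l r {s} → (ends l , state q₀ ∷ ends r) ⟪ rule (stepping q h x) ⟫ s →
    (s ≡ stacksOf (step M (cfg q₀ l r))) ⊎
    (Halted M (cfg q₀ l r) × TM.accept M q₀ ≡ true × (Σ (List Sym) λ l′ → Σ (List Sym) λ r′ → s ≡ (l′ , accepted ∷ r′)))
  transition-sound q h x q₀ l r run with TM.δ M q (val h) in e
  transition-sound q h x q₀ l r run | nothing with TM.accept M q in acc
  transition-sound q h x q₀ l r (popR run) | nothing | true with refl ← pop-end r h run with r | run
  ... | []    | popR (pushR []) = inj₂ (e , acc , _ , _ , refl)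
  ... | _ ∷ _ | popR (pushR []) = inj₂ (e , acc , _ , _ , refl)
  transition-sound q h x q₀ l r () | nothing | false
  transition-sound q h x q₀ l r (popR run) | just (q′ , a , S) with refl ← pop-end r h run with r | run
  ... | []    | popR (pushR (pushR (pushR []))) = inj₁ (cong stacksOf (sym (step-δ e)))
  ... | _ ∷ _ | popR (pushR (pushR []))         = inj₁ (cong stacksOf (sym (step-δ e)))
  transition-sound q h x q₀ l r (popR run) | just (q′ , a , R) with refl ← pop-end r h run with r | run
  ... | []    | popR (pushR (pushL (pushR []))) = inj₁ (cong stacksOf (sym (step-δ e)))
  ... | _ ∷ _ | popR (pushL (pushR []))         = inj₁ (cong stacksOf (sym (step-δ e)))
  transition-sound q h x q₀ l r (popR run) | just (q′ , a , L) with refl ← pop-end r h run with r | l | x | run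
  ... | []    | []    | nothing | popR (popL (pushR (pushL (pushR (pushR [])))))  = inj₁ (cong stacksOf (sym (step-δ e)))
  ... | []    | _ ∷ _ | just _  | popR (popL (pushR (pushR (pushR (pushR [])))))  = inj₁ (cong stacksOf (sym (step-δ e)))
  ... | _ ∷ _ | []    | nothing | popR (popL (pushL (pushR (pushR []))))          = inj₁ (cong stacksOf (sym (step-δ e)))
  ... | _ ∷ _ | _ ∷ _ | just _  | popR (popL (pushR (pushR (pushR []))))          = inj₁ (cong stacksOf (sym (step-δ e)))
  ... | []    | []    | just _  | popR ()
  ... | []    | _ ∷ _ | nothing | popR ()
  ... | _ ∷ _ | []    | just _  | popR ()
  ... | _ ∷ _ | _ ∷ _ | nothing | popR ()

  transition-run : ∀ c {x} → TM.δ M (Config.state c) (hd M (Config.right c)) ≡ just x → stacksOf c ↦ stacksOf (step M c)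
  transition-run c@(cfg q l r) {x} e = by-rule (stepping q (peek r) (peek l))
    (subst₂ (λ y c′ → stacksOf c ⟪ transition q (peek r) (peek l) y ⟫ stacksOf c′) (sym (look r e)) (sym (step-δ e)) (body l r x))
    where
    look : ∀ r {y} → TM.δ M q (hd M r) ≡ y → TM.δ M q (val (peek r)) ≡ y
    look []      e = e
    look (_ ∷ _) e = e
    body : ∀ l r x → stacksOf (cfg q l r) ⟪ transition q (peek r) (peek l) (just x) ⟫
          stacksOf (move M (proj₁ x) (proj₁ (proj₂ x)) (proj₂ (proj₂ x)) (cfg q l r))
    body l       []      (_ , _ , S) = popR (popR (pushR (pushR (pushR []))))
    body l       (_ ∷ _) (_ , _ , S) = popR (popR (pushR (pushR [])))
    body l       []      (_ , _ , R) = popR (popR (pushR (pushL (pushR []))))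
    body l       (_ ∷ _) (_ , _ , R) = popR (popR (pushL (pushR [])))
    body []      []      (_ , _ , L) = popR (popR (popL (pushR (pushL (pushR (pushR []))))))
    body []      (_ ∷ _) (_ , _ , L) = popR (popR (popL (pushL (pushR (pushR [])))))
    body (_ ∷ _) []      (_ , _ , L) = popR (popR (popL (pushR (pushR (pushR (pushR []))))))
    body (_ ∷ _) (_ ∷ _) (_ , _ , L) = popR (popR (popL (pushR (pushR (pushR [])))))

  accepting-run : ∀ c → Halted M c → TM.accept M (Config.state c) ≡ true →
                  Σ (List Sym) λ l → Σ (List Sym) λ r → stacksOf c ↦ (l , accepted ∷ r)
  accepting-run (cfg q l []) h acc = ends l , [] , by-rule (stepping q nothing nothing)
    (subst (λ y → stacksOf (cfg q l []) ⟪ transition q nothing nothing y ⟫ (ends l , accepted ∷ [])) (sym h) (body acc))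
    where
    body : TM.accept M q ≡ true → stacksOf (cfg q l []) ⟪ transition q nothing nothing nothing ⟫ (ends l , accepted ∷ [])
    body acc rewrite acc = popR (popR (pushR []))
  accepting-run (cfg q l (a ∷ r)) h acc = ends l , ends r , by-rule (stepping q (just a) nothing)
    (subst (λ y → stacksOf (cfg q l (a ∷ r)) ⟪ transition q (just a) nothing y ⟫ (ends l , accepted ∷ ends r)) (sym h) (body acc))
    where
    body : TM.accept M q ≡ true → stacksOf (cfg q l (a ∷ r)) ⟪ transition q (just a) nothing nothing ⟫ (ends l , accepted ∷ ends r)
    body acc rewrite acc = popR (popR (pushR []))

  run-simulated : ∀ t c → stacksOf c ↦[ t ] stacksOf (run M t c)
  run-simulated zero    c = stop
  run-simulated (suc t) c = by-cases _ refl
    where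
    by-cases : ∀ x → TM.δ M (Config.state c) (hd M (Config.right c)) ≡ x → stacksOf c ↦[ suc t ] stacksOf (run M t (step M c))
    by-cases (just _) e = transition-run c e ∷ run-simulated t (step M c)
    by-cases nothing  e = subst (λ c′ → stacksOf c ↦[ suc t ] stacksOf (run M t c′)) (sym (step-halted {c} e))
      (↦-weaken (n≤1+n t) (run-simulated t c))

  stuck : ∀ q h x y {a l r s} → (∀ {q} → a ≢ state q) → a ≢ bottom → (l , a ∷ r) ⟪ transition q h x y ⟫ s → ⊥
  stuck q h x nothing ≢q ≢⊥ run with TM.accept M q
  stuck q h x nothing ≢q ≢⊥ (popR _) | true  = ≢q refl
  stuck q h x nothing ≢q ≢⊥ (popR _) | false = ≢⊥ refl
  stuck q h x (just (_ , _ , L)) ≢q ≢⊥ (popR _) = ≢q refl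
  stuck q h x (just (_ , _ , R)) ≢q ≢⊥ (popR _) = ≢q refl
  stuck q h x (just (_ , _ , S)) ≢q ≢⊥ (popR _) = ≢q refl

  -- Rewinding and running on a fixed input

  module Input (w : List (Fin k)) (j : ℕ) where

    word : List Bool → List (Fin nΣ)
    word u = map (TM.inE M) (map inj₁ w ++ map inj₂ u)

    given : List Sym
    given = map (tape ∘ TM.inE M ∘ inj₁) w ʳ++ (bottom ∷ [])

    guessed : Stacks
    guessed = replicate j unknown ++ given , rewind ∷ bottom ∷ []

    -- The stages after guessing: certificate bits receive values, the head returns over the input,
    -- `M` runs, `M` has accepted. Throughout, `j` is the length of the full certificate.
    data Inv : Stacks → Set where
      bits    : ∀ i u → i + length u ≡ j → Inv (replicate i unknown ++ given , rewind ∷ ends (map bit u))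
      cells   : ∀ u ys zs → length u ≡ j → ys ʳ++ zs ≡ word u → Inv (ends ys , rewind ∷ ends zs)
      running : ∀ u t → length u ≡ j → Inv (stacksOf (run M t (initCfg M (map inj₁ w ++ map inj₂ u))))
      done    : ∀ u t {l r} → length u ≡ j → let c = run M t (initCfg M (map inj₁ w ++ map inj₂ u)) in
                Halted M c → TM.accept M (Config.state c) ≡ true → Inv (l , accepted ∷ r)

    run-suc : ∀ t c → run M (suc t) c ≡ step M (run M t c)
    run-suc zero    c = refl
    run-suc (suc t) c = run-suc t (step M c)

    given-ends : given ≡ ends (reverse (map (TM.inE M ∘ inj₁) w))
    given-ends = trans (cong (_ʳ++ (bottom ∷ [])) (map-∘ w)) (trans (ʳ++-defn (map tape ws))
      (cong (_++ bottom ∷ []) (sym (map-ʳ++ tape ws))))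
      where ws = map (TM.inE M ∘ inj₁) w

    word-split : ∀ u → reverse (map (TM.inE M ∘ inj₁) w) ʳ++ map bit u ≡ word u
    word-split u = trans (ʳ++-ʳ++ (map (TM.inE M ∘ inj₁) w))
      (sym (trans (map-++ (TM.inE M) (map inj₁ w) (map inj₂ u)) (cong₂ _++_ (sym (map-∘ w)) (sym (map-∘ u)))))

    closed-cells : ∀ r u ys zs {s} → length u ≡ j → ys ʳ++ zs ≡ word u →
                   (ends ys , rewind ∷ ends zs) ⟪ rule r ⟫ s → Inv s
    closed-cells (rewindCell a) u (y ∷ ys) zs eq e (popR (popL (pushR (pushR [])))) = cells u ys (y ∷ zs) eq e
    closed-cells (rewindCell a) u []       zs eq e (popR ())
    closed-cells (rewindBit b)  u []       zs eq e (popR ())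
    closed-cells (rewindBit b)  u (y ∷ ys) zs eq e (popR ())
    closed-cells rewound        u []       zs eq e (popR (popL (pushL (pushR []))))
      rewrite e = running u 0 eq
    closed-cells rewound        u (y ∷ ys) zs eq e (popR ())
    closed-cells (stepping q h x) u ys zs eq e run = ⊥-elim (stuck q h x (TM.δ M q (val h)) (λ ()) (λ ()) run)

    closed-rule : ∀ r {s s′} → Inv s → s ⟪ rule r ⟫ s′ → Inv s′
    closed-rule r (cells u ys zs eq e) run = closed-cells r u ys zs eq e run
    -- Without unknowns left, this stage is an instance of `cells`.
    closed-rule r {s′ = s′} (bits zero u eq) run = closed-cells r u _ (map bit u) eq (word-split u)
      (subst (λ l → (l , rewind ∷ ends (map bit u)) ⟪ rule r ⟫ s′) given-ends run)
    closed-rule (rewindBit b)  (bits (suc i) u eq) (popR (popL (pushR (pushR [])))) = bits i (b ∷ u) (trans (+-suc i (length u)) eq)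
    closed-rule (rewindCell a) (bits (suc i) u eq) (popR ())
    closed-rule rewound        (bits (suc i) u eq) (popR ())
    closed-rule (stepping q h x) (bits (suc i) u eq) run = ⊥-elim (stuck q h x (TM.δ M q (val h)) (λ ()) (λ ()) run)
    closed-rule (rewindCell a) (running u t eq) ()
    closed-rule (rewindBit b)  (running u t eq) ()
    closed-rule rewound        (running u t eq) ()
    closed-rule (stepping q h x) (running u t eq) run
      with transition-sound q h x _ _ _ run
    ... | inj₁ refl = subst (λ c → Inv (stacksOf c)) (run-suc t _) (running u (suc t) eq)
    ... | inj₂ (halted , acc , _ , _ , refl) = done u t eq halted acc
    closed-rule (rewindCell a) (done u t eq h acc) ()
    closed-rule (rewindBit b)  (done u t eq h acc) ()
    closed-rule rewound        (done u t eq h acc) ()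
    closed-rule (stepping q h x) (done u t eq _ _) run = ⊥-elim (stuck q h x (TM.δ M q (val h)) (λ ()) (λ ()) run)

    closed : ∀ {s s′} → Inv s → s ↦* s′ → Inv s′
    closed inv []      = inv
    closed inv (x ∷ p) = let r , run = rule-of x in closed (closed-rule r inv run) p

    bits-rewound : ∀ us v → (replicate (length us) unknown ++ given , rewind ∷ ends (map bit v)) ↦[ length us ]
                            (given , rewind ∷ ends (map bit (us ʳ++ v)))
    bits-rewound []       v = stop
    bits-rewound (b ∷ us) v = by-rule (rewindBit b) (popR (popL (pushR (pushR [])))) ∷ bits-rewound us (b ∷ v)

    cells-rewound : ∀ ys zs → (ends ys , rewind ∷ ends zs) ↦[ length ys ] (ends [] , rewind ∷ ends (ys ʳ++ zs))
    cells-rewound []       zs = stop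
    cells-rewound (y ∷ ys) zs = by-rule (rewindCell y) (popR (popL (pushR (pushR [])))) ∷ cells-rewound ys (y ∷ zs)

    simulation : ∀ u t → length u ≡ j → let c = run M t (initCfg M (map inj₁ w ++ map inj₂ u)) in
                 Halted M c → TM.accept M (Config.state c) ≡ true →
                 Σ (List Sym) λ l → Σ (List Sym) λ r → guessed ↦[ j + (length w + (1 + (t + 1))) ] (l , accepted ∷ r)
    simulation u t eq h acc with l , r , x ← accepting-run (run M t (initCfg M (map inj₁ w ++ map inj₂ u))) h acc =
      l , r , ↦-trans rewindBits (↦-trans rewindCells
        (↦-trans (by-rule rewound (popR (popL (pushL (pushR [])))) ∷ stop {n = 0}) (↦-trans (run-simulated t _) (x ∷ stop {n = 0}))))
      where
      ws = map (TM.inE M ∘ inj₁) w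
      rewindBits : guessed ↦[ j ] (given , rewind ∷ ends (map bit u))
      -- Rewinding meets the last bit first, hence the values are supplied by `reverse u`.
      rewindBits = subst₂ (λ n v → (replicate n unknown ++ given , rewind ∷ bottom ∷ []) ↦[ n ] (given , rewind ∷ ends (map bit v)))
        (trans (length-reverse u) eq) (trans (ʳ++-ʳ++ u) (++-identityʳ u)) (bits-rewound (reverse u) [])
      rewindCells : (given , rewind ∷ ends (map bit u)) ↦[ length w ] (ends [] , rewind ∷ ends (word u))
      rewindCells = subst₂ (λ l z → (l , rewind ∷ ends (map bit u)) ↦[ length w ] (ends [] , rewind ∷ ends z))
        (sym given-ends) (word-split u)
        (subst (λ n → (ends (reverse ws) , rewind ∷ ends (map bit u)) ↦[ n ] (ends [] , rewind ∷ ends (reverse ws ʳ++ map bit u)))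
          (trans (length-reverse ws) (length-map _ w)) (cells-rewound (reverse ws) (map bit u)))

  -- Fillers: mixed copies of the guessing block and the table

  guessTable : List Letter
  guessTable = blockCode guessing

  copies : List Letter → ℕ → List Letter
  copies u zero    = []
  copies u (suc n) = u ++ copies u n

  -- Only the two counts are kept: in every phase of the word at most one of the two kinds can act,
  -- so their order is irrelevant.
  data Mix : ℕ → ℕ → List Letter → Set where
    []      : Mix 0 0 []
    guess∷_ : ∀ {a c u} → Mix a c u → Mix (suc a) c (guessTable ++ u)
    step∷_  : ∀ {a c u} → Mix a c u → Mix a (suc c) (table ++ u)

  mix-++ : ∀ {a c a′ c′ u v} → Mix a c u → Mix a′ c′ v → Mix (a + a′) (c + c′) (u ++ v)
  mix-++ [] q = q
  mix-++ {a′ = a′} {c′} {v = v} (guess∷_ {a} {c} {u} p) q = subst (Mix (suc a + a′) (c + c′)) (sym (++-assoc guessTable u v)) (guess∷ mix-++ p q)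
  mix-++ {a′ = a′} {c′} {v = v} (step∷_ {a} {c} {u} p) q = subst (Mix (a + a′) (suc c + c′)) (sym (++-assoc table u v)) (step∷ mix-++ p q)

  guess-copies : ∀ n → Mix n 0 (copies guessTable n)
  guess-copies zero    = []
  guess-copies (suc n) = guess∷ guess-copies n

  step-copies : ∀ n → Mix 0 n (copies table n)
  step-copies zero    = []
  step-copies (suc n) = step∷ step-copies n

  table-skipped : ∀ {s} → loaded s ⟨ table ⟩* loaded s
  table-skipped {s} = tableOf-skipped rules {s}

  mix-skipped : ∀ {a c u s} → Mix a c u → loaded s ⟨ u ⟩* loaded s
  mix-skipped []         = []
  mix-skipped {s = s} (guess∷ p) = block-skipped {s} guessing +++ mix-skipped {s = s} p
  mix-skipped {s = s} (step∷ p)  = table-skipped {s} +++ mix-skipped {s = s} p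

  mix-steps : ∀ {a c u s s′} → Mix a c u → s ↦[ c ] s′ → loaded s ⟨ u ⟩* loaded s′
  mix-steps []         stop = []
  mix-steps {s = s} {s′} (guess∷ p) q = block-skipped {s} guessing +++ mix-steps {s = s} {s′} p q
  mix-steps {s = s} (step∷ p) stop = table-skipped {s} +++ mix-skipped {s = s} p
  mix-steps {s′ = s′} (step∷ p) (_∷_ {s′ = s₁} (_ , is∈ , run) q) = tableOf-run is∈ run +++ mix-steps {s = s₁} {s′} p q

  replicate-∷ : ∀ {A : Set} {x : A} {l} i → replicate i x ++ x ∷ l ≡ replicate (suc i) x ++ l
  replicate-∷ zero    = refl
  replicate-∷ (suc i) = cong (_ ∷_) (replicate-∷ i)

  mix-guesses : ∀ {a c u} i {l r} → Mix a c u → i ≤ a →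
                loaded (l , guess ∷ r) ⟨ u ⟩* loaded (replicate i unknown ++ l , guess ∷ r)
  mix-guesses zero    {l} {r} p _   = mix-skipped {s = l , guess ∷ r} p
  mix-guesses (suc i) {l} {r} (step∷ p) i≤a = table-skipped {l , guess ∷ r} +++ mix-guesses (suc i) {l} {r} p i≤a
  mix-guesses (suc i) {l} {r} (guess∷_ {u = u} p) (s≤s i≤a) =
    block-run {l , guess ∷ r} {unknown ∷ l , guess ∷ r} (popR (pushL (pushR []))) +++
    subst (λ l′ → loaded (unknown ∷ l , guess ∷ r) ⟨ u ⟩* loaded (l′ , guess ∷ r)) (replicate-∷ i)
      (mix-guesses i {unknown ∷ l} {r} p i≤a)

  no-rule : ∀ {l s} → ((l , []) ↦ s) → ⊥
  no-rule x with rule-of x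
  ... | stepping q h y , run = blocked (TM.δ M q (val h)) run
    where
    blocked : ∀ z {l s} → (l , []) ⟪ transition q h y z ⟫ s → ⊥
    blocked nothing run with TM.accept M q
    blocked nothing () | true
    blocked nothing () | false
    blocked (just (_ , _ , L)) ()
    blocked (just (_ , _ , R)) ()
    blocked (just (_ , _ , S)) ()

  no-rule-guess : ∀ {l r s} → ((l , guess ∷ r) ↦ s) → ⊥
  no-rule-guess x with rule-of x
  ... | stepping q h y , run = stuck q h y (TM.δ M q (val h)) (λ ()) (λ ()) run

  -- Every block begins with a pop from the right stack, so on an empty one each block must be
  -- skipped.
  mix-idle : ∀ {a c u l t} → Mix a c u → loaded (l , []) ⟨ u ⟩* t → t ≡ loaded (l , [])
  mix-idle [] [] = refl
  mix-idle {l = l} (guess∷ p) run with _ , r₁ , r₂ ← split-run guessTable run with block-sound {l , []} guessing r₁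
  ... | inj₁ refl = mix-idle {l = l} p r₂
  ... | inj₂ (_ , () , _)
  mix-idle {l = l} (step∷ p) run with _ , r₁ , r₂ ← split-run table run with table-only {l , []} r₁
  ... | _ , [] , refl  = mix-idle {l = l} p r₂
  ... | _ , x ∷ _ , _ = ⊥-elim (no-rule x)

  -- With `guess` on top, every rule fails at its first pop; each guessing block adds one `unknown`
  -- or none.
  mix-guess-only : ∀ {a c u l r t} → Mix a c u → loaded (l , guess ∷ r) ⟨ u ⟩* t →
                   Σ ℕ λ i → i ≤ a × t ≡ loaded (replicate i unknown ++ l , guess ∷ r)
  mix-guess-only [] [] = 0 , z≤n , refl
  mix-guess-only {l = l} {r} (step∷ p) run with _ , r₁ , r₂ ← split-run table run with table-only {l , guess ∷ r} r₁
  ... | _ , [] , refl  = mix-guess-only {l = l} {r} p r₂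
  ... | _ , x ∷ _ , _ = ⊥-elim (no-rule-guess x)
  mix-guess-only {l = l} {r} (guess∷ p) run with _ , r₁ , r₂ ← split-run guessTable run with block-sound {l , guess ∷ r} guessing r₁
  ... | inj₁ refl = let i , i≤a , e = mix-guess-only {l = l} {r} p r₂ in i , m≤n⇒m≤1+n i≤a , e
  ... | inj₂ (_ , popR (pushL (pushR [])) , refl) =
    let i , i≤a , e = mix-guess-only {l = unknown ∷ l} {r} p r₂ in
    suc i , s≤s i≤a , trans e (cong (λ l′ → loaded (l′ , guess ∷ r)) (replicate-∷ i))

  module _ (w : List (Fin k)) (j : ℕ) where
    open Input w j

    mix-step-only : ∀ {a c u s t} → Mix a c u → Inv s → loaded s ⟨ u ⟩* t → Σ Stacks λ s′ → Inv s′ × t ≡ loaded s′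
    mix-step-only {s = s} [] inv [] = s , inv , refl
    mix-step-only {s = s} (step∷ p) inv run with _ , r₁ , r₂ ← split-run table run with table-only {s} r₁
    ... | s₁ , xs , refl = mix-step-only {s = s₁} p (closed inv xs) r₂
    mix-step-only {s = s} (guess∷ p) inv run with _ , r₁ , r₂ ← split-run guessTable run with block-sound {s} guessing r₁
    ... | inj₁ refl = mix-step-only {s = s} p inv r₂
    ... | inj₂ (_ , x , _) = ⊥-elim (no-guess inv x)
      where
      no-guess : ∀ {s s′} → Inv s → s ⟪ guessing ⟫ s′ → ⊥
      no-guess (bits _ _ _)       ()
      no-guess (cells _ _ _ _ _)  ()
      no-guess (running _ _ _)    ()
      no-guess (done _ _ _ _ _)   ()

  -- The word produced by the reduction

  module Word (e : ℕ) (g h : ℕ → ℕ) where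

    D : ℕ
    D = suc e

    -- Emitted at the top level, hence once for each mark and from left to right. The copies at
    -- `mid` and `rend` stand for the empty subset, the zeroth term of Newton's formula.
    loading : Mark k → List Letter
    loading lend      = compile (pushL bottom ∷ [])
    loading (input i) = compile (pushL (tape (TM.inE M (inj₁ i))) ∷ [])
    loading mid       = compile (pushR bottom ∷ pushR guess ∷ []) ++ copies guessTable (g 0)
    loading rend      = compile (popR guess ∷ pushR rewind ∷ []) ++ copies table (h 0)

    -- Leaving aside the mark loaded last, a block below the top level belongs to a subset of
    -- `D ∸ n` cells, which explains the index of the weights.
    emitted : Mark k → ℕ → List Letter
    emitted x n = if does (n ≟ D) then loading x else copies guessTable (g (D ∸ n)) ++ copies table (h (D ∸ n))

    closing : List Letter
    closing = compile (popR accepted ∷ [])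

    open Odometer k 7 D (λ x n → map encLetter (emitted x n)) (map encLetter closing)
      using (output; marks; computed; computable) public

    letters : ℕ → List (Mark k) → List Letter
    letters zero    xs       = []
    letters (suc n) []       = []
    letters (suc n) (x ∷ xs) = letters (suc n) xs ++ emitted x (suc n) ++ letters n xs

    dec-enc-word : ∀ u → map decLetter (map encLetter u) ≡ u
    dec-enc-word u = trans (sym (map-∘ u)) (trans (map-cong dec-encLetter u) (map-id u))

    output-letters : ∀ n xs → map decLetter (output n xs) ≡ letters n xs
    output-letters zero    xs       = refl
    output-letters (suc n) []       = refl
    output-letters (suc n) (x ∷ xs) = trans (map-++ decLetter (output (suc n) xs) _) (cong₂ _++_ (output-letters (suc n) xs)
      (trans (map-++ decLetter (map encLetter (emitted x (suc n))) (output n xs))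
        (cong₂ _++_ (dec-enc-word (emitted x (suc n))) (output-letters n xs))))

    emitted-top : ∀ x → emitted x D ≡ loading x
    emitted-top x rewrite dec-true (D ≟ D) refl = refl

    emitted-below : ∀ x b {n} → suc b + n ≡ D → Mix (g (suc b)) (h (suc b)) (emitted x n)
    emitted-below x b {n} eq rewrite dec-false (n ≟ D) (λ n≡D → m+1+n≢n b (trans (+-suc b n) (trans eq (sym n≡D)))) | sym eq | m+n∸n≡m (suc b) n =
      subst (λ a → Mix a (h (suc b)) (copies guessTable (g (suc b)) ++ copies table (h (suc b))))
        (+-identityʳ (g (suc b))) (mix-++ (guess-copies (g (suc b))) (step-copies (h (suc b))))

    mix-letters : ∀ n b xs → suc b + n ≡ D → Mix (weighted g (suc b) n (length xs)) (weighted h (suc b) n (length xs)) (letters n xs)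
    mix-letters zero    b xs       eq = []
    mix-letters (suc n) b []       eq = []
    mix-letters (suc n) b (x ∷ xs) eq = mix-++ (mix-letters (suc n) b xs eq)
      (mix-++ (emitted-below x b eq) (mix-letters n (suc b) xs (trans (sym (+-suc (suc b) n)) eq)))

    Loads : List Letter → List Sym → Set
    Loads u l = loaded ([] , []) ⟨ u ⟩* loaded (l , []) × (∀ {t} → loaded ([] , []) ⟨ u ⟩* t → t ≡ loaded (l , []))

    -- The fillers that follow the mark are idle because the right stack is still empty; so the
    -- symbol is loaded in exactly one way.
    loads-mark : ∀ x a {ys l} → loading x ≡ compile (pushL a ∷ []) → Loads (letters D ys) l → Loads (letters D (x ∷ ys)) (a ∷ l)
    loads-mark x a {ys} {l} eq (run , only) rewrite emitted-top x | eq =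
      run +++ (compile-run {l , []} {a ∷ l , []} (pushL []) +++ mix-skipped {s = a ∷ l , []} idle) ,
      λ run′ → let _ , r₁ , r₂ = split-run (letters D ys) run′ in after-loading (only r₁) r₂
      where
      idle = mix-letters e 0 ys refl
      after-loading : ∀ {s t} → s ≡ loaded (l , []) → s ⟨ compile (pushL a ∷ []) ++ letters e ys ⟩* t → t ≡ loaded (a ∷ l , [])
      after-loading refl r₂ with _ , r₃ , r₄ ← split-run (compile (pushL a ∷ [])) r₂ with compile-sound {l , []} (pushL a ∷ []) r₃
      ... | _ , pushL [] , refl = mix-idle {l = a ∷ l} idle r₄

    loads-inputs : ∀ w {ys l} → Loads (letters D ys) l →
                   Loads (letters D (map input w ʳ++ ys)) (map (tape ∘ TM.inE M ∘ inj₁) w ʳ++ l)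
    loads-inputs []      ld = ld
    loads-inputs (i ∷ w) {ys} {l} ld = loads-inputs w {input i ∷ ys} {a ∷ l} (loads-mark (input i) a {ys} {l} refl ld)
      where a = tape (TM.inE M (inj₁ i))

    loads-given : ∀ w → Loads (letters D (map input w ʳ++ (lend ∷ []))) (Input.given w 0)
    loads-given w = loads-inputs w {lend ∷ []} {bottom ∷ []} (loads-mark lend bottom {[]} {[]} refl ([] , λ { [] → refl }))

    module _ (w : List (Fin k)) where

      inputs : List (Mark k)
      inputs = map input w ʳ++ (lend ∷ [])

      given : List Sym
      given = Input.given w 0

      -- Between `mid` and `rend` the subsets consist of cells to the left of `mid`; after `rend`
      -- they may also contain `mid`, whence the `suc`.
      guesses steps : ℕ
      guesses = g 0 + weighted g 1 e (length inputs)
      steps   = h 0 + weighted h 1 e (suc (length inputs))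

      guessPart stepPart : List Letter
      guessPart = copies guessTable (g 0) ++ letters e inputs
      stepPart  = copies table (h 0) ++ letters e (mid ∷ inputs)

      guessPart-mix : Mix guesses (weighted h 1 e (length inputs)) guessPart
      guessPart-mix = mix-++ (guess-copies (g 0)) (mix-letters e 0 inputs refl)

      stepPart-mix : Mix (weighted g 1 e (suc (length inputs))) steps stepPart
      stepPart-mix = mix-++ (step-copies (h 0)) (mix-letters e 0 (mid ∷ inputs) refl)

      toGuess toRewind : List Instr
      toGuess  = pushR bottom ∷ pushR guess ∷ []
      toRewind = popR guess ∷ pushR rewind ∷ []

      shape : map decLetter (computed w) ≡
              letters D inputs ++ compile toGuess ++ guessPart ++ compile toRewind ++ stepPart ++ closing
      shape = begin
        map decLetter (computed w)
          ≡⟨ map-++ decLetter (output D (marks w)) (map encLetter closing) ⟩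
        map decLetter (output D (marks w)) ++ map decLetter (map encLetter closing)
          ≡⟨ cong₂ _++_ (output-letters D (marks w)) (dec-enc-word closing) ⟩
        letters D (marks w) ++ closing
          ≡⟨ cong₂ (λ u v → ((A ++ u ++ letters e inputs) ++ v ++ letters e (mid ∷ inputs)) ++ closing) (emitted-top mid) (emitted-top rend) ⟩
        ((A ++ (B ++ G) ++ letters e inputs) ++ (C ++ T) ++ letters e (mid ∷ inputs)) ++ closing
          ≡⟨ cong₂ (λ u v → ((A ++ u) ++ v) ++ closing) (++-assoc B G (letters e inputs)) (++-assoc C T (letters e (mid ∷ inputs))) ⟩
        ((A ++ B ++ guessPart) ++ C ++ stepPart) ++ closing
          ≡⟨ ++-assoc (A ++ B ++ guessPart) (C ++ stepPart) closing ⟩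
        (A ++ B ++ guessPart) ++ (C ++ stepPart) ++ closing
          ≡⟨ cong ((A ++ B ++ guessPart) ++_) (++-assoc C stepPart closing) ⟩
        (A ++ B ++ guessPart) ++ C ++ stepPart ++ closing
          ≡⟨ ++-assoc A (B ++ guessPart) _ ⟩
        A ++ (B ++ guessPart) ++ C ++ stepPart ++ closing
          ≡⟨ cong (A ++_) (++-assoc B guessPart _) ⟩
        A ++ B ++ guessPart ++ C ++ stepPart ++ closing ∎
        where
        open ≡-Reasoning
        A = letters D inputs
        B = compile toGuess
        C = compile toRewind
        G = copies guessTable (g 0)
        T = copies table (h 0)

      complete-word : ∀ u t → length u ≤ guesses → length u + (length w + (1 + (t + 1))) ≤ steps →
        let c = run M t (initCfg M (map inj₁ w ++ map inj₂ u)) in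
        Halted M c → TM.accept M (Config.state c) ≡ true → Accepts (map decLetter (computed w))
      complete-word u t u≤ t≤ halted acc with l , r , sim ← Input.simulation w (length u) u t refl halted acc =
        ⌜ l ⌝ , ⌜ r ⌝ , subst (λ v → initial ⟨ v ⟩* (exec , ⌜ l ⌝ , ⌜ r ⌝)) (sym shape)
          (proj₁ (loads-given w) +++ (
           compile-run {given , []} {given , guess ∷ bottom ∷ []} (pushR (pushR [])) +++ (
           mix-guesses (length u) {given} {bottom ∷ []} guessPart-mix u≤ +++ (
           compile-run {_ , guess ∷ bottom ∷ []} {replicate (length u) unknown ++ given , rewind ∷ bottom ∷ []} (popR (pushR [])) +++ (
           mix-steps {s = Input.guessed w (length u)} {l , accepted ∷ r} stepPart-mix (↦-weaken t≤ sim) +++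
           compile-run {l , accepted ∷ r} {l , r} (popR []))))))

      -- The last letters pop `accepted`, which among the stages of `Inv` only `done` has on top;
      -- its certificate is as long as the number of guesses made, which the guessing phase bounds.
      sound-word : Accepts (map decLetter (computed w)) → Σ (List Bool) λ u → Σ ℕ λ t → length u ≤ guesses ×
        (let c = run M t (initCfg M (map inj₁ w ++ map inj₂ u)) in Halted M c × TM.accept M (Config.state c) ≡ true)
      sound-word (l , r , whole)
        with _ , r₁ , rest₁ ← split-run (letters D inputs) (subst (λ v → initial ⟨ v ⟩* (exec , l , r)) shape whole)
        with refl ← proj₂ (loads-given w) r₁
        with _ , r₂ , rest₂ ← split-run (compile toGuess) rest₁
        with compile-sound {given , []} toGuess r₂
      ... | _ , pushR (pushR []) , refl
        with _ , r₃ , rest₃ ← split-run guessPart rest₂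
        with j , j≤ , refl ← mix-guess-only {l = given} {bottom ∷ []} guessPart-mix r₃
        with _ , r₄ , rest₄ ← split-run (compile toRewind) rest₃
        with compile-sound {replicate j unknown ++ given , guess ∷ bottom ∷ []} toRewind r₄
      ... | _ , popR (pushR []) , refl
        with _ , r₅ , r₆ ← split-run stepPart rest₄
        with s , inv , refl ← mix-step-only w j {s = Input.guessed w j} stepPart-mix (Input.bits j [] (+-identityʳ j)) r₅
        with compile-sound {s} (popR accepted ∷ []) r₆
      ... | _ , final , _ = conclude inv final
        where
        conclude : ∀ {s s′} → Input.Inv w j s → s ⟪ popR accepted ∷ [] ⟫ s′ → Σ (List Bool) λ u → Σ ℕ λ t → length u ≤ guesses ×
          (let c = run M t (initCfg M (map inj₁ w ++ map inj₂ u)) in Halted M c × TM.accept M (Config.state c) ≡ true)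
        conclude (Input.done u t eq halted acc) (popR []) = u , t , ≤-trans (≤-reflexive eq) j≤ , halted , acc
        conclude (Input.bits _ _ _)      ()
        conclude (Input.cells _ _ _ _ _) ()
        conclude (Input.running _ _ _)   ()

-- NP-hardness

module _ {I O : Set} (M : TM I O) where

  run-+ : ∀ m n c → run M (m + n) c ≡ run M n (run M m c)
  run-+ zero    n c = refl
  run-+ (suc m) n c = run-+ m n (step M c)

  run-halted : ∀ n c → Halted M c → run M n c ≡ c
  run-halted zero    c h = refl
  run-halted (suc n) c h = trans (cong (run M n) stays) (run-halted n c h)
    where
    stays : step M c ≡ c
    stays rewrite h = refl

  -- Relates the moment at which the simulated run halts to the polynomial time at which the decider
  -- of `V` is inspected.
  halted-unique : ∀ m n {c} → Halted M (run M m c) → Halted M (run M n c) → run M m c ≡ run M n c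
  halted-unique m n {c} hm hn = trans (sym (run-halted n (run M m c) hm))
    (trans (trans (sym (run-+ m n c)) (trans (cong (λ t → run M t c) (+-comm m n)) (run-+ n m c))) (run-halted m (run M n c) hn))

accepts-NP-hard : NPHard (λ w → Accepts (map decLetter w))
accepts-NP-hard k P (V , (M , c₂ , d₂ , decides) , c₁ , d₁ , certified) =
  computed , computable , λ w → mk⇔ (forward w) (backward w)
  where
  -- The summands pay for rewinding the longest certificate, rewinding the input, starting `M`,
  -- running it on the longest input, and accepting.
  stepsNeeded : ℕ → ℕ
  stepsNeeded n = poly c₁ d₁ n + (n + (1 + (poly c₂ d₂ (n + poly c₁ d₁ n) + 1)))

  stepsNeeded-bounded : PolyBounded stepsNeeded
  stepsNeeded-bounded = bound-+ p₁ (bound-+ bound-id (bound-+ (bound-const 1) (bound-+ (bound-poly c₂ d₂ (bound-+ bound-id p₁)) (bound-const 1))))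
    where p₁ = bound-poly c₁ d₁ bound-id

  c₃ = proj₁ stepsNeeded-bounded
  d₃ = proj₁ (proj₂ stepsNeeded-bounded)

  open Simulation M
  -- One depth serves both polynomials, so it is the larger degree; differences beyond the smaller
  -- degree vanish.
  open Word (d₁ ⊔ d₃) (weight c₁ d₁) (weight c₃ d₃)

  length-inputs : ∀ w → length (inputs w) ≡ suc (length w)
  length-inputs w = trans (length-ʳ++ (map input w)) (trans (+-comm _ 1) (cong suc (length-map input w)))

  -- `lend` is a cell besides the letters of `w` and supplies the `suc` in `poly`. Both directions
  -- of the reduction use this: completeness bounds guesses from below, soundness from above.
  guesses≡ : ∀ w → guesses w ≡ poly c₁ d₁ (length w)
  guesses≡ w = trans (weighted-power c₁ d₁ (d₁ ⊔ d₃) (length (inputs w)) (m≤m⊔n d₁ d₃))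
    (cong (λ n → c₁ * n ^ d₁) (length-inputs w))

  -- An inequality is enough here: surplus tables can be skipped, and `M` does not change once it
  -- has halted.
  steps≥ : ∀ w → stepsNeeded (length w) ≤ steps w
  steps≥ w = ≤-trans (proj₂ (proj₂ stepsNeeded-bounded) (length w))
    (≤-trans (poly-mono c₃ d₃ (n≤1+n (length w)))
      (≤-reflexive (sym (trans (weighted-power c₃ d₃ (d₁ ⊔ d₃) (suc (length (inputs w))) (m≤n⊔m d₁ d₃))
        (cong (λ n → c₃ * suc n ^ d₃) (length-inputs w))))))

  input-length : ∀ w u → length (map inj₁ w ++ map inj₂ u) ≡ length w + length u
  input-length w u = trans (length-++ (map inj₁ w)) (cong₂ _+_ (length-map inj₁ w) (length-map inj₂ u))

  forward : ∀ w → P w → Accepts (map decLetter (computed w))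
  forward w p =
    let u , u≤ , v = to (certified w) p
        x = map inj₁ w ++ map inj₂ u
        halted , acc = decides x
    in complete-word w u (poly c₂ d₂ (length x)) (≤-trans u≤ (≤-reflexive (sym (guesses≡ w))))
         (≤-trans (+-mono-≤ u≤ (+-monoʳ-≤ (length w) (s≤s (+-monoˡ-≤ 1 (poly-mono c₂ d₂
           (≤-trans (≤-reflexive (input-length w u)) (+-monoʳ-≤ (length w) u≤))))))) (steps≥ w))
         halted (from acc v)

  backward : ∀ w → Accepts (map decLetter (computed w)) → P w
  backward w acc =
    let u , t , u≤ , halted , accepts = sound-word w acc
        x = map inj₁ w ++ map inj₂ u
        halted′ , decided = decides x
    in from (certified w) (u , ≤-trans u≤ (≤-reflexive (guesses≡ w)) ,
         to decided (trans (cong (TM.accept M ∘ Config.state)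
           (halted-unique M (poly c₂ d₂ (length x)) t halted′ halted)) accepts))

NP-complete-cong : ∀ {k} {P Q : Lang k} → (∀ w → P w ⇔ Q w) → NPComplete Q → NPComplete P
NP-complete-cong P⇔Q ((V , V-dec , c , d , cert) , hard) =
  (V , V-dec , c , d , λ w → mk⇔ (to (cert w) ∘ to (P⇔Q w)) (from (P⇔Q w) ∘ from (cert w))) ,
  λ k′ R R-NP → let f , f-computable , R⇔Q = hard k′ R R-NP in
    f , f-computable , λ w → mk⇔ (from (P⇔Q (f w)) ∘ to (R⇔Q w)) (from (R⇔Q w) ∘ to (P⇔Q (f w)))

theorem30 : Σ Grammar λ G → NPComplete (Generates G)
theorem30 = stackGrammar , NP-complete-cong generates⇔accepts (Verifier.accepts-NP , accepts-NP-hard)
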